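{- Let $a$, $b$, $c$ be pairwise coprime positive integers with $a+b+c$ even. Then for all integers $p,q\geq1$ and all $x,y,z\in\mathbb{R}$, \begin{align*} a^{1-p}b^{1-q}S_{p,q}(a,b,c:x,y,z) &=\sum_{j=1}^{p}\binom{p-1}{j-1}a^{1-j}c^{1+j-p-q}S_{p+q-j,j}(c,-a,b:z,x,y)\\ &\quad+\sum_{h=1}^{q}\binom{q-1}{h-1}(-1)^{h}b^{1-h}c^{1+h-p-q}S_{p+q-h,h}(c,b,a:z,-y,x). \end{align*}
   Context: $E_n(x)$ denotes the $n$th Euler polynomial, defined by $\frac{2e^{xt}}{e^t+1}=\sum_{n\ge0}E_n(x)\frac{t^n}{n!}$. The $n$th Euler function $\mathcal{E}_n$ ($n\ge0$) is defined by $\mathcal{E}_n(x)=E_n(x)$ for $0\le x<1$ and $\mathcal{E}_n(x+m)=(-1)^m\mathcal{E}_n(x)$ for $m\in\mathbb{Z}$. For integers $a,b$, a positive integer $c$, integers $p,q\ge1$ and real $x,y,z$, define $$S_{p,q}(a,b,c:x,y,z)=\sum_{\mu=0}^{c-1}(-1)^{\mu}\mathcal{E}_{p-1}\Big(a\frac{\mu+z}{c}+x\Big)\mathcal{E}_{q-1}\Big(b\frac{\mu+z}{c}+y\Big).$$ -}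

module Defs where

open import Algebra.Bundles using (CommutativeRing)
open import Algebra.Structures using (IsCommutativeRing)
open import Axiom.ExcludedMiddle using (ExcludedMiddle)
open import Data.Empty using (⊥-elim)
open import Data.Fin.Base using (Fin; zero; suc; toℕ)
open import Data.Integer.Base as ℤ using (ℤ; +_; -[1+_]; 1ℤ)
import Data.Integer.Properties as ℤₚ
open import Data.Nat.Base as ℕ using (ℕ; zero; suc; _!)
import Data.Nat.Properties as ℕₚ
open import Data.Product.Base using (∃; _×_; _,_; proj₁; proj₂)
open import Data.Rational.Base as ℚ using (ℚ; 0ℚ; 1ℚ; ½)
import Data.Rational.Properties as ℚₚ
open import Data.Rational.Solver using (module +-*-Solver)
import Data.Rational.Unnormalised.Base as ℚᵘ
import Data.Rational.Unnormalised.Properties as ℚᵘₚ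
open import Data.Vec.Base using (Vec; []; _∷_; head; lookup)
open import Level using (0ℓ)
open import Relation.Binary.Definitions using (tri<; tri≈; tri>)
open import Relation.Binary.PropositionalEquality as ≡ using (_≡_)
open import Relation.Nullary using (¬_; yes; no)

module Estimates where

  triangle : ∀ {ε} p q → ℚ.∣ p ∣ ℚ.< ε ℚ.* ½ → ℚ.∣ q ∣ ℚ.< ε ℚ.* ½ →
             ℚ.∣ p ℚ.+ q ∣ ℚ.< ε
  triangle {ε} p q p<ε/2 q<ε/2 = begin-strict
    ℚ.∣ p ℚ.+ q ∣         ≤⟨ ℚₚ.∣p+q∣≤∣p∣+∣q∣ p q ⟩
    ℚ.∣ p ∣ ℚ.+ ℚ.∣ q ∣   <⟨ ℚₚ.+-mono-< p<ε/2 q<ε/2 ⟩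
    ε ℚ.* ½ ℚ.+ ε ℚ.* ½   ≡⟨ ℚₚ.*-distribˡ-+ ε ½ ½ ⟨
    ε ℚ.* 1ℚ              ≡⟨ ℚₚ.*-identityʳ ε ⟩
    ε                     ∎
    where open ℚₚ.≤-Reasoning

  half-pos : ∀ {ε} → 0ℚ ℚ.< ε → 0ℚ ℚ.< ε ℚ.* ½
  half-pos {ε} 0<ε = ℚₚ.positive⁻¹ (ε ℚ.* ½) {{ℚₚ.pos*pos⇒pos ε {{ℚ.positive 0<ε}} ½}}

  pos+nonNeg : ∀ {p q} → 0ℚ ℚ.< p → 0ℚ ℚ.≤ q → 0ℚ ℚ.< p ℚ.+ q
  pos+nonNeg {p} {q} 0<p 0≤q = ℚₚ.<-≤-trans 0<p
    (≡.subst (ℚ._≤ p ℚ.+ q) (ℚₚ.+-identityʳ p) (ℚₚ.+-monoʳ-≤ p 0≤q))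

  diff-comm : ∀ p q → ℚ.∣ p ℚ.- q ∣ ≡ ℚ.∣ q ℚ.- p ∣
  diff-comm p q = ≡.trans (≡.cong ℚ.∣_∣ (solve 2 (λ a b → a :- b := :- (b :- a)) ≡.refl p q))
                          (ℚₚ.∣-p∣≡∣p∣ (q ℚ.- p))
    where open +-*-Solver

  diff-trans : ∀ {ε} p q r → ℚ.∣ p ℚ.- q ∣ ℚ.< ε ℚ.* ½ → ℚ.∣ q ℚ.- r ∣ ℚ.< ε ℚ.* ½ →
               ℚ.∣ p ℚ.- r ∣ ℚ.< ε
  diff-trans {ε} p q r pq qr = ≡.subst (λ d → ℚ.∣ d ∣ ℚ.< ε)
    (solve 3 (λ a b c → (a :- b) :+ (b :- c) := a :- c) ≡.refl p q r)
    (triangle (p ℚ.- q) (q ℚ.- r) pq qr)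
    where open +-*-Solver

  diff-+ : ∀ {ε} p p′ q q′ → ℚ.∣ p ℚ.- p′ ∣ ℚ.< ε ℚ.* ½ → ℚ.∣ q ℚ.- q′ ∣ ℚ.< ε ℚ.* ½ →
           ℚ.∣ (p ℚ.+ q) ℚ.- (p′ ℚ.+ q′) ∣ ℚ.< ε
  diff-+ {ε} p p′ q q′ hp hq = ≡.subst (λ d → ℚ.∣ d ∣ ℚ.< ε)
    (solve 4 (λ a a′ b b′ → (a :- a′) :+ (b :- b′) := (a :+ b) :- (a′ :+ b′)) ≡.refl p p′ q q′)
    (triangle (p ℚ.- p′) (q ℚ.- q′) hp hq)
    where open +-*-Solver

  diff-neg : ∀ {ε} p q → ℚ.∣ p ℚ.- q ∣ ℚ.< ε → ℚ.∣ ℚ.- p ℚ.- ℚ.- q ∣ ℚ.< ε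
  diff-neg {ε} p q = ≡.subst (ℚ._< ε)
    (≡.trans (diff-comm p q)
             (≡.cong ℚ.∣_∣ (solve 2 (λ a b → b :- a := (:- a) :- (:- b)) ≡.refl p q)))
    where open +-*-Solver

  shrink : (B : ℚ) → 0ℚ ℚ.< B → ℚ → ℚ
  shrink B 0<B ε = (ε ℚ.* ½) ℚ.* (ℚ.1/ B) {{ℚ.>-nonZero 0<B}}

  shrink-pos : ∀ B (0<B : 0ℚ ℚ.< B) {ε} → 0ℚ ℚ.< ε → 0ℚ ℚ.< shrink B 0<B ε
  shrink-pos B 0<B {ε} 0<ε = ℚₚ.positive⁻¹ _
    {{ℚₚ.pos*pos⇒pos (ε ℚ.* ½) {{ℚ.positive (half-pos 0<ε)}}
                     ((ℚ.1/ B) {{_}}) {{ℚₚ.1/pos⇒pos B {{ℚ.positive 0<B}}}}}}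

  bounded*small : ∀ B (0<B : 0ℚ ℚ.< B) {ε} p d →
                  ℚ.∣ p ∣ ℚ.< B → ℚ.∣ d ∣ ℚ.< shrink B 0<B ε → ℚ.∣ p ℚ.* d ∣ ℚ.< ε ℚ.* ½
  bounded*small B 0<B {ε} p d p<B d<δ = begin-strict
    ℚ.∣ p ℚ.* d ∣          ≡⟨ ℚₚ.∣p*q∣≡∣p∣*∣q∣ p d ⟩
    ℚ.∣ p ∣ ℚ.* ℚ.∣ d ∣    ≤⟨ ℚₚ.*-monoʳ-≤-nonNeg ℚ.∣ d ∣ {{ℚₚ.∣-∣-nonNeg d}} (ℚₚ.<⇒≤ p<B) ⟩
    B ℚ.* ℚ.∣ d ∣          <⟨ ℚₚ.*-monoʳ-<-pos B {{ℚ.positive 0<B}} d<δ ⟩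
    B ℚ.* ((ε ℚ.* ½) ℚ.* B⁻¹)  ≡⟨ solve 3 (λ b e i → b :* (e :* i) := e :* (b :* i)) ≡.refl B (ε ℚ.* ½) B⁻¹ ⟩
    (ε ℚ.* ½) ℚ.* (B ℚ.* B⁻¹)  ≡⟨ ≡.cong ((ε ℚ.* ½) ℚ.*_) (ℚₚ.*-inverseʳ B {{ℚ.>-nonZero 0<B}}) ⟩
    (ε ℚ.* ½) ℚ.* 1ℚ       ≡⟨ ℚₚ.*-identityʳ _ ⟩
    ε ℚ.* ½                ∎
    where
    open ℚₚ.≤-Reasoning
    open +-*-Solver
    B⁻¹ = (ℚ.1/ B) {{ℚ.>-nonZero 0<B}}

  diff-* : ∀ B (0<B : 0ℚ ℚ.< B) {ε} p p′ q q′ → ℚ.∣ p ∣ ℚ.< B → ℚ.∣ q′ ∣ ℚ.< B →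
           ℚ.∣ p ℚ.- p′ ∣ ℚ.< shrink B 0<B ε → ℚ.∣ q ℚ.- q′ ∣ ℚ.< shrink B 0<B ε →
           ℚ.∣ p ℚ.* q ℚ.- p′ ℚ.* q′ ∣ ℚ.< ε
  diff-* B 0<B {ε} p p′ q q′ p<B q′<B hp hq = ≡.subst (λ d → ℚ.∣ d ∣ ℚ.< ε)
    (solve 4 (λ a a′ b b′ → a :* (b :- b′) :+ b′ :* (a :- a′) := a :* b :- a′ :* b′) ≡.refl p p′ q q′)
    (triangle (p ℚ.* (q ℚ.- q′)) (q′ ℚ.* (p ℚ.- p′))
      (bounded*small B 0<B {ε} p (q ℚ.- q′) p<B hq)
      (bounded*small B 0<B {ε} q′ (p ℚ.- p′) q′<B hp))
    where open +-*-Solver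

  i≤∣i∣ : ∀ i → i ℤ.≤ + ℤ.∣ i ∣
  i≤∣i∣ (+ n)    = ℤₚ.≤-refl
  i≤∣i∣ -[1+ n ] = ℤ.-≤+

  p≤∣p∣ : ∀ p → p ℚ.≤ ℚ.∣ p ∣
  p≤∣p∣ p@record{} = ℚ.*≤* (ℤₚ.*-monoʳ-≤-nonNeg (ℚ.↧ p) (i≤∣i∣ (ℚ.↥ p)))

  gap : ∀ {ε} x y x′ y′ → x ℚ.+ ε ℚ.< y → ℚ.∣ (y ℚ.- x) ℚ.- (y′ ℚ.- x′) ∣ ℚ.< ε ℚ.* ½ →
        x′ ℚ.+ ε ℚ.* ½ ℚ.< y′
  gap {ε} x y x′ y′ x+ε<y d<ε/2 = begin-strict
    x′ ℚ.+ ε ℚ.* ½                          ≡⟨ solve 3 (λ a b e → b :+ e :* con ½ := (a :+ e) :+ ((b :- a) :- e :* con ½)) ≡.refl x x′ ε ⟩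
    (x ℚ.+ ε) ℚ.+ ((x′ ℚ.- x) ℚ.- ε ℚ.* ½)  <⟨ ℚₚ.+-mono-<-≤ x+ε<y (ℚₚ.+-monoʳ-≤ (x′ ℚ.- x) (ℚₚ.neg-antimono-≤ d≤ε/2)) ⟩
    y ℚ.+ ((x′ ℚ.- x) ℚ.- d)                ≡⟨ solve 4 (λ a b a′ b′ → b :+ ((a′ :- a) :- ((b :- a) :- (b′ :- a′))) := b′) ≡.refl x y x′ y′ ⟩
    y′                                      ∎
    where
    open ℚₚ.≤-Reasoning
    open +-*-Solver
    d = (y ℚ.- x) ℚ.- (y′ ℚ.- x′)
    d≤ε/2 : d ℚ.≤ ε ℚ.* ½
    d≤ε/2 = ℚₚ.≤-trans (p≤∣p∣ d) (ℚₚ.<⇒≤ d<ε/2)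

open Estimates

------------------------------------------------------------------------
-- The real numbers: Cauchy sequences of rationals, as a setoid

Eventually : (ℕ → Set) → Set
Eventually P = ∃ λ N → ∀ n → N ℕ.≤ n → P n

IsCauchy : (ℕ → ℚ) → Set
IsCauchy s = ∀ ε → 0ℚ ℚ.< ε →
  ∃ λ N → ∀ m n → N ℕ.≤ m → N ℕ.≤ n → ℚ.∣ s m ℚ.- s n ∣ ℚ.< ε

record ℝ : Set where
  no-eta-equality
  constructor mkℝ
  field
    seq    : ℕ → ℚ
    cauchy : IsCauchy seq

open ℝ public

infix 4 _≈_ _<_ _≤_

record _≈_ (x y : ℝ) : Set where
  constructor mk≈
  field
    close : ∀ ε → 0ℚ ℚ.< ε → Eventually λ n → ℚ.∣ seq x n ℚ.- seq y n ∣ ℚ.< ε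

open _≈_ public

record _<_ (x y : ℝ) : Set where
  constructor mk<
  field
    margin   : ℚ
    0<margin : 0ℚ ℚ.< margin
    apart    : Eventually λ n → seq x n ℚ.+ margin ℚ.< seq y n

open _<_ public

_≤_ : ℝ → ℝ → Set
x ≤ y = ¬ (y < x)

private abstract
  const-cauchy : ∀ q → IsCauchy (λ _ → q)
  const-cauchy q ε 0<ε = 0 , λ _ _ _ _ →
    ≡.subst (λ d → ℚ.∣ d ∣ ℚ.< ε) (≡.sym (ℚₚ.+-inverseʳ q)) 0<ε

fromℚ : ℚ → ℝ
fromℚ q = mkℝ (λ _ → q) (const-cauchy q)

fromℤ : ℤ → ℝ
fromℤ i = fromℚ (i ℚ./ 1)

fromℕ : ℕ → ℝ
fromℕ n = fromℤ (+ n)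

0ℝ 1ℝ : ℝ
0ℝ = fromℚ 0ℚ
1ℝ = fromℚ 1ℚ

module Bounds where

  both : ∀ {P Q R : ℕ → Set} → (∀ n → P n → Q n → R n) →
         Eventually P → Eventually Q → Eventually R
  both f (M , p) (N , q) = M ℕ.⊔ N , λ n h →
    f n (p n (ℕₚ.≤-trans (ℕₚ.m≤m⊔n M N) h)) (q n (ℕₚ.≤-trans (ℕₚ.m≤n⊔m M N) h))

  bound : ∀ x → ∃ λ B → 0ℚ ℚ.< B × Eventually λ n → ℚ.∣ seq x n ∣ ℚ.< B
  bound x with cauchy x 1ℚ (ℚₚ.positive⁻¹ 1ℚ)
  ... | N , h = 1ℚ ℚ.+ ℚ.∣ s ∣ , 0<B , N , λ n N≤n → begin-strict
      ℚ.∣ seq x n ∣                          ≡⟨ ≡.cong ℚ.∣_∣ (solve 2 (λ a b → a := (a :- b) :+ b) ≡.refl (seq x n) s) ⟩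
      ℚ.∣ (seq x n ℚ.- s) ℚ.+ s ∣            ≤⟨ ℚₚ.∣p+q∣≤∣p∣+∣q∣ (seq x n ℚ.- s) s ⟩
      ℚ.∣ seq x n ℚ.- s ∣ ℚ.+ ℚ.∣ s ∣        <⟨ ℚₚ.+-monoˡ-< ℚ.∣ s ∣ (h n N N≤n ℕₚ.≤-refl) ⟩
      1ℚ ℚ.+ ℚ.∣ s ∣                         ∎
    where
    open ℚₚ.≤-Reasoning
    open +-*-Solver
    s = seq x N
    0<B : 0ℚ ℚ.< 1ℚ ℚ.+ ℚ.∣ s ∣
    0<B = pos+nonNeg (ℚₚ.positive⁻¹ 1ℚ) (ℚₚ.0≤∣p∣ s)

  bound₂ : ∀ x y → ∃ λ B → 0ℚ ℚ.< B ×
           Eventually λ n → ℚ.∣ seq x n ∣ ℚ.< B × ℚ.∣ seq y n ∣ ℚ.< B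
  bound₂ x y =
    let A , 0<A , hx = bound x
        B , 0<B , hy = bound y
        A<A+B = ≡.subst (ℚ._< A ℚ.+ B) (ℚₚ.+-identityʳ A) (ℚₚ.+-monoʳ-< A 0<B)
        B<A+B = ≡.subst (ℚ._< A ℚ.+ B) (ℚₚ.+-identityˡ B) (ℚₚ.+-monoˡ-< B 0<A)
    in A ℚ.+ B , pos+nonNeg 0<A (ℚₚ.<⇒≤ 0<B) ,
       both (λ n p q → ℚₚ.<-trans p A<A+B , ℚₚ.<-trans q B<A+B) hx hy

open Bounds

infixl 6 _+_ _-_
infixl 7 _*_
infix  8 -_

private abstract
  +-cauchy : ∀ x y → IsCauchy (λ n → seq x n ℚ.+ seq y n)
  +-cauchy x y ε 0<ε =
    let M , hx = cauchy x (ε ℚ.* ½) (half-pos 0<ε)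
        N , hy = cauchy y (ε ℚ.* ½) (half-pos 0<ε)
    in M ℕ.⊔ N , λ m n hm hn →
       diff-+ (seq x m) (seq x n) (seq y m) (seq y n)
         (hx m n (ℕₚ.m⊔n≤o⇒m≤o M N hm) (ℕₚ.m⊔n≤o⇒m≤o M N hn))
         (hy m n (ℕₚ.m⊔n≤o⇒n≤o M N hm) (ℕₚ.m⊔n≤o⇒n≤o M N hn))

  neg-cauchy : ∀ x → IsCauchy (λ n → ℚ.- seq x n)
  neg-cauchy x ε 0<ε =
    let N , h = cauchy x ε 0<ε
    in N , λ m n hm hn → diff-neg (seq x m) (seq x n) (h m n hm hn)

  *-cauchy : ∀ x y → IsCauchy (λ n → seq x n ℚ.* seq y n)
  *-cauchy x y ε 0<ε =
    let B , 0<B , K , b = bound₂ x y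
        δ   = shrink B 0<B ε
        0<δ = shrink-pos B 0<B 0<ε
        M , hx = cauchy x δ 0<δ
        N , hy = cauchy y δ 0<δ
    in K ℕ.⊔ (M ℕ.⊔ N) , λ m n hm hn →
       let hm′ = ℕₚ.m⊔n≤o⇒n≤o K (M ℕ.⊔ N) hm
           hn′ = ℕₚ.m⊔n≤o⇒n≤o K (M ℕ.⊔ N) hn
       in diff-* B 0<B (seq x m) (seq x n) (seq y m) (seq y n)
            (proj₁ (b m (ℕₚ.m⊔n≤o⇒m≤o K (M ℕ.⊔ N) hm)))
            (proj₂ (b n (ℕₚ.m⊔n≤o⇒m≤o K (M ℕ.⊔ N) hn)))
            (hx m n (ℕₚ.m⊔n≤o⇒m≤o M N hm′) (ℕₚ.m⊔n≤o⇒m≤o M N hn′))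
            (hy m n (ℕₚ.m⊔n≤o⇒n≤o M N hm′) (ℕₚ.m⊔n≤o⇒n≤o M N hn′))

_+_ : ℝ → ℝ → ℝ
x + y = mkℝ (λ n → seq x n ℚ.+ seq y n) (+-cauchy x y)

-_ : ℝ → ℝ
- x = mkℝ (λ n → ℚ.- seq x n) (neg-cauchy x)

_-_ : ℝ → ℝ → ℝ
x - y = x + - y

_*_ : ℝ → ℝ → ℝ
x * y = mkℝ (λ n → seq x n ℚ.* seq y n) (*-cauchy x y)

≗⇒≈ : ∀ {x y} → (∀ n → seq x n ≡ seq y n) → x ≈ y
≗⇒≈ {x} {y} eq = mk≈ λ ε 0<ε → 0 , λ n _ → ≡.subst (λ d → ℚ.∣ d ∣ ℚ.< ε)
  (≡.sym (≡.trans (≡.cong (ℚ._- seq y n) (eq n)) (ℚₚ.+-inverseʳ (seq y n)))) 0<ε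

≈-refl : ∀ {x} → x ≈ x
≈-refl = ≗⇒≈ λ _ → ≡.refl

≈-sym : ∀ {x y} → x ≈ y → y ≈ x
≈-sym {x} {y} x≈y = mk≈ λ ε 0<ε →
  let N , h = close x≈y ε 0<ε
  in N , λ n N≤n → ≡.subst (ℚ._< ε) (diff-comm (seq x n) (seq y n)) (h n N≤n)

≈-trans : ∀ {x y z} → x ≈ y → y ≈ z → x ≈ z
≈-trans {x} {y} {z} x≈y y≈z = mk≈ λ ε 0<ε →
  both (λ n → diff-trans (seq x n) (seq y n) (seq z n))
    (close x≈y (ε ℚ.* ½) (half-pos 0<ε)) (close y≈z (ε ℚ.* ½) (half-pos 0<ε))

+-cong : ∀ {x x′ y y′} → x ≈ x′ → y ≈ y′ → x + y ≈ x′ + y′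
+-cong {x} {x′} {y} {y′} x≈x′ y≈y′ = mk≈ λ ε 0<ε →
  both (λ n → diff-+ (seq x n) (seq x′ n) (seq y n) (seq y′ n))
    (close x≈x′ (ε ℚ.* ½) (half-pos 0<ε)) (close y≈y′ (ε ℚ.* ½) (half-pos 0<ε))

-‿cong : ∀ {x y} → x ≈ y → - x ≈ - y
-‿cong {x} {y} x≈y = mk≈ λ ε 0<ε →
  let N , h = close x≈y ε 0<ε
  in N , λ n N≤n → diff-neg (seq x n) (seq y n) (h n N≤n)

*-cong : ∀ {x x′ y y′} → x ≈ x′ → y ≈ y′ → x * y ≈ x′ * y′
*-cong {x} {x′} {y} {y′} x≈x′ y≈y′ = mk≈ λ ε 0<ε →
  let B , 0<B , b = bound₂ x y′
      δ   = shrink B 0<B ε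
      0<δ = shrink-pos B 0<B 0<ε
  in both (λ n (p , q) (hx , hy) →
         diff-* B 0<B (seq x n) (seq x′ n) (seq y n) (seq y′ n) p q hx hy)
       b (both (λ _ → _,_) (close x≈x′ δ 0<δ) (close y≈y′ δ 0<δ))

+-*-isCommutativeRing : IsCommutativeRing _≈_ _+_ _*_ -_ 0ℝ 1ℝ
+-*-isCommutativeRing = record
  { isRing = record
    { +-isAbelianGroup = record
      { isGroup = record
        { isMonoid = record
          { isSemigroup = record
            { isMagma = record
              { isEquivalence = record { refl = ≈-refl ; sym = ≈-sym ; trans = ≈-trans }
              ; ∙-cong = +-cong
              }
            ; assoc = λ x y z → ≗⇒≈ λ n → ℚₚ.+-assoc (seq x n) (seq y n) (seq z n)
            }
          ; identity = (λ x → ≗⇒≈ λ n → ℚₚ.+-identityˡ (seq x n))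
                     , (λ x → ≗⇒≈ λ n → ℚₚ.+-identityʳ (seq x n))
          }
        ; inverse = (λ x → ≗⇒≈ λ n → ℚₚ.+-inverseˡ (seq x n))
                  , (λ x → ≗⇒≈ λ n → ℚₚ.+-inverseʳ (seq x n))
        ; ⁻¹-cong = -‿cong
        }
      ; comm = λ x y → ≗⇒≈ λ n → ℚₚ.+-comm (seq x n) (seq y n)
      }
    ; *-cong = *-cong
    ; *-assoc = λ x y z → ≗⇒≈ λ n → ℚₚ.*-assoc (seq x n) (seq y n) (seq z n)
    ; *-identity = (λ x → ≗⇒≈ λ n → ℚₚ.*-identityˡ (seq x n))
                 , (λ x → ≗⇒≈ λ n → ℚₚ.*-identityʳ (seq x n))
    ; distrib = (λ x y z → ≗⇒≈ λ n → ℚₚ.*-distribˡ-+ (seq x n) (seq y n) (seq z n))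
              , (λ x y z → ≗⇒≈ λ n → ℚₚ.*-distribʳ-+ (seq x n) (seq y n) (seq z n))
    }
  ; *-comm = λ x y → ≗⇒≈ λ n → ℚₚ.*-comm (seq x n) (seq y n)
  }

+-*-commutativeRing : CommutativeRing 0ℓ 0ℓ
+-*-commutativeRing = record { isCommutativeRing = +-*-isCommutativeRing }

private module R = CommutativeRing +-*-commutativeRing

open import Algebra.Properties.Semiring.Exp R.semiring public using (_^_; ^-congˡ)
open import Algebra.Properties.Semiring.Sum R.semiring public using (sum; sum-syntax; sum-cong-≋)
open import Relation.Binary.Reasoning.Setoid R.setoid

infixl 7 _÷_

_÷_ : ℝ → (c : ℕ) .{{_ : ℕ.NonZero c}} → ℝ
x ÷ c = x * fromℚ (1ℤ ℚ./ c)

infixr 8 _^ᶻ_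

_^ᶻ_ : (a : ℕ) .{{_ : ℕ.NonZero a}} → ℤ → ℝ
a ^ᶻ (+ n)    = fromℕ a ^ n
a ^ᶻ -[1+ n ] = (1ℝ ÷ a) ^ suc n

------------------------------------------------------------------------
-- Formal power series in t over ℝ; f n is the coefficient of tⁿ

Series : Set
Series = ℕ → ℝ

infix  4 _≋_
infixl 6 _⊕_
infixl 7 _⊛_

_≋_ : Series → Series → Set
f ≋ g = ∀ n → f n ≈ g n

_⊕_ : Series → Series → Series
(f ⊕ g) n = f n + g n

_⊛_ : Series → Series → Series
(f ⊛ g) n = ∑[ k < suc n ] (f (toℕ k) * g (n ℕ.∸ toℕ k))

one : Series
one zero    = 1ℝ
one (suc _) = 0ℝ

-- Exponential generating function ∑ sₙ tⁿ/n!
egf : (ℕ → ℝ) → Series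
egf s n = (s n ÷ n !) {{n ℕₚ.!≢0}}

-- e^{xt}
exp : ℝ → Series
exp x = egf (x ^_)

-- Long division of f by g, where u is the inverse of g 0. The quotient q
-- solves ∑ₖ g k · q (n ∸ k) = f n; quotients n holds q (n-1), …, q 0.
module Division (u : ℝ) (f g : Series) where

  quotients : ∀ n → Vec ℝ n
  quotients zero    = []
  quotients (suc n) =
    u * (f n - ∑[ i < n ] (g (suc (toℕ i)) * lookup (quotients n) i)) ∷ quotients n

  quotient : Series
  quotient n = head (quotients (suc n))

  private
    lookup-quotients : ∀ n (i : Fin n) → lookup (quotients n) i ≡ quotient (n ℕ.∸ suc (toℕ i))
    lookup-quotients (suc n) zero    = ≡.refl
    lookup-quotients (suc n) (suc i) = lookup-quotients n i

  quotient-correct : g 0 * u ≈ 1ℝ → g ⊛ quotient ≋ f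
  quotient-correct gu≈1 n = begin
    g 0 * (u * (f n - s)) + ∑[ i < n ] (g (suc (toℕ i)) * quotient (n ℕ.∸ suc (toℕ i)))
      ≈⟨ R.+-cong (R.*-assoc (g 0) u (f n - s))
          (sum-cong-≋ {n} λ i → R.reflexive (≡.cong (g (suc (toℕ i)) *_) (lookup-quotients n i))) ⟨
    g 0 * u * (f n - s) + s   ≈⟨ R.+-congʳ (R.*-congʳ gu≈1) ⟩
    1ℝ * (f n - s) + s        ≈⟨ R.+-congʳ (R.*-identityˡ (f n - s)) ⟩
    f n - s + s               ≈⟨ R.+-assoc (f n) (- s) s ⟩
    f n + (- s + s)           ≈⟨ R.+-congˡ (R.-‿inverseˡ s) ⟩
    f n + 0ℝ                  ≈⟨ R.+-identityʳ (f n) ⟩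
    f n                       ∎
    where s = ∑[ i < n ] (g (suc (toℕ i)) * lookup (quotients n) i)

------------------------------------------------------------------------
-- Euler polynomials: 2e^{xt} / (e^t + 1) = ∑ Eₙ(x) tⁿ/n!
-- The divisor e^t + 1 has constant term 2.

2exp : ℝ → Series
2exp x n = fromℕ 2 * exp x n

1+exp : Series
1+exp = exp 1ℝ ⊕ one

E : ℕ → ℝ → ℝ
E n x = fromℕ (n !) * Division.quotient (fromℚ ½) (2exp x) 1+exp n

n/n≡1 : ∀ n .{{_ : ℕ.NonZero n}} → (+ n ℚ./ 1) ℚ.* (1ℤ ℚ./ n) ≡ 1ℚ
n/n≡1 n@(suc _) = ℚₚ.toℚᵘ-injective (ℚᵘₚ.≃-trans (ℚₚ.toℚᵘ-homo-* (+ n ℚ./ 1) (1ℤ ℚ./ n))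
  (ℚᵘₚ.≃-trans (ℚᵘₚ.*-cong (ℚₚ.toℚᵘ-fromℚᵘ (+ n ℚᵘ./ 1)) (ℚₚ.toℚᵘ-fromℚᵘ (1ℤ ℚᵘ./ n)))
    (ℚᵘ.*≡* (≡.trans (ℤₚ.*-identityʳ _) (≡.trans (ℤₚ.*-identityʳ (+ n)) (≡.sym
      (≡.trans (ℤₚ.*-identityˡ _) (≡.cong +_ (ℕₚ.*-identityˡ n)))))))))

n*x÷n≈x : ∀ n .{{_ : ℕ.NonZero n}} x → fromℕ n * x ÷ n ≈ x
n*x÷n≈x n x = begin
  fromℕ n * x * n⁻¹    ≈⟨ R.*-congʳ (R.*-comm (fromℕ n) x) ⟩
  x * fromℕ n * n⁻¹    ≈⟨ R.*-assoc x (fromℕ n) n⁻¹ ⟩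
  x * (fromℕ n * n⁻¹)  ≈⟨ R.*-congˡ (≗⇒≈ λ _ → n/n≡1 n) ⟩
  x * 1ℝ               ≈⟨ R.*-identityʳ x ⟩
  x                    ∎
  where n⁻¹ = fromℚ (1ℤ ℚ./ n)

E-generating : ∀ x → 1+exp ⊛ egf (λ n → E n x) ≋ 2exp x
E-generating x n = begin
  (1+exp ⊛ egf (λ n → E n x)) n
    ≈⟨ sum-cong-≋ {suc n} (λ k → R.*-congˡ {1+exp (toℕ k)}
         (n*x÷n≈x ((n ℕ.∸ toℕ k) !) {{(n ℕ.∸ toℕ k) ℕₚ.!≢0}} (quotient (n ℕ.∸ toℕ k)))) ⟩
  (1+exp ⊛ quotient) n
    ≈⟨ quotient-correct (≗⇒≈ λ _ → ≡.refl) n ⟩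
  2exp x n ∎
  where open Division (fromℚ ½) (2exp x) 1+exp

------------------------------------------------------------------------
-- Euler functions

-- ℰ is discontinuous, so it cannot be defined as a total function on ℝ without
-- a classical principle deciding integer parts; the defining conditions are
-- therefore stated as a predicate (see eulerFunction-exists for its
-- inhabitation). The first field is well-definedness on the setoid ℝ.
record IsEulerFunction (n : ℕ) (ℰ : ℝ → ℝ) : Set where
  field
    cong         : ∀ {x y} → x ≈ y → ℰ x ≈ ℰ y
    on-unit      : ∀ x → 0ℝ ≤ x → x < 1ℝ → ℰ x ≈ E n x
    antiperiodic : ∀ x m → ℰ (x + fromℤ m) ≈ (- 1ℝ) ^ ℤ.∣ m ∣ * ℰ x

-- Intended for p, q ≥ 1.
S : (ℰ : ℕ → ℝ → ℝ) (p q : ℕ) (a b : ℤ) (c : ℕ) .{{_ : ℕ.NonZero c}} (x y z : ℝ) → ℝ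
S ℰ p q a b c x y z = ∑[ μ < c ]
  ( (- 1ℝ) ^ toℕ μ
  * ℰ (p ℕ.∸ 1) (fromℤ a * ((fromℕ (toℕ μ) + z) ÷ c) + x)
  * ℰ (q ℕ.∸ 1) (fromℤ b * ((fromℕ (toℕ μ) + z) ÷ c) + y)
  )

∑₁ : ℕ → (ℕ → ℝ) → ℝ
∑₁ n f = ∑[ i < n ] f (suc (toℕ i))

syntax ∑₁ n (λ j → x) = ∑[1≤ j ≤ n ] x

------------------------------------------------------------------------
-- Existence of the Euler functions from excluded middle

module IntegerParts where

  <-transport : ∀ {x y x′ y′} → y - x ≈ y′ - x′ → x < y → x′ < y′
  <-transport {x} {y} {x′} {y′} eq (mk< ε 0<ε h) = mk< (ε ℚ.* ½) (half-pos 0<ε)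
    (both (λ n → gap (seq x n) (seq y n) (seq x′ n) (seq y′ n)) h (close eq (ε ℚ.* ½) (half-pos 0<ε)))

  <-respˡ : ∀ {x x′ y} → x ≈ x′ → x < y → x′ < y
  <-respˡ x≈x′ = <-transport (R.+-congˡ (-‿cong x≈x′))

  /1-homo-+ : ∀ i j → (i ℤ.+ j) ℚ./ 1 ≡ i ℚ./ 1 ℚ.+ j ℚ./ 1
  /1-homo-+ i j = ℚₚ.toℚᵘ-injective (ℚᵘₚ.≃-trans (ℚₚ.toℚᵘ-fromℚᵘ ((i ℤ.+ j) ℚᵘ./ 1))
    (ℚᵘₚ.≃-trans (ℚᵘ.*≡* (≡.cong (ℤ._* 1ℤ) (≡.cong₂ ℤ._+_ (≡.sym (ℤₚ.*-identityʳ i)) (≡.sym (ℤₚ.*-identityʳ j)))))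
    (ℚᵘₚ.≃-trans (ℚᵘₚ.+-cong (ℚᵘₚ.≃-sym (ℚₚ.toℚᵘ-fromℚᵘ (i ℚᵘ./ 1))) (ℚᵘₚ.≃-sym (ℚₚ.toℚᵘ-fromℚᵘ (j ℚᵘ./ 1))))
                 (ℚᵘₚ.≃-sym (ℚₚ.toℚᵘ-homo-+ (i ℚ./ 1) (j ℚ./ 1))))))

  /1-mono : ∀ {i j} → i ℤ.≤ j → i ℚ./ 1 ℚ.≤ j ℚ./ 1
  /1-mono {i} {j} i≤j = ℚₚ.toℚᵘ-cancel-≤
    (ℚᵘₚ.≤-respʳ-≃ (ℚᵘₚ.≃-sym (ℚₚ.toℚᵘ-fromℚᵘ (j ℚᵘ./ 1)))
    (ℚᵘₚ.≤-respˡ-≃ (ℚᵘₚ.≃-sym (ℚₚ.toℚᵘ-fromℚᵘ (i ℚᵘ./ 1)))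
      (ℚᵘ.*≤* (ℤₚ.*-monoʳ-≤-nonNeg 1ℤ i≤j))))

  p≤∣↥p∣ : ∀ p → p ℚ.≤ + ℤ.∣ ℚ.↥ p ∣ ℚ./ 1
  p≤∣↥p∣ p@record{} = ℚₚ.toℚᵘ-cancel-≤
    (ℚᵘₚ.≤-respʳ-≃ (ℚᵘₚ.≃-sym (ℚₚ.toℚᵘ-fromℚᵘ (+ ℤ.∣ ℚ.↥ p ∣ ℚᵘ./ 1)))
      (ℚᵘ.*≤* (≡.subst₂ ℤ._≤_ (≡.sym (ℤₚ.*-identityʳ (ℚ.↥ p))) (ℤₚ.pos-* ℤ.∣ ℚ.↥ p ∣ (ℚ.↧ₙ p))
        (ℤₚ.≤-trans (i≤∣i∣ (ℚ.↥ p)) (ℤ.+≤+ (ℕₚ.m≤m*n ℤ.∣ ℚ.↥ p ∣ (ℚ.↧ₙ p)))))))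

  <-fromℤ-mono : ∀ {x i j} → i ℤ.≤ j → x < fromℤ i → x < fromℤ j
  <-fromℤ-mono i≤j (mk< ε 0<ε (N , h)) = mk< ε 0<ε (N , λ n N≤n → ℚₚ.<-≤-trans (h n N≤n) (/1-mono i≤j))

  record IntegerPart (x : ℝ) : Set where
    constructor integerPart
    field
      part  : ℤ
      lower : fromℤ part ≤ x
      upper : x < fromℤ (part ℤ.+ 1ℤ)

  open IntegerPart public

  unique : ∀ {x y} → x ≈ y → (f : IntegerPart x) (g : IntegerPart y) → part f ≡ part g
  unique {x} {y} x≈y (integerPart i i≤x x<i+1) (integerPart j j≤y y<j+1) with ℤₚ.<-cmp i j
  ... | tri≈ _ i≡j _ = i≡j
  ... | tri< i<j _ _ = ⊥-elim (j≤y (<-respˡ x≈y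
          (<-fromℤ-mono (≡.subst (ℤ._≤ j) (ℤₚ.+-comm 1ℤ i) (ℤₚ.i<j⇒suc[i]≤j i<j)) x<i+1)))
  ... | tri> _ _ j<i = ⊥-elim (i≤x (<-respˡ (≈-sym x≈y)
          (<-fromℤ-mono (≡.subst (ℤ._≤ i) (ℤₚ.+-comm 1ℤ j) (ℤₚ.i<j⇒suc[i]≤j j<i)) y<j+1)))

  module _ (em : ExcludedMiddle 0ℓ) where

    search : ∀ {x} m k → fromℤ m ≤ x → x < fromℤ (m ℤ.+ + k) → IntegerPart x
    search {x} m zero    m≤x x<m = ⊥-elim (m≤x (≡.subst (λ i → x < fromℤ i) (ℤₚ.+-identityʳ m) x<m))
    search {x} m (suc k) m≤x x<m+k with em {x < fromℤ (m ℤ.+ 1ℤ)}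
    ... | yes x<m+1 = integerPart m m≤x x<m+1
    ... | no  m+1≤x = search (m ℤ.+ 1ℤ) k m+1≤x
            (≡.subst (λ i → x < fromℤ i) (≡.sym (ℤₚ.+-assoc m 1ℤ (+ k))) x<m+k)

    abstract
      floor : ∀ x → IntegerPart x
      floor x =
        let B , 0<B , N , b = bound x
            M = ℤ.∣ ℚ.↥ B ∣
            B≤M = p≤∣↥p∣ B
            above : x < fromℤ (+ M ℤ.+ 1ℤ)
            above = mk< 1ℚ (ℚₚ.positive⁻¹ 1ℚ) (N , λ n N≤n →
              ≡.subst (seq x n ℚ.+ 1ℚ ℚ.<_) (≡.sym (/1-homo-+ (+ M) 1ℤ))
                (ℚₚ.+-monoˡ-< 1ℚ (ℚₚ.<-≤-trans (ℚₚ.≤-<-trans (p≤∣p∣ (seq x n)) (b n N≤n)) B≤M)))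
            -M+M≡0 : (ℤ.- (+ M)) ℚ./ 1 ℚ.+ (+ M) ℚ./ 1 ≡ 0ℚ
            -M+M≡0 = ≡.trans (≡.sym (/1-homo-+ (ℤ.- (+ M)) (+ M))) (≡.cong (ℚ._/ 1) (ℤₚ.+-inverseˡ (+ M)))
            below : fromℤ (ℤ.- (+ M)) ≤ x
            below = λ (mk< ε 0<ε (K , h)) →
              let n   = K ℕ.⊔ N
                  s   = seq x n
                  -s<M = ℚₚ.<-≤-trans (ℚₚ.≤-<-trans
                           (≡.subst (ℚ.- s ℚ.≤_) (ℚₚ.∣-p∣≡∣p∣ s) (p≤∣p∣ (ℚ.- s)))
                           (b n (ℕₚ.m≤n⊔m K N))) B≤M
                  s+ε<-M = h n (ℕₚ.m≤m⊔n K N)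
              in ℚₚ.<-asym 0<ε (≡.subst₂ ℚ._<_
                   (cancel s ε) -M+M≡0 (ℚₚ.+-mono-< s+ε<-M -s<M))
        in search (ℤ.- (+ M)) (M ℕ.+ (M ℕ.+ 1)) below
             (≡.subst (λ i → x < fromℤ i) (range M) above)
        where
        cancel : ∀ s ε → (s ℚ.+ ε) ℚ.+ ℚ.- s ≡ ε
        cancel = solve 2 (λ s e → (s :+ e) :+ :- s := e) ≡.refl
          where open +-*-Solver
        range : ∀ M → + M ℤ.+ 1ℤ ≡ ℤ.- (+ M) ℤ.+ + (M ℕ.+ (M ℕ.+ 1))
        range M = ≡.sym (≡.trans (≡.sym (ℤₚ.+-assoc (ℤ.- (+ M)) (+ M) (+ (M ℕ.+ 1))))
          (≡.trans (≡.cong (ℤ._+ + (M ℕ.+ 1)) (ℤₚ.+-inverseˡ (+ M))) (ℤₚ.+-identityˡ (+ (M ℕ.+ 1)))))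

  shift : ∀ {x} (f : IntegerPart x) k → IntegerPart (x + fromℤ k)
  shift {x} (integerPart m m≤x x<m+1) k = integerPart (m ℤ.+ k)
    (λ x+k<m+k → m≤x (<-transport (≗⇒≈ λ n → eq₁ (seq x n)) x+k<m+k))
    (<-transport (≗⇒≈ λ n → eq₂ (seq x n)) x<m+1)
    where
    open +-*-Solver
    eq₁ : ∀ s → (m ℤ.+ k) ℚ./ 1 ℚ.- (s ℚ.+ k ℚ./ 1) ≡ m ℚ./ 1 ℚ.- s
    eq₁ s = ≡.trans (≡.cong (ℚ._- (s ℚ.+ k ℚ./ 1)) (/1-homo-+ m k))
      (solve 3 (λ a b c → (a :+ b) :- (c :+ b) := a :- c) ≡.refl (m ℚ./ 1) (k ℚ./ 1) s)
    eq₂ : ∀ s → (m ℤ.+ 1ℤ) ℚ./ 1 ℚ.- s ≡ (m ℤ.+ k ℤ.+ 1ℤ) ℚ./ 1 ℚ.- (s ℚ.+ k ℚ./ 1)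
    eq₂ s = ≡.trans (solve 3 (λ a b c → a :- c := (a :+ b) :- (c :+ b)) ≡.refl ((m ℤ.+ 1ℤ) ℚ./ 1) (k ℚ./ 1) s)
      (≡.cong (ℚ._- (s ℚ.+ k ℚ./ 1)) (≡.trans (≡.sym (/1-homo-+ (m ℤ.+ 1ℤ) k)) (≡.cong (ℚ._/ 1)
        (≡.trans (ℤₚ.+-assoc m 1ℤ k) (≡.trans (≡.cong (λ i → m ℤ.+ i) (ℤₚ.+-comm 1ℤ k)) (≡.sym (ℤₚ.+-assoc m k 1ℤ)))))))

  sign : ℤ → ℝ
  sign m = (- 1ℝ) ^ ℤ.∣ m ∣

  -1*-1*x≈x : ∀ x → - 1ℝ * (- 1ℝ * x) ≈ x
  -1*-1*x≈x x = ≗⇒≈ λ n → solve 1 (λ a → con (ℚ.- 1ℚ) :* (con (ℚ.- 1ℚ) :* a) := a) ≡.refl (seq x n)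
    where open +-*-Solver

  sign-suc : ∀ m → sign (m ℤ.+ 1ℤ) ≈ - 1ℝ * sign m
  sign-suc (+ n)          = R.reflexive (≡.cong ((- 1ℝ) ^_) (ℕₚ.+-comm n 1))
  sign-suc -[1+ zero ]    = ≈-sym (-1*-1*x≈x 1ℝ)
  sign-suc -[1+ suc n ]   = ≈-sym (-1*-1*x≈x ((- 1ℝ) ^ suc n))

  sign-+ : ∀ m j → sign (m ℤ.+ + j) ≈ (- 1ℝ) ^ j * sign m
  sign-+ m zero    = ≈-trans (R.reflexive (≡.cong sign (ℤₚ.+-identityʳ m))) (≈-sym (R.*-identityˡ (sign m)))
  sign-+ m (suc j) = begin
    sign (m ℤ.+ + suc j)           ≡⟨ ≡.cong sign (≡.sym (ℤₚ.+-assoc m 1ℤ (+ j))) ⟩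
    sign (m ℤ.+ 1ℤ ℤ.+ + j)        ≈⟨ sign-+ (m ℤ.+ 1ℤ) j ⟩
    (- 1ℝ) ^ j * sign (m ℤ.+ 1ℤ)   ≈⟨ R.*-congˡ (sign-suc m) ⟩
    (- 1ℝ) ^ j * (- 1ℝ * sign m)   ≈⟨ R.*-assoc ((- 1ℝ) ^ j) (- 1ℝ) (sign m) ⟨
    (- 1ℝ) ^ j * - 1ℝ * sign m     ≈⟨ R.*-congʳ (R.*-comm ((- 1ℝ) ^ j) (- 1ℝ)) ⟩
    (- 1ℝ) ^ suc j * sign m        ∎

  sign² : ∀ j x → (- 1ℝ) ^ j * ((- 1ℝ) ^ j * x) ≈ x
  sign² zero    x = ≈-trans (R.*-identityˡ (1ℝ * x)) (R.*-identityˡ x)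
  sign² (suc j) x = begin
    - 1ℝ * s * (- 1ℝ * s * x)    ≈⟨ ≗⇒≈ (λ n → solve 3 (λ e a b → e :* a :* (e :* a :* b) := e :* (e :* (a :* (a :* b)))) ≡.refl
                                       (seq (- 1ℝ) n) (seq s n) (seq x n)) ⟩
    - 1ℝ * (- 1ℝ * (s * (s * x)))  ≈⟨ -1*-1*x≈x (s * (s * x)) ⟩
    s * (s * x)                    ≈⟨ sign² j x ⟩
    x                              ∎
    where
    open +-*-Solver
    s = (- 1ℝ) ^ j

  sign-homo : ∀ m k → sign (m ℤ.+ k) ≈ sign k * sign m
  sign-homo m (+ j)    = sign-+ m j
  sign-homo m -[1+ j ] = begin
    sign m′                    ≈⟨ sign² (suc j) (sign m′) ⟨
    s * (s * sign m′)          ≈⟨ R.*-congˡ (sign-+ m′ (suc j)) ⟨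
    s * sign (m′ ℤ.+ + suc j)  ≡⟨ ≡.cong (λ i → s * sign i) (≡.trans (ℤₚ.+-assoc m -[1+ j ] (+ suc j))
                                    (≡.trans (≡.cong (λ i → m ℤ.+ i) (ℤₚ.+-inverseˡ (+ suc j))) (ℤₚ.+-identityʳ m))) ⟩
    s * sign m                 ∎
    where
    s  = (- 1ℝ) ^ suc j
    m′ = m ℤ.+ -[1+ j ]

  quotients-cong : ∀ {u f f′ g} → f ≋ f′ → ∀ n (i : Fin n) →
    lookup (Division.quotients u f g n) i ≈ lookup (Division.quotients u f′ g n) i
  quotients-cong eq (suc n) zero    = R.*-congˡ (+-cong (eq n)
    (-‿cong (sum-cong-≋ {n} λ i → R.*-congˡ (quotients-cong eq n i))))
  quotients-cong eq (suc n) (suc i) = quotients-cong eq n i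

open IntegerParts

E-cong : ∀ n {x y} → x ≈ y → E n x ≈ E n y
E-cong n x≈y = R.*-congˡ (quotients-cong {fromℚ ½} {g = 1+exp}
  (λ k → R.*-congˡ (R.*-congʳ (^-congˡ k x≈y))) (suc n) zero)

eulerFunction-exists : ExcludedMiddle 0ℓ → ∀ n → ∃ (IsEulerFunction n)
eulerFunction-exists em n = ℰ , record
  { cong = λ {x} {y} x≈y → value-cong (unique x≈y (floor em x) (floor em y)) x≈y
  ; on-unit = λ x 0≤x x<1 → begin
      value (part (floor em x)) x  ≈⟨ value-cong (unique {x} ≈-refl (floor em x) (integerPart ℤ.0ℤ 0≤x x<1)) ≈-refl ⟩
      1ℝ * E n (x - 0ℝ)            ≈⟨ R.*-identityˡ (E n (x - 0ℝ)) ⟩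
      E n (x - 0ℝ)                 ≈⟨ E-cong n (≗⇒≈ λ k → ℚₚ.+-identityʳ (seq x k)) ⟩
      E n x                        ∎
  ; antiperiodic = λ x k → let m = part (floor em x) in begin
      value (part (floor em (x + fromℤ k))) (x + fromℤ k)
        ≈⟨ value-cong (unique {x + fromℤ k} ≈-refl (floor em (x + fromℤ k)) (shift (floor em x) k)) ≈-refl ⟩
      sign (m ℤ.+ k) * E n (x + fromℤ k - fromℤ (m ℤ.+ k))
        ≈⟨ *-cong (sign-homo m k) (E-cong n (≗⇒≈ λ i → cancel (seq x i) m k)) ⟩
      sign k * sign m * E n (x - fromℤ m)
        ≈⟨ R.*-assoc (sign k) (sign m) (E n (x - fromℤ m)) ⟩
      sign k * value m x ∎
  }
  where
  value : ℤ → ℝ → ℝ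
  value m x = sign m * E n (x - fromℤ m)

  ℰ : ℝ → ℝ
  ℰ x = value (part (floor em x)) x

  value-cong : ∀ {m m′ x x′} → m ≡ m′ → x ≈ x′ → value m x ≈ value m′ x′
  value-cong ≡.refl x≈x′ = R.*-congˡ (E-cong n (R.+-congʳ x≈x′))

  cancel : ∀ s m k → s ℚ.+ k ℚ./ 1 ℚ.- (m ℤ.+ k) ℚ./ 1 ≡ s ℚ.- m ℚ./ 1
  cancel s m k = ≡.trans (≡.cong (λ i → s ℚ.+ k ℚ./ 1 ℚ.- i) (/1-homo-+ m k))
    (solve 3 (λ a b c → a :+ c :- (b :+ c) := a :- b) ≡.refl s (m ℚ./ 1) (k ℚ./ 1))
    where open +-*-Solver

{-# OPTIONS --safe #-}
module Submission where

-- Put u = e^{X/a}, v = e^{Y/b}, w = e^{(X+Y)/c}, so that w^c = u^a v^b. In terms of the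
-- generating function ∑ ℰₙ(s) tⁿ/n! = (-1)^{⌊s⌋} 2 e^{(s - ⌊s⌋)t} / (e^t + 1), the two sides
-- of the theorem are the coefficients of X^{p-1} Y^{q-1} / ((p-1)! (q-1)!) in the sums of the
-- jumps of one step function. Let a time t run over a period of length 1 and let
-- m = ⌊at + x⌋, n = ⌊bt + y⌋, and k - 1 = ⌊ct - z⌋. The function
--   (-1)^{m+n+k} u^{x-m} v^{y-n} w^{z+k} · 2/(1+u) · 2/(1+v) · 2/(1+w)
-- is periodic, because a + b + c is even, so its jumps add up to 0. A jump of m cancels the
-- factor 1 + u, and as at + x is then an integer, what remains is a summand of
-- S(c, b, a : z, -y, x); jumps of n and of k give S(c, -a, b : z, x, y) and S(a, b, c : x, y, z).
-- At common discontinuities the choice of ℰ at integers corresponds to jumping in the order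
-- m, n, k.
--
-- Integer parts of reals cannot be computed, but _≈_ is stable under double negation, so
-- finitely many case distinctions are allowed in the proof of an equation.

-- The order m, n, k at common discontinuities is forced by the half-open interval [0, 1) on which ℰ
-- agrees with the Euler polynomial. At a jump of k both arguments, at + x and bt + y, increase with
-- t, so at a tie m and n must already have their new values. At a jump of m the arguments are z -
-- ct and -y - bt; they decrease with t, so at a tie n and k must still have their old values. At a
-- jump of n the arguments z - ct and at + x are one of each kind, so m has jumped and k has not.
--
-- The decreasing argument -y - bt is paired with the variable -Y, which is the source of the powers
-- of -1 in the sum over h; the identity 2/(1 + 1/v) = v · 2/(1 + v) brings it back to the common
-- product.
--
-- The factor 1 + u appears because a jump also reverses the sign: new minus old value is minus the
-- sum of the two neighbouring exponentials. The surplus 2 is removed by the ½ in `φ`.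
--
-- The right-hand sums are single sums because of the two remaining factors one involves X and Y
-- together and the other only one of them, so only one degree is distributed between them.

open import Algebra.Bundles using (CommutativeRing)
import Algebra.Solver.Ring
open import Algebra.Solver.Ring.AlmostCommutativeRing using (fromCommutativeRing; _-Raw-AlmostCommutative⟶_)
open import Data.Empty using (⊥-elim)
open import Data.Fin.Base using (Fin; toℕ)
import Data.Fin.Properties as Finₚ
open import Data.Integer.Base as ℤ using (ℤ; +_; -[1+_]; 1ℤ)
import Data.Integer.Properties as ℤₚ
open import Data.Integer.Solver using () renaming (module +-*-Solver to ℤSolver)
import Data.Maybe.Base as Maybe
open import Data.Nat.Base as ℕ using (ℕ; zero; suc; NonZero)
open import Data.Nat.Combinatorics using (_C_; nCk+nC[k+1]≡[n+1]C[k+1]; k>n⇒nCk≡0; nCk≡n!/k![n-k]!; k![n∸k]!∣n!)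
open import Data.Nat.Coprimality using (Coprime)
open import Data.Nat.Divisibility using (_∣_; quotient)
open import Data.Nat.DivMod using (m/n*n≡m)
import Data.Nat.Properties as ℕₚ
open import Data.Product.Base using (∃; _,_; proj₁; proj₂)
open import Data.Rational.Base as ℚ using (ℚ; 0ℚ; 1ℚ; ½)
import Data.Rational.Properties as ℚₚ
open import Data.Rational.Solver using () renaming (module +-*-Solver to ℚSolver)
open import Data.Sum.Base using (_⊎_; inj₁; inj₂)
open import Level using (0ℓ)
open import Relation.Binary.PropositionalEquality as ≡ using (_≡_)
open import Relation.Nullary using (¬_; Dec; yes; no)
open import Relation.Nullary.Decidable using (dec⇒maybe; decidable-stable; toWitness)

-- Exponential generating functions

nCk*k![n∸k]!≡n! : ∀ {n k} → k ℕ.≤ n → (n C k) ℕ.* (k ℕ.! ℕ.* (n ℕ.∸ k) ℕ.!) ≡ n ℕ.!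
nCk*k![n∸k]!≡n! {n} {k} k≤n = ≡.trans (≡.cong (ℕ._* (k ℕ.! ℕ.* (n ℕ.∸ k) ℕ.!)) (nCk≡n!/k![n-k]! k≤n))
  (m/n*n≡m {{k ℕₚ.!* (n ℕ.∸ k) !≢0}} (k![n∸k]!∣n! k≤n))

-- With coefficients taken with respect to tⁿ/n!, products and derivatives need no division, so the
-- calculus works over any commutative ring.
module HurwitzSeries (K : CommutativeRing 0ℓ 0ℓ) where

  open CommutativeRing K hiding (zero)
  open import Algebra.Properties.CommutativeSemigroup +-commutativeSemigroup
    using () renaming (interchange to +-interchange)
  open import Algebra.Properties.CommutativeSemigroup *-commutativeSemigroup
    using (x∙yz≈y∙xz) renaming (interchange to *-interchange)
  open import Algebra.Properties.Semiring.Exp semiring using (_^_; ^-homo-*; ^-congˡ)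
  open import Algebra.Properties.CommutativeSemiring.Exp commutativeSemiring using (^-distrib-*)
  open import Algebra.Properties.Semiring.Mult semiring using (_×_; ×-congʳ; ×-congˡ; ×-homo-+; ×1-homo-*; ×-assoc-*)
  open import Algebra.Properties.Semiring.Sum semiring
    using (sum-syntax; sum-cong-≋; ∑-distrib-+; *-distribˡ-sum)
  open import Algebra.Properties.Ring ring using (-0#≈0#; -‿+-comm; -‿distribʳ-*)
  open import Algebra.Properties.Group +-group using () renaming (∙-cancelˡ to +-cancelˡ)
  open import Relation.Binary.Reasoning.Setoid setoid

  Seq Seq² : Set
  Seq  = ℕ → Carrier
  Seq² = ℕ → ℕ → Carrier

  infix  4 _≋_
  infixl 6 _⊞_
  infixr 8 _·_
  infixl 7 _⊙_ _⊠_

  _≋_ : Seq² → Seq² → Set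
  f ≋ g = ∀ m n → f m n ≈ g m n

  _⊞_ : Seq² → Seq² → Seq²
  (f ⊞ g) m n = f m n + g m n

  _·_ : Carrier → Seq² → Seq²
  (s · f) m n = s * f m n

  𝟎 : Seq²
  𝟎 _ _ = 0#

  ∂ : Seq → Seq
  ∂ f n = f (suc n)

  ∂₁ ∂₂ : Seq² → Seq²
  ∂₁ f m n = f (suc m) n
  ∂₂ f m n = f m (suc n)

  -- A sequence f stands for ∑ fₙ tⁿ/n!, so that ∂ is differentiation; the
  -- products of series are then characterised by the Leibniz rule.
  _⊙_ : Seq → Seq → Seq
  (f ⊙ g) zero    = f 0 * g 0
  (f ⊙ g) (suc n) = (∂ f ⊙ g) n + (f ⊙ ∂ g) n

  _⊠_ : Seq² → Seq² → Seq²
  (f ⊠ g) zero    zero    = f 0 0 * g 0 0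
  (f ⊠ g) zero    (suc n) = (∂₂ f ⊠ g) 0 n + (f ⊠ ∂₂ g) 0 n
  (f ⊠ g) (suc m) n       = (∂₁ f ⊠ g) m n + (f ⊠ ∂₁ g) m n

  -- e^{PX+QY}
  e : Carrier → Carrier → Seq²
  e P Q m n = P ^ m * Q ^ n

  -- f(PX+QY)
  subst : Carrier → Carrier → Seq → Seq²
  subst P Q f m n = P ^ m * Q ^ n * f (m ℕ.+ n)

  ≋-sym : ∀ {f g} → f ≋ g → g ≋ f
  ≋-sym p m n = sym (p m n)

  ≋-trans : ∀ {f g h} → f ≋ g → g ≋ h → f ≋ h
  ≋-trans p q m n = trans (p m n) (q m n)

  ≋-refl : ∀ {f} → f ≋ f
  ≋-refl m n = refl

  ⊠-cong : ∀ {f f′ g g′} → f ≋ f′ → g ≋ g′ → f ⊠ g ≋ f′ ⊠ g′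
  ⊠-cong p q zero    zero    = *-cong (p 0 0) (q 0 0)
  ⊠-cong p q zero    (suc n) =
    +-cong (⊠-cong (λ i j → p i (suc j)) q 0 n) (⊠-cong p (λ i j → q i (suc j)) 0 n)
  ⊠-cong p q (suc m) n       =
    +-cong (⊠-cong (λ i → p (suc i)) q m n) (⊠-cong p (λ i → q (suc i)) m n)

  ⊠-comm : ∀ f g → f ⊠ g ≋ g ⊠ f
  ⊠-comm f g zero    zero    = *-comm _ _
  ⊠-comm f g zero    (suc n) =
    trans (+-cong (⊠-comm (∂₂ f) g 0 n) (⊠-comm f (∂₂ g) 0 n)) (+-comm _ _)
  ⊠-comm f g (suc m) n       =
    trans (+-cong (⊠-comm (∂₁ f) g m n) (⊠-comm f (∂₁ g) m n)) (+-comm _ _)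

  ⊠-distribʳ : ∀ h f g → (f ⊞ g) ⊠ h ≋ f ⊠ h ⊞ g ⊠ h
  ⊠-distribʳ h f g zero    zero    = distribʳ _ _ _
  ⊠-distribʳ h f g zero    (suc n) =
    trans (+-cong (⊠-distribʳ h (∂₂ f) (∂₂ g) 0 n) (⊠-distribʳ (∂₂ h) f g 0 n)) (+-interchange _ _ _ _)
  ⊠-distribʳ h f g (suc m) n       =
    trans (+-cong (⊠-distribʳ h (∂₁ f) (∂₁ g) m n) (⊠-distribʳ (∂₁ h) f g m n)) (+-interchange _ _ _ _)

  ⊠-distribˡ : ∀ h f g → h ⊠ (f ⊞ g) ≋ h ⊠ f ⊞ h ⊠ g
  ⊠-distribˡ h f g m n = begin
    (h ⊠ (f ⊞ g)) m n         ≈⟨ ⊠-comm h (f ⊞ g) m n ⟩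
    ((f ⊞ g) ⊠ h) m n         ≈⟨ ⊠-distribʳ h f g m n ⟩
    (f ⊠ h) m n + (g ⊠ h) m n ≈⟨ +-cong (⊠-comm f h m n) (⊠-comm g h m n) ⟩
    (h ⊠ f) m n + (h ⊠ g) m n ∎

  ·-⊠ : ∀ s f g → (s · f) ⊠ g ≋ s · (f ⊠ g)
  ·-⊠ s f g zero    zero    = *-assoc _ _ _
  ·-⊠ s f g zero    (suc n) =
    trans (+-cong (·-⊠ s (∂₂ f) g 0 n) (·-⊠ s f (∂₂ g) 0 n)) (sym (distribˡ _ _ _))
  ·-⊠ s f g (suc m) n       =
    trans (+-cong (·-⊠ s (∂₁ f) g m n) (·-⊠ s f (∂₁ g) m n)) (sym (distribˡ _ _ _))

  ⊠-· : ∀ s f g → f ⊠ (s · g) ≋ s · (f ⊠ g)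
  ⊠-· s f g m n = trans (⊠-comm f (s · g) m n) (trans (·-⊠ s g f m n) (*-congˡ (⊠-comm g f m n)))

  ⊠-zeroʳ : ∀ f {g} → g ≋ 𝟎 → f ⊠ g ≋ 𝟎
  ⊠-zeroʳ f g≋𝟎 m n = begin
    (f ⊠ _) m n          ≈⟨ ⊠-cong (≋-refl {f}) (λ i j → trans (g≋𝟎 i j) (sym (zeroˡ 0#))) m n ⟩
    (f ⊠ (0# · 𝟎)) m n   ≈⟨ ⊠-· 0# f 𝟎 m n ⟩
    0# * (f ⊠ 𝟎) m n     ≈⟨ zeroˡ _ ⟩
    0#                   ∎

  ⊠-zeroˡ : ∀ {f} g → f ≋ 𝟎 → f ⊠ g ≋ 𝟎
  ⊠-zeroˡ {f} g f≋𝟎 m n = trans (⊠-comm f g m n) (⊠-zeroʳ g f≋𝟎 m n)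

  -- The recursion for `_⊠_` consumes the first degree first, so the Leibniz rule is definitional
  -- for `∂₁` but has to be proved for `∂₂`.
  ∂₂-⊠ : ∀ f g → ∂₂ (f ⊠ g) ≋ ∂₂ f ⊠ g ⊞ f ⊠ ∂₂ g
  ∂₂-⊠ f g zero    n = refl
  ∂₂-⊠ f g (suc m) n =
    trans (+-cong (∂₂-⊠ (∂₁ f) g m n) (∂₂-⊠ f (∂₁ g) m n)) (+-interchange _ _ _ _)

  ⊠-assoc : ∀ f g h → (f ⊠ g) ⊠ h ≋ f ⊠ (g ⊠ h)
  ⊠-assoc f g h zero    zero    = *-assoc _ _ _
  ⊠-assoc f g h zero    (suc n) = begin
    (∂₂ (f ⊠ g) ⊠ h) 0 n + ((f ⊠ g) ⊠ ∂₂ h) 0 n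
      ≈⟨ +-congʳ (trans (⊠-cong (∂₂-⊠ f g) (≋-refl {h}) 0 n) (⊠-distribʳ h (∂₂ f ⊠ g) (f ⊠ ∂₂ g) 0 n)) ⟩
    ((∂₂ f ⊠ g) ⊠ h) 0 n + ((f ⊠ ∂₂ g) ⊠ h) 0 n + ((f ⊠ g) ⊠ ∂₂ h) 0 n
      ≈⟨ +-cong (+-cong (⊠-assoc (∂₂ f) g h 0 n) (⊠-assoc f (∂₂ g) h 0 n)) (⊠-assoc f g (∂₂ h) 0 n) ⟩
    (∂₂ f ⊠ (g ⊠ h)) 0 n + (f ⊠ (∂₂ g ⊠ h)) 0 n + (f ⊠ (g ⊠ ∂₂ h)) 0 n
      ≈⟨ +-assoc _ _ _ ⟩
    (∂₂ f ⊠ (g ⊠ h)) 0 n + ((f ⊠ (∂₂ g ⊠ h)) 0 n + (f ⊠ (g ⊠ ∂₂ h)) 0 n)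
      ≈⟨ +-congˡ (trans (⊠-cong (≋-refl {f}) (∂₂-⊠ g h) 0 n) (⊠-distribˡ f (∂₂ g ⊠ h) (g ⊠ ∂₂ h) 0 n)) ⟨
    (∂₂ f ⊠ (g ⊠ h)) 0 n + (f ⊠ ∂₂ (g ⊠ h)) 0 n ∎
  ⊠-assoc f g h (suc m) n       = begin
    (∂₁ (f ⊠ g) ⊠ h) m n + ((f ⊠ g) ⊠ ∂₁ h) m n
      ≈⟨ +-congʳ (⊠-distribʳ h (∂₁ f ⊠ g) (f ⊠ ∂₁ g) m n) ⟩
    ((∂₁ f ⊠ g) ⊠ h) m n + ((f ⊠ ∂₁ g) ⊠ h) m n + ((f ⊠ g) ⊠ ∂₁ h) m n
      ≈⟨ +-cong (+-cong (⊠-assoc (∂₁ f) g h m n) (⊠-assoc f (∂₁ g) h m n)) (⊠-assoc f g (∂₁ h) m n) ⟩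
    (∂₁ f ⊠ (g ⊠ h)) m n + (f ⊠ (∂₁ g ⊠ h)) m n + (f ⊠ (g ⊠ ∂₁ h)) m n
      ≈⟨ +-assoc _ _ _ ⟩
    (∂₁ f ⊠ (g ⊠ h)) m n + ((f ⊠ (∂₁ g ⊠ h)) m n + (f ⊠ (g ⊠ ∂₁ h)) m n)
      ≈⟨ +-congˡ (⊠-distribˡ f (∂₁ g ⊠ h) (g ⊠ ∂₁ h) m n) ⟨
    (∂₁ f ⊠ (g ⊠ h)) m n + (f ⊠ ∂₁ (g ⊠ h)) m n ∎

  ⊠-interchange : ∀ f g h k → (f ⊠ g) ⊠ (h ⊠ k) ≋ (f ⊠ h) ⊠ (g ⊠ k)
  ⊠-interchange f g h k m n = begin
    ((f ⊠ g) ⊠ (h ⊠ k)) m n   ≈⟨ ⊠-assoc f g (h ⊠ k) m n ⟩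
    (f ⊠ (g ⊠ (h ⊠ k))) m n   ≈⟨ ⊠-cong (≋-refl {f}) (≋-sym (⊠-assoc g h k)) m n ⟩
    (f ⊠ ((g ⊠ h) ⊠ k)) m n   ≈⟨ ⊠-cong (≋-refl {f}) (⊠-cong (⊠-comm g h) (≋-refl {k})) m n ⟩
    (f ⊠ ((h ⊠ g) ⊠ k)) m n   ≈⟨ ⊠-cong (≋-refl {f}) (⊠-assoc h g k) m n ⟩
    (f ⊠ (h ⊠ (g ⊠ k))) m n   ≈⟨ ⊠-assoc f h (g ⊠ k) m n ⟨
    ((f ⊠ h) ⊠ (g ⊠ k)) m n   ∎

  e-cong : ∀ {P P′ Q Q′} → P ≈ P′ → Q ≈ Q′ → e P Q ≋ e P′ Q′
  e-cong p q m n = *-cong (^-congˡ m p) (^-congˡ n q)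

  ∂₁-e : ∀ P Q → ∂₁ (e P Q) ≋ P · e P Q
  ∂₁-e P Q m n = *-assoc _ _ _

  ∂₂-e : ∀ P Q → ∂₂ (e P Q) ≋ Q · e P Q
  ∂₂-e P Q m n = x∙yz≈y∙xz _ _ _

  -- Both sides have constant term 1 and are multiplied by `P + R` and `Q + S` under the two
  -- derivations; the induction is uniqueness for these differential equations.
  e-homo : ∀ P Q R S → e P Q ⊠ e R S ≋ e (P + R) (Q + S)
  e-homo P Q R S zero    zero    = trans (*-congˡ (*-identityˡ 1#)) (*-identityʳ _)
  e-homo P Q R S zero    (suc n) = begin
    (∂₂ (e P Q) ⊠ e R S) 0 n + (e P Q ⊠ ∂₂ (e R S)) 0 n
      ≈⟨ +-cong (⊠-cong (∂₂-e P Q) (≋-refl {e R S}) 0 n) (⊠-cong (≋-refl {e P Q}) (∂₂-e R S) 0 n) ⟩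
    ((Q · e P Q) ⊠ e R S) 0 n + (e P Q ⊠ (S · e R S)) 0 n
      ≈⟨ +-cong (·-⊠ Q (e P Q) (e R S) 0 n) (⊠-· S (e P Q) (e R S) 0 n) ⟩
    Q * (e P Q ⊠ e R S) 0 n + S * (e P Q ⊠ e R S) 0 n
      ≈⟨ distribʳ _ _ _ ⟨
    (Q + S) * (e P Q ⊠ e R S) 0 n
      ≈⟨ *-congˡ (e-homo P Q R S 0 n) ⟩
    (Q + S) * e (P + R) (Q + S) 0 n
      ≈⟨ ∂₂-e (P + R) (Q + S) 0 n ⟨
    e (P + R) (Q + S) 0 (suc n) ∎
  e-homo P Q R S (suc m) n       = begin
    (∂₁ (e P Q) ⊠ e R S) m n + (e P Q ⊠ ∂₁ (e R S)) m n
      ≈⟨ +-cong (⊠-cong (∂₁-e P Q) (≋-refl {e R S}) m n) (⊠-cong (≋-refl {e P Q}) (∂₁-e R S) m n) ⟩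
    ((P · e P Q) ⊠ e R S) m n + (e P Q ⊠ (R · e R S)) m n
      ≈⟨ +-cong (·-⊠ P (e P Q) (e R S) m n) (⊠-· R (e P Q) (e R S) m n) ⟩
    P * (e P Q ⊠ e R S) m n + R * (e P Q ⊠ e R S) m n
      ≈⟨ distribʳ _ _ _ ⟨
    (P + R) * (e P Q ⊠ e R S) m n
      ≈⟨ *-congˡ (e-homo P Q R S m n) ⟩
    (P + R) * e (P + R) (Q + S) m n
      ≈⟨ ∂₁-e (P + R) (Q + S) m n ⟨
    e (P + R) (Q + S) (suc m) n ∎

  -- `e 0# 0#` serves as the constant series 1: both its derivatives carry a factor 0.
  ⊠-identityʳ : ∀ f → f ⊠ e 0# 0# ≋ f
  ⊠-identityʳ f zero    zero    = trans (*-congˡ (*-identityˡ 1#)) (*-identityʳ _)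
  ⊠-identityʳ f zero    (suc n) = trans (+-cong (⊠-identityʳ (∂₂ f) 0 n)
    (⊠-zeroʳ f (λ i j → trans (∂₂-e 0# 0# i j) (zeroˡ _)) 0 n)) (+-identityʳ _)
  ⊠-identityʳ f (suc m) n       = trans (+-cong (⊠-identityʳ (∂₁ f) m n)
    (⊠-zeroʳ f (λ i j → trans (∂₁-e 0# 0# i j) (zeroˡ _)) m n)) (+-identityʳ _)

  ∂₁-subst : ∀ P Q f → ∂₁ (subst P Q f) ≋ P · subst P Q (∂ f)
  ∂₁-subst P Q f m n = trans (*-congʳ (*-assoc _ _ _)) (*-assoc _ _ _)

  ∂₂-subst : ∀ P Q f → ∂₂ (subst P Q f) ≋ Q · subst P Q (∂ f)
  ∂₂-subst P Q f m n = trans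
    (*-cong (x∙yz≈y∙xz _ _ _) (reflexive (≡.cong f (ℕₚ.+-suc m n)))) (*-assoc _ _ _)

  -- By the chain rule each derivation of `subst P Q f` yields a multiple of `subst P Q (∂ f)`, so
  -- both sides obey the same recursion. This carries identities in t over to t = PX + QY.
  subst-homo : ∀ P Q f g → subst P Q (f ⊙ g) ≋ subst P Q f ⊠ subst P Q g
  subst-homo P Q f g zero    zero    = begin
    1# * 1# * (f 0 * g 0)              ≈⟨ *-congʳ (*-identityˡ (1# * 1#)) ⟨
    1# * (1# * 1#) * (f 0 * g 0)       ≈⟨ *-congʳ (*-congʳ (*-identityˡ 1#)) ⟨
    1# * 1# * (1# * 1#) * (f 0 * g 0)  ≈⟨ *-interchange _ _ _ _ ⟩
    1# * 1# * f 0 * (1# * 1# * g 0)    ∎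
  subst-homo P Q f g zero    (suc n) = begin
    ∂₂ (subst P Q (f ⊙ g)) 0 n
      ≈⟨ ∂₂-subst P Q (f ⊙ g) 0 n ⟩
    Q * (1# * Q ^ n * ((∂ f ⊙ g) n + (f ⊙ ∂ g) n))
      ≈⟨ trans (*-congˡ (distribˡ _ _ _)) (distribˡ _ _ _) ⟩
    Q * subst P Q (∂ f ⊙ g) 0 n + Q * subst P Q (f ⊙ ∂ g) 0 n
      ≈⟨ +-cong (*-congˡ (subst-homo P Q (∂ f) g 0 n)) (*-congˡ (subst-homo P Q f (∂ g) 0 n)) ⟩
    Q * (subst P Q (∂ f) ⊠ subst P Q g) 0 n + Q * (subst P Q f ⊠ subst P Q (∂ g)) 0 n
      ≈⟨ +-cong (·-⊠ Q (subst P Q (∂ f)) (subst P Q g) 0 n) (⊠-· Q (subst P Q f) (subst P Q (∂ g)) 0 n) ⟨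
    ((Q · subst P Q (∂ f)) ⊠ subst P Q g) 0 n + (subst P Q f ⊠ (Q · subst P Q (∂ g))) 0 n
      ≈⟨ +-cong (⊠-cong (∂₂-subst P Q f) (≋-refl {subst P Q g}) 0 n)
                (⊠-cong (≋-refl {subst P Q f}) (∂₂-subst P Q g) 0 n) ⟨
    (subst P Q f ⊠ subst P Q g) 0 (suc n) ∎
  subst-homo P Q f g (suc m) n       = begin
    ∂₁ (subst P Q (f ⊙ g)) m n
      ≈⟨ ∂₁-subst P Q (f ⊙ g) m n ⟩
    P * (P ^ m * Q ^ n * ((∂ f ⊙ g) (m ℕ.+ n) + (f ⊙ ∂ g) (m ℕ.+ n)))
      ≈⟨ trans (*-congˡ (distribˡ _ _ _)) (distribˡ _ _ _) ⟩
    P * subst P Q (∂ f ⊙ g) m n + P * subst P Q (f ⊙ ∂ g) m n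
      ≈⟨ +-cong (*-congˡ (subst-homo P Q (∂ f) g m n)) (*-congˡ (subst-homo P Q f (∂ g) m n)) ⟩
    P * (subst P Q (∂ f) ⊠ subst P Q g) m n + P * (subst P Q f ⊠ subst P Q (∂ g)) m n
      ≈⟨ +-cong (·-⊠ P (subst P Q (∂ f)) (subst P Q g) m n) (⊠-· P (subst P Q f) (subst P Q (∂ g)) m n) ⟨
    ((P · subst P Q (∂ f)) ⊠ subst P Q g) m n + (subst P Q f ⊠ (P · subst P Q (∂ g))) m n
      ≈⟨ +-cong (⊠-cong (∂₁-subst P Q f) (≋-refl {subst P Q g}) m n)
                (⊠-cong (≋-refl {subst P Q f}) (∂₁-subst P Q g) m n) ⟨
    (subst P Q f ⊠ subst P Q g) (suc m) n ∎

  subst-^ : ∀ P Q r → subst P Q (r ^_) ≋ e (r * P) (r * Q)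
  subst-^ P Q r m n = begin
    P ^ m * Q ^ n * r ^ (m ℕ.+ n)      ≈⟨ *-comm _ _ ⟩
    r ^ (m ℕ.+ n) * (P ^ m * Q ^ n)    ≈⟨ *-congʳ (^-homo-* r m n) ⟩
    r ^ m * r ^ n * (P ^ m * Q ^ n)    ≈⟨ *-interchange _ _ _ _ ⟩
    r ^ m * P ^ m * (r ^ n * Q ^ n)    ≈⟨ *-cong (^-distrib-* r P m) (^-distrib-* r Q n) ⟨
    (r * P) ^ m * (r * Q) ^ n          ∎

  subst-⊠-subst-scale : ∀ P₁ Q₁ P₂ Q₂ {f₁ f₂ g₁ g₂ : Seq} {s₁ s₂} →
    (∀ n → f₁ n ≈ s₁ * g₁ n) → (∀ n → f₂ n ≈ s₂ * g₂ n) →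
    subst P₁ Q₁ f₁ ⊠ subst P₂ Q₂ f₂ ≋ (s₁ * s₂) · (subst P₁ Q₁ g₁ ⊠ subst P₂ Q₂ g₂)
  subst-⊠-subst-scale P₁ Q₁ P₂ Q₂ {f₁} {f₂} {g₁} {g₂} {s₁} {s₂} eq₁ eq₂ m n = begin
    (subst P₁ Q₁ f₁ ⊠ subst P₂ Q₂ f₂) m n
      ≈⟨ ⊠-cong (λ i j → trans (*-congˡ (eq₁ (i ℕ.+ j))) (x∙yz≈y∙xz _ _ _))
                (λ i j → trans (*-congˡ (eq₂ (i ℕ.+ j))) (x∙yz≈y∙xz _ _ _)) m n ⟩
    ((s₁ · subst P₁ Q₁ g₁) ⊠ (s₂ · subst P₂ Q₂ g₂)) m n
      ≈⟨ ·-⊠ s₁ (subst P₁ Q₁ g₁) (s₂ · subst P₂ Q₂ g₂) m n ⟩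
    s₁ * (subst P₁ Q₁ g₁ ⊠ (s₂ · subst P₂ Q₂ g₂)) m n
      ≈⟨ *-congˡ (⊠-· s₂ (subst P₁ Q₁ g₁) (subst P₂ Q₂ g₂) m n) ⟩
    s₁ * (s₂ * (subst P₁ Q₁ g₁ ⊠ subst P₂ Q₂ g₂) m n)
      ≈⟨ *-assoc _ _ _ ⟨
    s₁ * s₂ * (subst P₁ Q₁ g₁ ⊠ subst P₂ Q₂ g₂) m n ∎

  -- Coefficients of products

  ×-as-* : ∀ n x → n × x ≈ n × 1# * x
  ×-as-* n x = trans (×-congʳ n (sym (*-identityˡ x))) (sym (×-assoc-* n 1# x))

  sum-snoc : ∀ n (f : Seq) → ∑[ i < suc n ] f (toℕ i) ≈ ∑[ i < n ] f (toℕ i) + f n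
  sum-snoc zero    f = trans (+-identityʳ _) (sym (+-identityˡ _))
  sum-snoc (suc n) f = trans (+-congˡ (sum-snoc n (∂ f))) (sym (+-assoc _ _ _))

  -- The Leibniz rule gives two sums with coefficients `n C i`. Extending one by the vanishing term
  -- `n C suc n` and splitting off its first term aligns them for Pascal's rule.
  ⊙-binomial : ∀ n f g → (f ⊙ g) n ≈ ∑[ i < suc n ] ((n C toℕ i) × (f (toℕ i) * g (n ℕ.∸ toℕ i)))
  ⊙-binomial zero    f g = sym (trans (+-identityʳ _) (+-identityʳ _))
  ⊙-binomial (suc n) f g = begin
    (∂ f ⊙ g) n + (f ⊙ ∂ g) n
      ≈⟨ +-cong (⊙-binomial n (∂ f) g) (⊙-binomial n f (∂ g)) ⟩
    ∑[ i < suc n ] ((n C toℕ i) × h (suc (toℕ i))) +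
    ∑[ i < suc n ] ((n C toℕ i) × (f (toℕ i) * g (suc (n ℕ.∸ toℕ i))))
      ≈⟨ +-congˡ (sum-cong-≋ {suc n} λ i → ×-congʳ (n C toℕ i) (*-congˡ {f (toℕ i)} (reflexive (≡.cong g
           (≡.sym (ℕₚ.+-∸-assoc 1 (Finₚ.toℕ≤pred[n] i))))))) ⟩
    ∑[ i < suc n ] ((n C toℕ i) × h (suc (toℕ i))) + ∑[ i < suc n ] ((n C toℕ i) × h (toℕ i))
      ≈⟨ +-congˡ last-zero ⟨
    ∑[ i < suc n ] ((n C toℕ i) × h (suc (toℕ i))) +
    ((n C 0) × h 0 + ∑[ i < suc n ] ((n C suc (toℕ i)) × h (suc (toℕ i))))
      ≈⟨ trans (sym (+-assoc _ _ _)) (trans (+-congʳ (+-comm _ _)) (+-assoc _ _ _)) ⟩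
    (n C 0) × h 0 + (∑[ i < suc n ] ((n C toℕ i) × h (suc (toℕ i))) +
                     ∑[ i < suc n ] ((n C suc (toℕ i)) × h (suc (toℕ i))))
      ≈⟨ +-congˡ (∑-distrib-+ {suc n} (λ i → (n C toℕ i) × h (suc (toℕ i))) (λ i → (n C suc (toℕ i)) × h (suc (toℕ i)))) ⟨
    (n C 0) × h 0 + ∑[ i < suc n ] ((n C toℕ i) × h (suc (toℕ i)) + (n C suc (toℕ i)) × h (suc (toℕ i)))
      ≈⟨ +-congˡ (sum-cong-≋ {suc n} λ i → trans (sym (×-homo-+ (h (suc (toℕ i))) (n C toℕ i) (n C suc (toℕ i))))
           (×-congˡ (nCk+nC[k+1]≡[n+1]C[k+1] n (toℕ i)))) ⟩
    (suc n C 0) × h 0 + ∑[ i < suc n ] ((suc n C suc (toℕ i)) × h (suc (toℕ i))) ∎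
    where
    h : Seq
    h i = f i * g (suc n ℕ.∸ i)

    last-zero : (n C 0) × h 0 + ∑[ i < suc n ] ((n C suc (toℕ i)) × h (suc (toℕ i))) ≈
                ∑[ i < suc n ] ((n C toℕ i) × h (toℕ i))
    last-zero = begin
      ∑[ i < suc (suc n) ] ((n C toℕ i) × h (toℕ i))
        ≈⟨ sum-snoc (suc n) (λ i → (n C i) × h i) ⟩
      ∑[ i < suc n ] ((n C toℕ i) × h (toℕ i)) + (n C suc n) × h (suc n)
        ≈⟨ +-congˡ (×-congˡ (k>n⇒nCk≡0 (ℕₚ.n<1+n n))) ⟩
      ∑[ i < suc n ] ((n C toℕ i) × h (toℕ i)) + 0#
        ≈⟨ +-identityʳ _ ⟩
      ∑[ i < suc n ] ((n C toℕ i) × h (toℕ i)) ∎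

  -- A factor independent of Y receives no Y-derivative, so the whole Y-degree goes to `g` and a
  -- product in X alone remains.
  ⊠-rowˡ : ∀ m n f g → ∂₂ f ≋ 𝟎 → (f ⊠ g) m n ≈ ((λ i → f i 0) ⊙ (λ i → g i n)) m
  ⊠-rowˡ zero    zero    f g ∂₂f≋𝟎 = refl
  ⊠-rowˡ zero    (suc n) f g ∂₂f≋𝟎 = trans
    (+-cong (⊠-zeroˡ g ∂₂f≋𝟎 0 n) (⊠-rowˡ zero n f (∂₂ g) ∂₂f≋𝟎)) (+-identityˡ _)
  ⊠-rowˡ (suc m) n       f g ∂₂f≋𝟎 =
    +-cong (⊠-rowˡ m n (∂₁ f) g (λ i → ∂₂f≋𝟎 (suc i))) (⊠-rowˡ m n f (∂₁ g) ∂₂f≋𝟎)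

  ⊠-columnˡ : ∀ m n f g → ∂₁ f ≋ 𝟎 → (f ⊠ g) m n ≈ (f 0 ⊙ g m) n
  ⊠-columnˡ zero    zero    f g ∂₁f≋𝟎 = refl
  ⊠-columnˡ zero    (suc n) f g ∂₁f≋𝟎 =
    +-cong (⊠-columnˡ zero n (∂₂ f) g (λ i j → ∂₁f≋𝟎 i (suc j))) (⊠-columnˡ zero n f (∂₂ g) ∂₁f≋𝟎)
  ⊠-columnˡ (suc m) n       f g ∂₁f≋𝟎 = trans
    (+-cong (⊠-zeroˡ g ∂₁f≋𝟎 m n) (⊠-columnˡ m n f (∂₁ g) ∂₁f≋𝟎)) (+-identityˡ _)

  -- For a function of X times a function of Y no convolution is left; this gives the left-hand side
  -- of the theorem, which has a single term.
  ⊠-row-column : ∀ m n f g → ∂₂ f ≋ 𝟎 → ∂₁ g ≋ 𝟎 → (f ⊠ g) m n ≈ f m 0 * g 0 n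
  ⊠-row-column zero    zero    f g f₂ g₁ = refl
  ⊠-row-column zero    (suc n) f g f₂ g₁ = trans
    (+-cong (⊠-zeroˡ g f₂ 0 n) (⊠-row-column zero n f (∂₂ g) f₂ (λ i j → g₁ i (suc j)))) (+-identityˡ _)
  ⊠-row-column (suc m) n       f g f₂ g₁ = trans
    (+-cong (⊠-row-column m n (∂₁ f) g (λ i → f₂ (suc i)) g₁) (⊠-zeroʳ f g₁ m n)) (+-identityʳ _)

  ∂₁-subst-0 : ∀ Q f → ∂₁ (subst 0# Q f) ≋ 𝟎
  ∂₁-subst-0 Q f m n = trans (∂₁-subst 0# Q f m n) (zeroˡ _)

  ∂₂-subst-0 : ∀ P f → ∂₂ (subst P 0# f) ≋ 𝟎
  ∂₂-subst-0 P f m n = trans (∂₂-subst P 0# f m n) (zeroˡ _)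

  -- u n plays the role of 1/n!.
  ⊙-egf : (u : Seq) → (∀ n → (n ℕ.!) × u n ≈ 1#) → ∀ f g n →
          (n ℕ.!) × ∑[ k < suc n ] (f (toℕ k) * u (toℕ k) * (g (n ℕ.∸ toℕ k) * u (n ℕ.∸ toℕ k))) ≈
          (f ⊙ g) n
  ⊙-egf u inverse f g n = begin
    (n ℕ.!) × ∑[ k < suc n ] (f (toℕ k) * u (toℕ k) * (g (n ℕ.∸ toℕ k) * u (n ℕ.∸ toℕ k)))
      ≈⟨ ×-as-* (n ℕ.!) _ ⟩
    ((n ℕ.!) × 1#) * ∑[ k < suc n ] (f (toℕ k) * u (toℕ k) * (g (n ℕ.∸ toℕ k) * u (n ℕ.∸ toℕ k)))
      ≈⟨ *-distribˡ-sum {suc n} ((n ℕ.!) × 1#)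
           (λ k → f (toℕ k) * u (toℕ k) * (g (n ℕ.∸ toℕ k) * u (n ℕ.∸ toℕ k))) ⟩
    ∑[ k < suc n ] (((n ℕ.!) × 1#) * (f (toℕ k) * u (toℕ k) * (g (n ℕ.∸ toℕ k) * u (n ℕ.∸ toℕ k))))
      ≈⟨ sum-cong-≋ {suc n} (λ k → term (toℕ k) (Finₚ.toℕ≤pred[n] k)) ⟩
    ∑[ k < suc n ] ((n C toℕ k) × (f (toℕ k) * g (n ℕ.∸ toℕ k)))
      ≈⟨ ⊙-binomial n f g ⟨
    (f ⊙ g) n ∎
    where
    binomial : ∀ {k} → k ℕ.≤ n → ((n ℕ.!) × 1#) * (u k * u (n ℕ.∸ k)) ≈ (n C k) × 1#
    binomial {k} k≤n = begin
      ((n ℕ.!) × 1#) * (u k * u (n ℕ.∸ k))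
        ≈⟨ *-congʳ (×-congˡ (nCk*k![n∸k]!≡n! k≤n)) ⟨
      ((n C k) ℕ.* (k ℕ.! ℕ.* (n ℕ.∸ k) ℕ.!)) × 1# * (u k * u (n ℕ.∸ k))
        ≈⟨ *-congʳ (trans (×1-homo-* (n C k) _) (*-congˡ (×1-homo-* (k ℕ.!) ((n ℕ.∸ k) ℕ.!)))) ⟩
      (n C k) × 1# * ((k ℕ.!) × 1# * ((n ℕ.∸ k) ℕ.!) × 1#) * (u k * u (n ℕ.∸ k))
        ≈⟨ trans (*-assoc _ _ _) (*-congˡ (*-interchange _ _ _ _)) ⟩
      (n C k) × 1# * ((k ℕ.!) × 1# * u k * (((n ℕ.∸ k) ℕ.!) × 1# * u (n ℕ.∸ k)))
        ≈⟨ *-congˡ (*-cong (trans (sym (×-as-* (k ℕ.!) _)) (inverse k))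
                           (trans (sym (×-as-* ((n ℕ.∸ k) ℕ.!) _)) (inverse (n ℕ.∸ k)))) ⟩
      (n C k) × 1# * (1# * 1#)
        ≈⟨ trans (*-congˡ (*-identityˡ 1#)) (*-identityʳ _) ⟩
      (n C k) × 1# ∎

    term : ∀ k → k ℕ.≤ n → ((n ℕ.!) × 1#) * (f k * u k * (g (n ℕ.∸ k) * u (n ℕ.∸ k))) ≈
                           (n C k) × (f k * g (n ℕ.∸ k))
    term k k≤n = begin
      ((n ℕ.!) × 1#) * (f k * u k * (g (n ℕ.∸ k) * u (n ℕ.∸ k)))  ≈⟨ *-congˡ (*-interchange _ _ _ _) ⟩
      ((n ℕ.!) × 1#) * (f k * g (n ℕ.∸ k) * (u k * u (n ℕ.∸ k)))  ≈⟨ x∙yz≈y∙xz _ _ _ ⟩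
      f k * g (n ℕ.∸ k) * (((n ℕ.!) × 1#) * (u k * u (n ℕ.∸ k)))  ≈⟨ *-congˡ (binomial k≤n) ⟩
      f k * g (n ℕ.∸ k) * ((n C k) × 1#)                          ≈⟨ *-comm _ _ ⟩
      (n C k) × 1# * (f k * g (n ℕ.∸ k))                          ≈⟨ ×-as-* (n C k) _ ⟨
      (n C k) × (f k * g (n ℕ.∸ k))                               ∎

  -- Partial sums and sums over a cycle

  accumulate : Seq → Seq
  accumulate f zero    = 0#
  accumulate f (suc n) = accumulate f n + f n

  accumulate≈sum : ∀ f n → accumulate f n ≈ ∑[ i < n ] f (toℕ i)
  accumulate≈sum f zero    = refl
  accumulate≈sum f (suc n) = trans (+-congʳ (accumulate≈sum f n)) (sym (sum-snoc n f))

  accumulate-neg : ∀ f n → accumulate (λ i → - f i) n ≈ - accumulate f n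
  accumulate-neg f zero    = sym -0#≈0#
  accumulate-neg f (suc n) = trans (+-congʳ (accumulate-neg f n)) (-‿+-comm (accumulate f n) (f n))

  module _ (g : ℤ → Carrier) where

    -- Jumps of m and n occur at increasing values M, but the value M contributes the summand of
    -- index -M, so the summands arrive in descending order.
    sum-descending : ∀ s n →
      accumulate (λ i → g (ℤ.- (s ℤ.+ + suc i))) n ≈ ∑[ μ < n ] g (ℤ.- (s ℤ.+ + n) ℤ.+ + toℕ μ)
    sum-descending s zero    = refl
    sum-descending s (suc n) = begin
      accumulate (λ i → g (ℤ.- (s ℤ.+ + suc i))) n + g (ℤ.- (s ℤ.+ + suc n))
        ≈⟨ +-comm _ _ ⟩
      g (ℤ.- (s ℤ.+ + suc n)) + accumulate (λ i → g (ℤ.- (s ℤ.+ + suc i))) n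
        ≈⟨ +-cong (reflexive (≡.cong g (≡.sym (ℤₚ.+-identityʳ (ℤ.- (s ℤ.+ + suc n)))))) (sum-descending s n) ⟩
      g (ℤ.- (s ℤ.+ + suc n) ℤ.+ + 0) + ∑[ μ < n ] g (ℤ.- (s ℤ.+ + n) ℤ.+ + toℕ μ)
        ≈⟨ +-congˡ (sum-cong-≋ {n} λ μ → reflexive (≡.cong g (shift (+ n) (+ toℕ μ)))) ⟩
      g (ℤ.- (s ℤ.+ + suc n) ℤ.+ + 0) + ∑[ μ < n ] g (ℤ.- (s ℤ.+ + suc n) ℤ.+ + suc (toℕ μ)) ∎
      where
      shift : ∀ i j → ℤ.- (s ℤ.+ i) ℤ.+ j ≡ ℤ.- (s ℤ.+ (1ℤ ℤ.+ i)) ℤ.+ (1ℤ ℤ.+ j)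
      shift i j = solve 3 (λ s i j → :- (s :+ i) :+ j := :- (s :+ (con 1ℤ :+ i)) :+ (con 1ℤ :+ j)) ≡.refl s i j
        where open ℤSolver

    module _ (n : ℕ) (periodic : ∀ i → g (i ℤ.+ + n) ≈ g i) where

      sum-from : ℤ → Carrier
      sum-from s = ∑[ μ < n ] g (s ℤ.+ + toℕ μ)

      sum-from-suc : ∀ s → sum-from (s ℤ.+ 1ℤ) ≈ sum-from s
      -- With `g s` added, both sides are the sum of `n + 1` consecutive terms, once without
      -- splitting and once with its last term replaced by periodicity.
      sum-from-suc s = +-cancelˡ (g s) _ _ (begin
        g s + ∑[ μ < n ] g (s ℤ.+ 1ℤ ℤ.+ + toℕ μ)
          ≈⟨ +-cong (reflexive (≡.cong g (≡.sym (ℤₚ.+-identityʳ s))))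
               (sum-cong-≋ {n} λ μ → reflexive (≡.cong g (ℤₚ.+-assoc s 1ℤ (+ toℕ μ)))) ⟩
        ∑[ μ < suc n ] g (s ℤ.+ + toℕ μ)
          ≈⟨ sum-snoc n (λ μ → g (s ℤ.+ + μ)) ⟩
        ∑[ μ < n ] g (s ℤ.+ + toℕ μ) + g (s ℤ.+ + n)
          ≈⟨ trans (+-congˡ (periodic s)) (+-comm _ _) ⟩
        g s + ∑[ μ < n ] g (s ℤ.+ + toℕ μ) ∎)

      sum-from-const : ∀ s → sum-from s ≈ sum-from (+ 0)
      sum-from-const (+ zero)     = refl
      sum-from-const (+ suc k)    = trans
        (reflexive (≡.cong (λ i → sum-from (+ i)) (≡.sym (ℕₚ.+-comm k 1))))
        (trans (sum-from-suc (+ k)) (sum-from-const (+ k)))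
      sum-from-const -[1+ zero ]  = sym (sum-from-suc -[1+ 0 ])
      sum-from-const -[1+ suc k ] = trans (sym (sum-from-suc -[1+ suc k ])) (sum-from-const -[1+ k ])

      sum-cyclic : ∀ s → sum-from s ≈ ∑[ μ < n ] g (+ toℕ μ)
      sum-cyclic s = trans (sum-from-const s)
        (sum-cong-≋ {n} λ μ → reflexive (≡.cong g (ℤₚ.+-identityˡ (+ toℕ μ))))

  -- The series 2/(e^s + 1) and its functional equations

  module EulerSeries
    (halve : ∀ {x y} → x + x ≈ y + y → x ≈ y)
    (E : ℕ → Carrier → Carrier)
    (E-recurrence : ∀ r n → ((1# ^_) ⊙ (λ k → E k r)) n + E n r ≈ r ^ n + r ^ n)
    where

    -- 2/(e^{PX+QY} + 1)
    U : Carrier → Carrier → Seq²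
    U P Q = subst P Q (λ n → E n 0#)

    two : Seq² → Seq²
    two f = f ⊞ f

    two-⊠ : ∀ f g → two f ⊠ g ≋ two (f ⊠ g)
    two-⊠ f g = ⊠-distribʳ g f f

    ⊠-two : ∀ f g → f ⊠ two g ≋ two (f ⊠ g)
    ⊠-two f g = ⊠-distribˡ f g g

    -- `E-recurrence` is the coefficientwise form of (e^t + 1) ∑ Eₙ(r) tⁿ/n! = 2 e^{rt}; here it is
    -- transported to t = PX + QY by `subst-homo`.
    subst-E : ∀ P Q r → e P Q ⊠ subst P Q (λ n → E n r) ⊞ subst P Q (λ n → E n r) ≋
              two (e (r * P) (r * Q))
    subst-E P Q r m n = begin
      (e P Q ⊠ F) m n + F m n
        ≈⟨ +-congʳ (⊠-cong (λ i j → sym (trans (subst-^ P Q 1# i j) (e-cong (*-identityˡ P) (*-identityˡ Q) i j)))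
                           (≋-refl {F}) m n) ⟩
      (subst P Q (1# ^_) ⊠ F) m n + F m n
        ≈⟨ +-congʳ (subst-homo P Q (1# ^_) (λ k → E k r) m n) ⟨
      P ^ m * Q ^ n * ((1# ^_) ⊙ (λ k → E k r)) (m ℕ.+ n) + P ^ m * Q ^ n * E (m ℕ.+ n) r
        ≈⟨ distribˡ _ _ _ ⟨
      P ^ m * Q ^ n * (((1# ^_) ⊙ (λ k → E k r)) (m ℕ.+ n) + E (m ℕ.+ n) r)
        ≈⟨ *-congˡ (E-recurrence r (m ℕ.+ n)) ⟩
      P ^ m * Q ^ n * (r ^ (m ℕ.+ n) + r ^ (m ℕ.+ n))
        ≈⟨ distribˡ _ _ _ ⟩
      subst P Q (r ^_) m n + subst P Q (r ^_) m n
        ≈⟨ +-cong (subst-^ P Q r m n) (subst-^ P Q r m n) ⟩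
      two (e (r * P) (r * Q)) m n ∎
      where F = subst P Q (λ n → E n r)

    U-inverse : ∀ P Q → e P Q ⊠ U P Q ⊞ U P Q ≋ two (e 0# 0#)
    U-inverse P Q m n = trans (subst-E P Q 0# m n)
      (+-cong (e-cong (zeroˡ P) (zeroˡ Q) m n) (e-cong (zeroˡ P) (zeroˡ Q) m n))

    -- Once `e R S` is factored out, e^{PX+QY} + 1 meets its own reciprocal in `U P Q`. The sum, not
    -- the difference, is relevant since the sign of the step function alternates.
    jump : ∀ P Q R S f → e (R + P) (S + Q) ⊠ (U P Q ⊠ f) ⊞ e R S ⊠ (U P Q ⊠ f) ≋ two (e R S ⊠ f)
    jump P Q R S f m n = begin
      (e (R + P) (S + Q) ⊠ (u ⊠ f)) m n + (e R S ⊠ (u ⊠ f)) m n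
        ≈⟨ +-congʳ (trans (⊠-cong (≋-sym (e-homo R S P Q)) (≋-refl {u ⊠ f}) m n)
             (trans (⊠-assoc (e R S) (e P Q) (u ⊠ f) m n)
                    (⊠-cong (≋-refl {e R S}) (≋-sym (⊠-assoc (e P Q) u f)) m n))) ⟩
      (e R S ⊠ ((e P Q ⊠ u) ⊠ f)) m n + (e R S ⊠ (u ⊠ f)) m n
        ≈⟨ ⊠-distribˡ (e R S) ((e P Q ⊠ u) ⊠ f) (u ⊠ f) m n ⟨
      (e R S ⊠ ((e P Q ⊠ u) ⊠ f ⊞ u ⊠ f)) m n
        ≈⟨ ⊠-cong (≋-refl {e R S}) (≋-sym (⊠-distribʳ f (e P Q ⊠ u) u)) m n ⟩
      (e R S ⊠ ((e P Q ⊠ u ⊞ u) ⊠ f)) m n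
        ≈⟨ ⊠-cong (≋-refl {e R S}) (⊠-cong (U-inverse P Q) (≋-refl {f})) m n ⟩
      (e R S ⊠ (two (e 0# 0#) ⊠ f)) m n
        ≈⟨ ⊠-cong (≋-refl {e R S}) (two-⊠ (e 0# 0#) f) m n ⟩
      (e R S ⊠ two (e 0# 0# ⊠ f)) m n
        ≈⟨ ⊠-two (e R S) (e 0# 0# ⊠ f) m n ⟩
      two (e R S ⊠ (e 0# 0# ⊠ f)) m n
        ≈⟨ +-cong unit unit ⟩
      two (e R S ⊠ f) m n ∎
      where
      u = U P Q
      unit = ⊠-cong (≋-refl {e R S}) (≋-trans (⊠-comm (e 0# 0#) f) (⊠-identityʳ f)) m n

    -- This is division by e^{PX+QY} + 1: multiplying the hypothesis by `U P Q` replaces that factor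
    -- by 2, which `halve` cancels.
    U-unique : ∀ P Q R S f → e P Q ⊠ f ⊞ f ≋ two (e R S) → f ≋ e R S ⊠ U P Q
    U-unique P Q R S f eq m n = halve (begin
      f m n + f m n
        ≈⟨ +-cong unit unit ⟨
      two (e 0# 0# ⊠ f) m n
        ≈⟨ jump P Q 0# 0# f m n ⟨
      (e (0# + P) (0# + Q) ⊠ (u ⊠ f)) m n + (e 0# 0# ⊠ (u ⊠ f)) m n
        ≈⟨ +-cong (⊠-cong (e-cong (+-identityˡ P) (+-identityˡ Q)) (≋-refl {u ⊠ f}) m n)
                  (trans (⊠-comm (e 0# 0#) (u ⊠ f) m n) (⊠-identityʳ (u ⊠ f) m n)) ⟩
      (e P Q ⊠ (u ⊠ f)) m n + (u ⊠ f) m n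
        ≈⟨ +-congʳ (trans (≋-sym (⊠-assoc (e P Q) u f) m n)
             (trans (⊠-cong (⊠-comm (e P Q) u) (≋-refl {f}) m n) (⊠-assoc u (e P Q) f m n))) ⟩
      (u ⊠ (e P Q ⊠ f)) m n + (u ⊠ f) m n
        ≈⟨ ⊠-distribˡ u (e P Q ⊠ f) f m n ⟨
      (u ⊠ (e P Q ⊠ f ⊞ f)) m n
        ≈⟨ ⊠-cong (≋-refl {u}) eq m n ⟩
      (u ⊠ two (e R S)) m n
        ≈⟨ ⊠-two u (e R S) m n ⟩
      two (u ⊠ e R S) m n
        ≈⟨ +-cong (⊠-comm u (e R S) m n) (⊠-comm u (e R S) m n) ⟩
      two (e R S ⊠ u) m n ∎)
      where
      u = U P Q
      unit = trans (⊠-comm (e 0# 0#) f m n) (⊠-identityʳ f m n)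

    subst-E≋e⊠U : ∀ P Q r → subst P Q (λ n → E n r) ≋ e (r * P) (r * Q) ⊠ U P Q
    subst-E≋e⊠U P Q r = U-unique P Q (r * P) (r * Q) (subst P Q (λ n → E n r)) (subst-E P Q r)

    -- With s = PX + QY this is 2/(e^(-s) + 1) = e^s · 2/(e^s + 1); `U-unique` reduces it to a jump
    -- with step (-P, -Q) starting from (P, Q).
    U-neg : ∀ P Q → U (- P) (- Q) ≋ e P Q ⊠ U P Q
    U-neg P Q = U-unique P Q P Q u (λ m n → begin
      (e P Q ⊠ u) m n + u m n
        ≈⟨ +-comm _ _ ⟩
      u m n + (e P Q ⊠ u) m n
        ≈⟨ +-congʳ (trans (⊠-comm (e 0# 0#) u m n) (⊠-identityʳ u m n)) ⟨
      (e 0# 0# ⊠ u) m n + (e P Q ⊠ u) m n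
        ≈⟨ +-cong (⊠-cong (e-cong (sym (-‿inverseʳ P)) (sym (-‿inverseʳ Q))) (≋-sym (⊠-identityʳ u)) m n)
                  (⊠-cong (≋-refl {e P Q}) (≋-sym (⊠-identityʳ u)) m n) ⟩
      (e (P + - P) (Q + - Q) ⊠ (u ⊠ e 0# 0#)) m n + (e P Q ⊠ (u ⊠ e 0# 0#)) m n
        ≈⟨ jump (- P) (- Q) P Q (e 0# 0#) m n ⟩
      two (e P Q ⊠ e 0# 0#) m n
        ≈⟨ +-cong (⊠-identityʳ (e P Q) m n) (⊠-identityʳ (e P Q) m n) ⟩
      two (e P Q) m n ∎)
      where u = U (- P) (- Q)

    U-cong : ∀ {P P′ Q Q′} → P ≈ P′ → Q ≈ Q′ → U P Q ≋ U P′ Q′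
    U-cong p q m n = *-congʳ (e-cong p q m n)

    subst-⊠-subst : ∀ P₁ Q₁ P₂ Q₂ {f₁ f₂ : Seq} {s₁ s₂ r₁ r₂} →
      (∀ n → f₁ n ≈ s₁ * E n r₁) → (∀ n → f₂ n ≈ s₂ * E n r₂) →
      subst P₁ Q₁ f₁ ⊠ subst P₂ Q₂ f₂ ≋
      (s₁ * s₂) · (e (r₁ * P₁ + r₂ * P₂) (r₁ * Q₁ + r₂ * Q₂) ⊠ (U P₁ Q₁ ⊠ U P₂ Q₂))
    subst-⊠-subst P₁ Q₁ P₂ Q₂ {f₁} {f₂} {s₁} {s₂} {r₁} {r₂} eq₁ eq₂ m n = begin
      (subst P₁ Q₁ f₁ ⊠ subst P₂ Q₂ f₂) m n
        ≈⟨ subst-⊠-subst-scale P₁ Q₁ P₂ Q₂ {f₁} {f₂} eq₁ eq₂ m n ⟩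
      s₁ * s₂ * (subst P₁ Q₁ (λ k → E k r₁) ⊠ subst P₂ Q₂ (λ k → E k r₂)) m n
        ≈⟨ *-congˡ (⊠-cong (subst-E≋e⊠U P₁ Q₁ r₁) (subst-E≋e⊠U P₂ Q₂ r₂) m n) ⟩
      s₁ * s₂ * ((e₁ ⊠ U P₁ Q₁) ⊠ (e₂ ⊠ U P₂ Q₂)) m n
        ≈⟨ *-congˡ (⊠-interchange e₁ (U P₁ Q₁) e₂ (U P₂ Q₂) m n) ⟩
      s₁ * s₂ * ((e₁ ⊠ e₂) ⊠ (U P₁ Q₁ ⊠ U P₂ Q₂)) m n
        ≈⟨ *-congˡ (⊠-cong (e-homo (r₁ * P₁) (r₁ * Q₁) (r₂ * P₂) (r₂ * Q₂)) (≋-refl {U P₁ Q₁ ⊠ U P₂ Q₂}) m n) ⟩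
      s₁ * s₂ * (e (r₁ * P₁ + r₂ * P₂) (r₁ * Q₁ + r₂ * Q₂) ⊠ (U P₁ Q₁ ⊠ U P₂ Q₂)) m n ∎
      where
      e₁ = e (r₁ * P₁) (r₁ * Q₁)
      e₂ = e (r₂ * P₂) (r₂ * Q₂)

    -- The product of three series and its three kinds of jumps

    module _ (α β γ : Carrier) where

      Ψ : Carrier → Carrier → Seq²
      Ψ P Q = e P Q ⊠ (U α 0# ⊠ (U 0# β ⊠ U γ γ))

      Ψ-cong : ∀ {P P′ Q Q′} → P ≈ P′ → Q ≈ Q′ → Ψ P Q ≋ Ψ P′ Q′
      Ψ-cong p q = ⊠-cong (e-cong p q) (≋-refl {U α 0# ⊠ (U 0# β ⊠ U γ γ)})

      Ψ-jump₁ : ∀ P Q → Ψ (P + α) Q ⊞ Ψ P Q ≋ two (e P Q ⊠ (U 0# β ⊠ U γ γ))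
      Ψ-jump₁ P Q m n = trans (+-congʳ (Ψ-cong refl (sym (+-identityʳ Q)) m n))
        (jump α 0# P Q (U 0# β ⊠ U γ γ) m n)

      Ψ-jump₂ : ∀ P Q → Ψ P (Q + β) ⊞ Ψ P Q ≋ two (e P Q ⊠ (U α 0# ⊠ U γ γ))
      Ψ-jump₂ P Q m n = trans
        (+-cong (⊠-cong (e-cong (sym (+-identityʳ P)) refl) swap m n) (⊠-cong (≋-refl {e P Q}) swap m n))
        (jump 0# β P Q (U α 0# ⊠ U γ γ) m n)
        where
        swap : U α 0# ⊠ (U 0# β ⊠ U γ γ) ≋ U 0# β ⊠ (U α 0# ⊠ U γ γ)
        swap = ≋-trans (≋-sym (⊠-assoc (U α 0#) (U 0# β) (U γ γ))) (≋-trans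
          (⊠-cong (⊠-comm (U α 0#) (U 0# β)) (≋-refl {U γ γ})) (⊠-assoc (U 0# β) (U α 0#) (U γ γ)))

      Ψ-jump₃ : ∀ P Q → Ψ (P + γ) (Q + γ) ⊞ Ψ P Q ≋ two (e P Q ⊠ (U α 0# ⊠ U 0# β))
      Ψ-jump₃ P Q m n = trans
        (+-cong (⊠-cong (≋-refl {e (P + γ) (Q + γ)}) rotate m n) (⊠-cong (≋-refl {e P Q}) rotate m n))
        (jump γ γ P Q (U α 0# ⊠ U 0# β) m n)
        where
        rotate : U α 0# ⊠ (U 0# β ⊠ U γ γ) ≋ U γ γ ⊠ (U α 0# ⊠ U 0# β)
        rotate = ≋-trans (≋-sym (⊠-assoc (U α 0#) (U 0# β) (U γ γ))) (⊠-comm (U α 0# ⊠ U 0# β) (U γ γ))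

      module _ {f₁ f₂ : Seq} {s₁ s₂ r₁ r₂}
        (eq₁ : ∀ n → f₁ n ≈ s₁ * E n r₁) (eq₂ : ∀ n → f₂ n ≈ s₂ * E n r₂) (P Q : Carrier) where

        -- The extra `β` in the exponent of Y is the factor e^{βY} produced by reflecting
        -- `U 0# (- β)` to `U 0# β`.
        event₁ : r₁ * γ ≈ P → r₁ * γ + - (r₂ * β) + β ≈ Q →
          subst γ γ f₁ ⊠ subst 0# (- β) f₂ ≋ (s₁ * s₂) · (e P Q ⊠ (U 0# β ⊠ U γ γ))
        event₁ p q m n = begin
          (subst γ γ f₁ ⊠ subst 0# (- β) f₂) m n
            ≈⟨ subst-⊠-subst γ γ 0# (- β) eq₁ eq₂ m n ⟩
          s₁ * s₂ * (e (r₁ * γ + r₂ * 0#) (r₁ * γ + r₂ * - β) ⊠ (U γ γ ⊠ U 0# (- β))) m n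
            ≈⟨ *-congˡ (⊠-cong (≋-refl {e (r₁ * γ + r₂ * 0#) (r₁ * γ + r₂ * - β)}) reflected m n) ⟩
          s₁ * s₂ * (e (r₁ * γ + r₂ * 0#) (r₁ * γ + r₂ * - β) ⊠ (e 0# β ⊠ (U 0# β ⊠ U γ γ))) m n
            ≈⟨ *-congˡ (⊠-assoc (e (r₁ * γ + r₂ * 0#) (r₁ * γ + r₂ * - β)) (e 0# β) (U 0# β ⊠ U γ γ) m n) ⟨
          s₁ * s₂ * ((e (r₁ * γ + r₂ * 0#) (r₁ * γ + r₂ * - β) ⊠ e 0# β) ⊠ (U 0# β ⊠ U γ γ)) m n
            ≈⟨ *-congˡ (⊠-cong (≋-trans (e-homo (r₁ * γ + r₂ * 0#) (r₁ * γ + r₂ * - β) 0# β)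
                 (e-cong (trans (+-identityʳ _) (trans (+-congˡ (zeroʳ r₂)) (trans (+-identityʳ _) p)))
                         (trans (+-congʳ (+-congˡ (sym (-‿distribʳ-* r₂ β)))) q)))
                 (≋-refl {U 0# β ⊠ U γ γ}) m n) ⟩
          s₁ * s₂ * (e P Q ⊠ (U 0# β ⊠ U γ γ)) m n ∎
          where
          reflected : U γ γ ⊠ U 0# (- β) ≋ e 0# β ⊠ (U 0# β ⊠ U γ γ)
          reflected = ≋-trans (⊠-comm (U γ γ) (U 0# (- β))) (≋-trans
            (⊠-cong (≋-trans (U-cong (sym -0#≈0#) refl) (U-neg 0# β)) (≋-refl {U γ γ}))
            (⊠-assoc (e 0# β) (U 0# β) (U γ γ)))

        event₂ : r₁ * γ + r₂ * α ≈ P → r₁ * γ ≈ Q →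
          subst γ γ f₁ ⊠ subst α 0# f₂ ≋ (s₁ * s₂) · (e P Q ⊠ (U α 0# ⊠ U γ γ))
        event₂ p q m n = trans (subst-⊠-subst γ γ α 0# eq₁ eq₂ m n) (*-congˡ
          (⊠-cong (e-cong p (trans (+-congˡ (zeroʳ r₂)) (trans (+-identityʳ _) q)))
                  (⊠-comm (U γ γ) (U α 0#)) m n))

        event₃ : r₁ * α ≈ P → r₂ * β ≈ Q →
          subst α 0# f₁ ⊠ subst 0# β f₂ ≋ (s₁ * s₂) · (e P Q ⊠ (U α 0# ⊠ U 0# β))
        event₃ p q m n = trans (subst-⊠-subst α 0# 0# β eq₁ eq₂ m n) (*-congˡ
          (⊠-cong (e-cong (trans (+-congˡ (zeroʳ r₂)) (trans (+-identityʳ _) p))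
                          (trans (+-congʳ (zeroʳ r₁)) (trans (+-identityˡ _) q)))
                  (≋-refl {U α 0# ⊠ U 0# β}) m n))

-- Real numbers

open import Defs
open Estimates
open Bounds
open IntegerParts

-- For Cauchy sequences, closeness of the tails follows from comparing the two rationals at one late
-- index `J`. That comparison is decidable, hence stable, and can be extracted from the double
-- negation.
≈-stable : ∀ {x y} → ¬ ¬ (x ≈ y) → x ≈ y
≈-stable {x} {y} ¬¬x≈y = mk≈ λ ε 0<ε →
  -- Each use of `diff-trans` halves the tolerance: the conclusion spends ε/2 + ε/4 + ε/4, and
  -- `near` obtains ε/4 as ε/8 + ε/16 + ε/16.
  let ε/2  = ε ℚ.* ½   ; 0<ε/2  = half-pos 0<ε
      ε/4  = ε/2 ℚ.* ½ ; 0<ε/4  = half-pos 0<ε/2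
      ε/8  = ε/4 ℚ.* ½ ; 0<ε/8  = half-pos 0<ε/4
      ε/16 = ε/8 ℚ.* ½ ; 0<ε/16 = half-pos 0<ε/8
      K , hx  = cauchy x ε/2 0<ε/2
      L , hy  = cauchy y ε/4 0<ε/4
      M , hx′ = cauchy x ε/8 0<ε/8
      N , hy′ = cauchy y ε/16 0<ε/16
      J = (K ℕ.⊔ L) ℕ.⊔ (M ℕ.⊔ N)
      K⊔L≤J = ℕₚ.m≤m⊔n (K ℕ.⊔ L) (M ℕ.⊔ N)
      M⊔N≤J = ℕₚ.m≤n⊔m (K ℕ.⊔ L) (M ℕ.⊔ N)
      K≤J = ℕₚ.≤-trans (ℕₚ.m≤m⊔n K L) K⊔L≤J
      L≤J = ℕₚ.≤-trans (ℕₚ.m≤n⊔m K L) K⊔L≤J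
      M≤J = ℕₚ.≤-trans (ℕₚ.m≤m⊔n M N) M⊔N≤J
      N≤J = ℕₚ.≤-trans (ℕₚ.m≤n⊔m M N) M⊔N≤J
      near : x ≈ y → ℚ.∣ seq x J ℚ.- seq y J ∣ ℚ.< ε/4
      near x≈y =
        let I , h = close x≈y ε/16 0<ε/16
            n   = I ℕ.⊔ J
            I≤n = ℕₚ.m≤m⊔n I J
            J≤n = ℕₚ.m≤n⊔m I J
        in diff-trans (seq x J) (seq x n) (seq y J) (hx′ J n M≤J (ℕₚ.≤-trans M≤J J≤n))
             (diff-trans (seq x n) (seq y n) (seq y J) (h n I≤n) (hy′ n J (ℕₚ.≤-trans N≤J J≤n) N≤J))
      at-J : ℚ.∣ seq x J ℚ.- seq y J ∣ ℚ.< ε/4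
      at-J = decidable-stable (ℚ.∣ seq x J ℚ.- seq y J ∣ ℚₚ.<? ε/4) λ far → ¬¬x≈y λ x≈y → far (near x≈y)
  in J , λ n J≤n → diff-trans (seq x n) (seq x J) (seq y n) (hx n J (ℕₚ.≤-trans K≤J J≤n) K≤J)
       (diff-trans (seq x J) (seq y J) (seq y n) at-J (hy J n L≤J (ℕₚ.≤-trans L≤J J≤n)))

by-cases : ∀ {x y} (P : Set) → (Dec P → x ≈ y) → x ≈ y
by-cases P f = ≈-stable λ x≉y → x≉y (f (no λ p → x≉y (f (yes p))))

<-trans : ∀ {x y z} → x < y → y < z → x < z
<-trans {x} {y} {z} (mk< ε 0<ε x<y) (mk< δ 0<δ y<z) = mk< ε 0<ε (both
  (λ n x+ε<y y+δ<z → ℚₚ.<-trans x+ε<y (ℚₚ.≤-<-trans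
    (≡.subst (ℚ._≤ seq y n ℚ.+ δ) (ℚₚ.+-identityʳ (seq y n)) (ℚₚ.+-monoʳ-≤ (seq y n) (ℚₚ.<⇒≤ 0<δ))) y+δ<z))
  x<y y<z)

-- The rational test ε/2 < `w N` chooses the side. From `N` on, y - x stays within ε/4 of `w N`, so
-- it either exceeds ε/4 or stays below 3ε/4; in the second case z - y exceeds ε/4 eventually.
<-cotrans : ∀ {x z} y → x < z → x < y ⊎ y < z
<-cotrans {x} {z} y (mk< ε 0<ε (M , x<z)) = decide (ε/2 ℚₚ.<? w N)
  where
  ε/2 ε/4 : ℚ
  ε/2 = ε ℚ.* ½
  ε/4 = ε/2 ℚ.* ½
  0<ε/4 : 0ℚ ℚ.< ε/4
  0<ε/4 = half-pos (half-pos 0<ε)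
  w : ℕ → ℚ
  w = seq (y - x)
  N : ℕ
  N = proj₁ (cauchy (y - x) ε/4 0<ε/4)
  near : ∀ m n → N ℕ.≤ m → N ℕ.≤ n → w m ℚ.- w n ℚ.< ε/4
  near m n N≤m N≤n = ℚₚ.≤-<-trans (p≤∣p∣ (w m ℚ.- w n)) (proj₂ (cauchy (y - x) ε/4 0<ε/4) m n N≤m N≤n)
  open ℚSolver
  open ℚₚ.≤-Reasoning
  decide : Dec (ε/2 ℚ.< w N) → x < y ⊎ y < z
  decide (yes ε/2<w) = inj₁ (mk< ε/4 0<ε/4 (N , λ n N≤n → begin-strict
    seq x n ℚ.+ ε/4                          ≡⟨ solve 2 (λ x e → x :+ e :* con ½ :* con ½ := e :* con ½ :+ x :- e :* con ½ :* con ½) ≡.refl (seq x n) ε ⟩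
    ε/2 ℚ.+ seq x n ℚ.- ε/4                  <⟨ ℚₚ.+-monoˡ-< (ℚ.- ε/4) (ℚₚ.+-monoˡ-< (seq x n) ε/2<w) ⟩
    w N ℚ.+ seq x n ℚ.- ε/4                  <⟨ ℚₚ.+-monoʳ-< (w N ℚ.+ seq x n) (ℚₚ.neg-antimono-< (near N n ℕₚ.≤-refl N≤n)) ⟩
    w N ℚ.+ seq x n ℚ.- (w N ℚ.- w n)        ≡⟨ solve 3 (λ x y w → w :+ x :- (w :- (y :- x)) := y) ≡.refl (seq x n) (seq y n) (w N) ⟩
    seq y n                                  ∎))
  decide (no  ε/2≮w) = inj₂ (mk< ε/4 0<ε/4 (M ℕ.⊔ N , λ n M⊔N≤n → begin-strict
    seq y n ℚ.+ ε/4                          ≡⟨ solve 4 (λ x y w e → y :+ e :* con ½ :* con ½ := (((y :- x) :- w) :+ w) :+ (x :+ e :* con ½ :* con ½)) ≡.refl (seq x n) (seq y n) (w N) ε ⟩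
    ((w n ℚ.- w N) ℚ.+ w N) ℚ.+ (seq x n ℚ.+ ε/4)
      <⟨ ℚₚ.+-monoˡ-< (seq x n ℚ.+ ε/4) (ℚₚ.+-mono-<-≤ (near n N (ℕₚ.≤-trans (ℕₚ.m≤n⊔m M N) M⊔N≤n) ℕₚ.≤-refl) (ℚₚ.≮⇒≥ ε/2≮w)) ⟩
    (ε/4 ℚ.+ ε/2) ℚ.+ (seq x n ℚ.+ ε/4)      ≡⟨ solve 2 (λ x e → (e :* con ½ :* con ½ :+ e :* con ½) :+ (x :+ e :* con ½ :* con ½) := x :+ e) ≡.refl (seq x n) ε ⟩
    seq x n ℚ.+ ε                            <⟨ x<z n (ℕₚ.≤-trans (ℕₚ.m≤m⊔n M N) M⊔N≤n) ⟩
    seq z n                                  ∎))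

≤-<-trans : ∀ {x y z} → x ≤ y → y < z → x < z
≤-<-trans {x} x≤y y<z with <-cotrans x y<z
... | inj₁ y<x = ⊥-elim (x≤y y<x)
... | inj₂ x<z = x<z

<-≤-trans : ∀ {x y z} → x < y → y ≤ z → x < z
<-≤-trans {z = z} x<y y≤z with <-cotrans z x<y
... | inj₁ x<z = x<z
... | inj₂ z<y = ⊥-elim (y≤z z<y)

<-irrefl : ∀ {x} → ¬ (x < x)
<-irrefl {x} (mk< ε 0<ε (N , h)) = ℚₚ.<-irrefl ≡.refl (ℚₚ.<-trans
  (≡.subst (ℚ._< seq x N ℚ.+ ε) (ℚₚ.+-identityʳ (seq x N)) (ℚₚ.+-monoʳ-< (seq x N) 0<ε)) (h N ℕₚ.≤-refl))

module R = CommutativeRing +-*-commutativeRing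

module ℝSolver where

  -- Rational coefficients have decidable equality, so the solver can normalise constants such as ½
  -- in identities between reals.
  fromℚ-homomorphism : CommutativeRing.rawRing ℚₚ.+-*-commutativeRing -Raw-AlmostCommutative⟶ fromCommutativeRing +-*-commutativeRing
  fromℚ-homomorphism = record
    { ⟦_⟧    = fromℚ
    ; +-homo = λ p q → ≗⇒≈ λ _ → ≡.refl
    ; *-homo = λ p q → ≗⇒≈ λ _ → ≡.refl
    ; -‿homo = λ p → ≗⇒≈ λ _ → ≡.refl
    ; 0-homo = ≗⇒≈ λ _ → ≡.refl
    ; 1-homo = ≗⇒≈ λ _ → ≡.refl
    }

  open Algebra.Solver.Ring (CommutativeRing.rawRing ℚₚ.+-*-commutativeRing) (fromCommutativeRing +-*-commutativeRing) fromℚ-homomorphism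
    (λ p q → Maybe.map (λ p≡q → R.reflexive (≡.cong fromℚ p≡q)) (dec⇒maybe (p ℚₚ.≟ q))) public


open ℝSolver using (solve; _:=_; _:+_; _:*_; _:-_; :-_; con)
open HurwitzSeries +-*-commutativeRing
  using ( accumulate; accumulate-neg; accumulate≈sum; sum-descending; sum-cyclic; e; subst; subst-⊠-subst-scale
        ; _⊠_; ⊠-comm; ⊠-rowˡ; ⊠-columnˡ; ⊠-row-column; _⊙_; ⊙-binomial; ⊙-egf; ∂₁-subst-0; ∂₂-subst-0)
open import Algebra.Properties.CommutativeSemiring.Exp R.commutativeSemiring using (^-distrib-*)
open import Algebra.Properties.Semiring.Exp R.semiring using (^-homo-*)
open import Algebra.Properties.Semiring.Mult R.semiring
  using () renaming (_×_ to _×ᴿ_; ×-assoc-* to ×ᴿ-assoc-*; ×-congʳ to ×ᴿ-congʳ)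
open import Algebra.Properties.Semiring.Sum R.semiring using (*-distribˡ-sum; ∑-comm; ∑-distrib-+; sum-replicate-zero)
open import Relation.Binary.Reasoning.Setoid R.setoid

-- Comparisons of event times become comparisons of arguments of ℰ, and back, by multiplying a
-- difference by d or 1/d; the remaining equation is a ring identity.
<-scale : ∀ {r} → 0ℚ ℚ.< r → ∀ {x y x′ y′} → fromℚ r * (y - x) ≈ y′ - x′ → x < y → x′ < y′
<-scale {r} 0<r {x} {y} eq (mk< ε 0<ε (N , h)) = <-transport
  (≈-trans (solve 3 (λ r x y → r :* y :- r :* x := r :* (y :- x)) ≈-refl (fromℚ r) x y) eq)
  (mk< (r ℚ.* ε) (ℚₚ.positive⁻¹ _ {{ℚₚ.pos*pos⇒pos r {{ℚ.positive 0<r}} ε {{ℚ.positive 0<ε}}}})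
    (N , λ n N≤n → ≡.subst (ℚ._< r ℚ.* seq y n) (ℚₚ.*-distribˡ-+ r (seq x n) ε)
      (ℚₚ.*-monoʳ-<-pos r {{ℚ.positive 0<r}} (h n N≤n))))

fromℤ-+ : ∀ m n → fromℤ (m ℤ.+ n) ≈ fromℤ m + fromℤ n
fromℤ-+ m n = ≗⇒≈ λ _ → /1-homo-+ m n

fromℤ-neg : ∀ m → fromℤ (ℤ.- m) ≈ - fromℤ m
fromℤ-neg m = begin
  fromℤ (ℤ.- m)                         ≈⟨ solve 2 (λ x y → y := (x :+ y) :- x) ≈-refl (fromℤ m) (fromℤ (ℤ.- m)) ⟩
  (fromℤ m + fromℤ (ℤ.- m)) - fromℤ m   ≈⟨ R.+-congʳ (fromℤ-+ m (ℤ.- m)) ⟨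
  fromℤ (m ℤ.+ ℤ.- m) - fromℤ m         ≡⟨ ≡.cong (λ i → fromℤ i - fromℤ m) (ℤₚ.+-inverseʳ m) ⟩
  0ℝ - fromℤ m                          ≈⟨ R.+-identityˡ (- fromℤ m) ⟩
  - fromℤ m                             ∎

n*1/n≈1 : ∀ n .{{_ : NonZero n}} → fromℕ n * fromℚ (1ℤ ℚ./ n) ≈ 1ℝ
n*1/n≈1 n = ≗⇒≈ λ _ → n/n≡1 n

0<n/1 : ∀ n .{{_ : NonZero n}} → 0ℚ ℚ.< + n ℚ./ 1
0<n/1 n = ℚₚ.positive⁻¹ _ {{ℚₚ.normalize-pos n 1}}

0<1/n : ∀ n .{{_ : NonZero n}} → 0ℚ ℚ.< 1ℤ ℚ./ n
0<1/n n = ℚₚ.positive⁻¹ _ {{ℚₚ.normalize-pos 1 n}}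

-- Integer parts up to double negation

<-some-ℕ : ∀ x → ∃ λ n → x < fromℕ n
<-some-ℕ x =
  let B , 0<B , N , h = bound x
      M = ℤ.∣ ℚ.↥ B ∣
  in suc M , mk< 1ℚ (ℚₚ.positive⁻¹ 1ℚ) (N , λ n N≤n →
       ≡.subst (seq x n ℚ.+ 1ℚ ℚ.<_) (≡.trans (ℚₚ.+-comm (+ M ℚ./ 1) (1ℤ ℚ./ 1)) (≡.sym (/1-homo-+ 1ℤ (+ M))))
         (ℚₚ.+-monoˡ-< 1ℚ (ℚₚ.<-≤-trans (ℚₚ.≤-<-trans (p≤∣p∣ (seq x n)) (h n N≤n)) (p≤∣↥p∣ B))))

module _ {u v : ℝ} where

  -- The integer part is handed to a continuation instead of returned: each test x < m + 1 is a case
  -- distinction, available only because the final goal is an equation.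
  search-integerPart : ∀ {x} m k → fromℤ m ≤ x → x < fromℤ (m ℤ.+ + k) → (IntegerPart x → u ≈ v) → u ≈ v
  search-integerPart {x} m zero    m≤x x<m f =
    ⊥-elim (m≤x (≡.subst (λ i → x < fromℤ i) (ℤₚ.+-identityʳ m) x<m))
  search-integerPart {x} m (suc k) m≤x x<m+k f = by-cases (x < fromℤ (m ℤ.+ 1ℤ)) λ where
    (yes x<m+1) → f (integerPart m m≤x x<m+1)
    (no  m+1≤x) → search-integerPart (m ℤ.+ 1ℤ) k m+1≤x
      (≡.subst (λ i → x < fromℤ i) (≡.sym (ℤₚ.+-assoc m 1ℤ (+ k))) x<m+k) f

  with-integerPart : ∀ x → (IntegerPart x → u ≈ v) → u ≈ v
  with-integerPart x =
    let m , x<m  = <-some-ℕ x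
        n , -x<n = <-some-ℕ (- x)
        -n<x : fromℤ (ℤ.- (+ n)) < x
        -n<x = <-transport (≈-trans
          (solve 2 (λ x n → n :- :- x := x :- (:- n)) ≈-refl x (fromℕ n))
          (R.+-congˡ {x} (-‿cong (≈-sym (fromℤ-neg (+ n)))))) -x<n
    in search-integerPart (ℤ.- (+ n)) (n ℕ.+ m) (λ x<-n → <-irrefl (<-trans x<-n -n<x))
         (≡.subst (λ i → x < fromℤ i) (range (+ n) (+ m)) x<m)
    where
    range : ∀ i j → j ≡ ℤ.- i ℤ.+ (i ℤ.+ j)
    range = S.solve 2 (λ i j → j S.:= S.:- i S.:+ (i S.:+ j)) ≡.refl
      where module S = ℤSolver

-- The recurrence of the Euler polynomials

fromℕ≈× : ∀ n → fromℕ n ≈ n ×ᴿ 1ℝ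
fromℕ≈× zero    = ≈-refl
fromℕ≈× (suc n) = ≈-trans (fromℤ-+ 1ℤ (+ n)) (R.+-congˡ {1ℝ} (fromℕ≈× n))

fromℕ*≈× : ∀ n x → fromℕ n * x ≈ n ×ᴿ x
fromℕ*≈× n x = ≈-trans (R.*-congʳ {x} (fromℕ≈× n)) (≈-trans (×ᴿ-assoc-* n 1ℝ x) (×ᴿ-congʳ n (R.*-identityˡ x)))

-- This is `E-generating` multiplied by n!: `⊙-egf` absorbs the factorials of the product with e^t,
-- and `split` isolates the contribution of the constant 1 in e^t + 1.
E-recurrence : ∀ r n → ((1ℝ ^_) ⊙ (λ k → E k r)) n + E n r ≈ r ^ n + r ^ n
E-recurrence r n = begin
  ((1ℝ ^_) ⊙ (λ k → E k r)) n + E n r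
    ≈⟨ +-cong (⊙-egf u inverse (1ℝ ^_) (λ k → E k r) n) (R.*-identityˡ (E n r)) ⟨
  (n ℕ.!) ×ᴿ (exp 1ℝ ⊛ egf (λ k → E k r)) n + 1ℝ * E n r
    ≈⟨ +-cong (fromℕ*≈× (n ℕ.!) ((exp 1ℝ ⊛ egf (λ k → E k r)) n)) (R.*-congʳ {E n r} (unit n)) ⟨
  fromℕ (n ℕ.!) * (exp 1ℝ ⊛ egf (λ k → E k r)) n + fromℕ (n ℕ.!) * u n * E n r
    ≈⟨ solve 4 (λ f s u e → f :* s :+ f :* u :* e := f :* (s :+ (con 1ℚ :* (e :* u) :+ con 0ℚ))) ≈-refl
         (fromℕ (n ℕ.!)) ((exp 1ℝ ⊛ egf (λ k → E k r)) n) (u n) (E n r) ⟩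
  fromℕ (n ℕ.!) * ((exp 1ℝ ⊛ egf (λ k → E k r)) n + (1ℝ * egf (λ k → E k r) n + 0ℝ))
    ≈⟨ R.*-congˡ {fromℕ (n ℕ.!)} (split (egf (λ k → E k r))) ⟨
  fromℕ (n ℕ.!) * (1+exp ⊛ egf (λ k → E k r)) n
    ≈⟨ R.*-congˡ {fromℕ (n ℕ.!)} (E-generating r n) ⟩
  fromℕ (n ℕ.!) * (fromℕ 2 * (r ^ n * u n))
    ≈⟨ solve 3 (λ f p u → f :* (con (+ 2 ℚ./ 1) :* (p :* u)) := f :* u :* p :+ f :* u :* p) ≈-refl (fromℕ (n ℕ.!)) (r ^ n) (u n) ⟩
  fromℕ (n ℕ.!) * u n * r ^ n + fromℕ (n ℕ.!) * u n * r ^ n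
    ≈⟨ +-cong (R.*-congʳ {r ^ n} (unit n)) (R.*-congʳ {r ^ n} (unit n)) ⟩
  1ℝ * r ^ n + 1ℝ * r ^ n
    ≈⟨ +-cong (R.*-identityˡ (r ^ n)) (R.*-identityˡ (r ^ n)) ⟩
  r ^ n + r ^ n ∎
  where
  u : ℕ → ℝ
  u k = fromℚ ((1ℤ ℚ./ k ℕ.!) {{k ℕₚ.!≢0}})
  unit : ∀ k → fromℕ (k ℕ.!) * u k ≈ 1ℝ
  unit k = n*1/n≈1 (k ℕ.!) {{k ℕₚ.!≢0}}
  inverse : ∀ k → (k ℕ.!) ×ᴿ u k ≈ 1ℝ
  inverse k = ≈-trans (≈-sym (fromℕ*≈× (k ℕ.!) (u k))) (unit k)
  split : ∀ f → (1+exp ⊛ f) n ≈ (exp 1ℝ ⊛ f) n + (1ℝ * f n + 0ℝ)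
  split f = begin
    ∑[ k < suc n ] ((exp 1ℝ (toℕ k) + one (toℕ k)) * f (n ℕ.∸ toℕ k))
      ≈⟨ sum-cong-≋ {suc n} (λ k → R.distribʳ (f (n ℕ.∸ toℕ k)) (exp 1ℝ (toℕ k)) (one (toℕ k))) ⟩
    ∑[ k < suc n ] (exp 1ℝ (toℕ k) * f (n ℕ.∸ toℕ k) + one (toℕ k) * f (n ℕ.∸ toℕ k))
      ≈⟨ ∑-distrib-+ {suc n} (λ k → exp 1ℝ (toℕ k) * f (n ℕ.∸ toℕ k)) (λ k → one (toℕ k) * f (n ℕ.∸ toℕ k)) ⟩
    (exp 1ℝ ⊛ f) n + (1ℝ * f n + ∑[ k < n ] (0ℝ * f (n ℕ.∸ suc (toℕ k))))
      ≈⟨ R.+-congˡ {(exp 1ℝ ⊛ f) n} (R.+-congˡ {1ℝ * f n}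
           (≈-trans (sum-cong-≋ {n} (λ k → R.zeroˡ (f (n ℕ.∸ suc (toℕ k))))) (sum-replicate-zero n))) ⟩
    (exp 1ℝ ⊛ f) n + (1ℝ * f n + 0ℝ) ∎

halve : ∀ {x y} → x + x ≈ y + y → x ≈ y
halve {x} {y} eq = begin
  x                    ≈⟨ solve 1 (λ x → x := con ½ :* (x :+ x)) ≈-refl x ⟩
  fromℚ ½ * (x + x)    ≈⟨ R.*-congˡ {fromℚ ½} eq ⟩
  fromℚ ½ * (y + y)    ≈⟨ solve 1 (λ x → con ½ :* (x :+ x) := x) ≈-refl y ⟩
  y                    ∎

-- Jumps of a step function

module Merge
  (A B C : ℕ → ℝ)
  (A-suc : ∀ i → A i < A (suc i)) (B-suc : ∀ j → B j < B (suc j)) (C-suc : ∀ l → C l < C (suc l))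
  where

  -- State (i , j , l): the events A i, B j, C l have occurred and the next ones
  -- have not, where at equal times A precedes B and B precedes C.
  record Valid (i j l : ℕ) : Set where
    constructor valid
    field
      A≤B′ : A i ≤ B (suc j)
      A≤C′ : A i ≤ C (suc l)
      B<A′ : B j < A (suc i)
      B≤C′ : B j ≤ C (suc l)
      C<A′ : C l < A (suc i)
      C<B′ : C l < B (suc j)

  open Valid

  -- An event of C comes last among ties, so locating the next one relative to A and B settles all
  -- six conditions. The initial and the final state are both taken at such a moment.
  valid-before-C : ∀ {i j l} → A i ≤ C (suc l) → C (suc l) < A (suc i) →
                   B j ≤ C (suc l) → C (suc l) < B (suc j) → Valid i j l
  valid-before-C {l = l} A≤C C<A B≤C C<B = valid
    (λ B′<A → A≤C (<-trans C<B B′<A)) A≤C (≤-<-trans B≤C C<A) B≤C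
    (<-trans (C-suc l) C<A) (<-trans (C-suc l) C<B)

  private
    first : ∀ {T : ℕ → ℝ} → (∀ i → T i < T (suc i)) → ∀ i {t} → T (suc i) < t → T 1 < t
    first T-suc zero    h = h
    first T-suc (suc i) h = first T-suc i (<-trans (T-suc (suc i)) h)

    last : ∀ {T : ℕ → ℝ} → (∀ i → T i < T (suc i)) → ∀ i {t} → t < T 1 → t < T (suc i)
    last T-suc zero    h = h
    last T-suc (suc i) h = <-trans (last T-suc i h) (T-suc (suc i))

  module _
    (φ : ℕ → ℕ → ℕ → ℝ) (JA JB JC : ℕ → ℝ)
    (stepA : ∀ i j l → B j < A (suc i) → A (suc i) ≤ B (suc j) → C l < A (suc i) → A (suc i) ≤ C (suc l) →
             φ (suc i) j l ≈ φ i j l + JA i)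
    (stepB : ∀ i j l → A i ≤ B (suc j) → B (suc j) < A (suc i) → C l < B (suc j) → B (suc j) ≤ C (suc l) →
             φ i (suc j) l ≈ φ i j l + JB j)
    (stepC : ∀ i j l → A i ≤ C (suc l) → C (suc l) < A (suc i) → B j ≤ C (suc l) → C (suc l) < B (suc j) →
             φ i j (suc l) ≈ φ i j l + JC l)
    (start : Valid 0 0 0)
    where

    private
      total : ℕ → ℕ → ℕ → ℝ
      total i j l = φ 0 0 0 + (accumulate JA i + accumulate JB j + accumulate JC l)

      no-jumps : φ 0 0 0 ≈ total 0 0 0
      no-jumps = solve 1 (λ f → f := f :+ (con 0ℚ :+ con 0ℚ :+ con 0ℚ)) ≈-refl (φ 0 0 0)

    -- Induction undoes the last event that led to the state. It is A i if this is strictly later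
    -- than B j and C l, B j if it is strictly later than C l and not earlier than A i, and C l
    -- otherwise.
    sum-of-jumps : ∀ i j l → Valid i j l → φ i j l ≈ total i j l

    private
      by-last-event : ∀ i j l → Valid i j l →
        Dec (B j < A i) → Dec (C l < A i) → Dec (C l < B j) → φ i j l ≈ total i j l

      last-C : ∀ i j l → Valid i j l → A i ≤ C l → B j ≤ C l → φ i j l ≈ total i j l

    sum-of-jumps i j l v =
      by-cases (B j < A i) λ B<A? → by-cases (C l < A i) λ C<A? → by-cases (C l < B j) λ C<B? →
      by-last-event i j l v B<A? C<A? C<B?

    by-last-event (suc i) j l v (yes B<A) (yes C<A) _ = begin
      φ (suc i) j l         ≈⟨ stepA i j l B<A (A≤B′ v) C<A (A≤C′ v) ⟩
      φ i j l + JA i        ≈⟨ R.+-congʳ {JA i} (sum-of-jumps i j l (valid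
                                 (λ B′<A → A≤B′ v (<-trans B′<A (A-suc i)))
                                 (λ C′<A → A≤C′ v (<-trans C′<A (A-suc i)))
                                 B<A (B≤C′ v) C<A (C<B′ v))) ⟩
      total i j l + JA i    ≈⟨ solve 5 (λ f a b c d → f :+ (a :+ b :+ c) :+ d := f :+ (a :+ d :+ b :+ c)) ≈-refl
                                 (φ 0 0 0) (accumulate JA i) (accumulate JB j) (accumulate JC l) (JA i) ⟩
      total (suc i) j l     ∎
    -- If the last event is `A 0`, which belongs to the initial state, then nothing can have
    -- happened since: an event of positive index before `A 0` contradicts `start`.
    by-last-event zero (suc j) l v (yes B<A) (yes C<A) _ = ⊥-elim (A≤B′ start (first B-suc j B<A))
    by-last-event zero zero (suc l) v (yes B<A) (yes C<A) _ = ⊥-elim (A≤C′ start (first C-suc l C<A))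
    by-last-event zero zero zero v (yes B<A) (yes C<A) _ = no-jumps
    by-last-event i j l v (yes B<A) (no A≤C) _ = last-C i j l v A≤C (λ C<B → A≤C (<-trans C<B B<A))
    by-last-event i (suc j) l v (no A≤B) _ (yes C<B) = begin
      φ i (suc j) l         ≈⟨ stepB i j l A≤B (B<A′ v) C<B (B≤C′ v) ⟩
      φ i j l + JB j        ≈⟨ R.+-congʳ {JB j} (sum-of-jumps i j l (valid A≤B (A≤C′ v)
                                 (<-trans (B-suc j) (B<A′ v))
                                 (λ C′<B → B≤C′ v (<-trans C′<B (B-suc j)))
                                 (C<A′ v) C<B)) ⟩
      total i j l + JB j    ≈⟨ solve 5 (λ f a b c d → f :+ (a :+ b :+ c) :+ d := f :+ (a :+ (b :+ d) :+ c)) ≈-refl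
                                 (φ 0 0 0) (accumulate JA i) (accumulate JB j) (accumulate JC l) (JB j) ⟩
      total i (suc j) l     ∎
    by-last-event (suc i) zero l v (no A≤B) _ (yes C<B) = ⊥-elim (A≤B (last A-suc i (B<A′ start)))
    by-last-event zero zero (suc l) v (no A≤B) _ (yes C<B) = ⊥-elim (B≤C′ start (first C-suc l C<B))
    by-last-event zero zero zero v (no A≤B) _ (yes C<B) = no-jumps
    by-last-event i j l v (no A≤B) _ (no B≤C) = last-C i j l v (λ C<A → B≤C (<-≤-trans C<A A≤B)) B≤C

    last-C i j (suc l) v A≤C B≤C = begin
      φ i j (suc l)         ≈⟨ stepC i j l A≤C (C<A′ v) B≤C (C<B′ v) ⟩
      φ i j l + JC l        ≈⟨ R.+-congʳ {JC l} (sum-of-jumps i j l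
                                 (valid-before-C A≤C (C<A′ v) B≤C (C<B′ v))) ⟩
      total i j l + JC l    ≈⟨ solve 5 (λ f a b c d → f :+ (a :+ b :+ c) :+ d := f :+ (a :+ b :+ (c :+ d))) ≈-refl
                                 (φ 0 0 0) (accumulate JA i) (accumulate JB j) (accumulate JC l) (JC l) ⟩
      total i j (suc l)     ∎
    last-C (suc i) j zero v A≤C B≤C = ⊥-elim (A≤C (last A-suc i (C<A′ start)))
    last-C zero (suc j) zero v A≤C B≤C = ⊥-elim (B≤C (last B-suc j (C<B′ start)))
    last-C zero zero zero v A≤C B≤C = no-jumps

open HurwitzSeries.EulerSeries +-*-commutativeRing halve E E-recurrence

-- To use u ≈ v in a goal for the ring solver, exhibit l - r as a multiple of u - v.
modulo : ∀ {l r u v} t → u ≈ v → l ≈ r + t * (u - v) → l ≈ r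
modulo {l} {r} {u} {v} t u≈v eq = begin
  l                ≈⟨ eq ⟩
  r + t * (u - v)  ≈⟨ R.+-congˡ {r} (R.*-congˡ {t} (R.+-congʳ { - v} u≈v)) ⟩
  r + t * (v - v)  ≈⟨ solve 3 (λ r t v → r :+ t :* (v :- v) := r) ≈-refl r t v ⟩
  r                ∎

fromℤ-suc : ∀ m → fromℤ (m ℤ.+ 1ℤ) ≈ fromℤ m + 1ℝ
fromℤ-suc m = fromℤ-+ m 1ℤ

sign-neg : ∀ m → sign (ℤ.- m) ≈ sign m
sign-neg m = R.reflexive (≡.cong ((- 1ℝ) ^_) (ℤₚ.∣-i∣≡∣i∣ m))

-- With reversed sign the increment is -s/2 times Z + Z′, and the jump equation turns this sum into
-- 2 · ev.
half-jump : ∀ {s s′ τ Z Z′ ev} → s′ ≈ - 1ℝ * s → τ ≈ s → Z + Z′ ≈ ev + ev →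
            fromℚ ½ * (s′ * Z′) ≈ fromℚ ½ * (s * Z) + - (τ * ev)
half-jump {s} {s′} {τ} {Z} {Z′} {ev} s′≈-s τ≈s sum≈ =
  modulo (fromℚ ½ * Z′) s′≈-s (modulo ev τ≈s (modulo (- (fromℚ ½ * s)) sum≈
    (solve 6 (λ s s′ τ Z Z′ ev →
      con ½ :* (s′ :* Z′) :=
      con ½ :* (s :* Z) :+ :- (τ :* ev) :+ con ½ :* Z′ :* (s′ :- :- con 1ℚ :* s)
      :+ ev :* (τ :- s) :+ :- (con ½ :* s) :* ((Z :+ Z′) :- (ev :+ ev))) ≈-refl s s′ τ Z Z′ ev)))

-- p and q are one less than in the theorem.
module Reciprocity
  (ℰ : ℕ → ℝ → ℝ) (isEuler : ∀ n → IsEulerFunction n (ℰ n))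
  (a b c : ℕ) .{{_ : NonZero a}} .{{_ : NonZero b}} .{{_ : NonZero c}}
  (2∣a+b+c : 2 ∣ (a ℕ.+ b ℕ.+ c)) (x y z : ℝ) (p q : ℕ)
  where

  α β γ : ℝ
  α = fromℚ (1ℤ ℚ./ a)
  β = fromℚ (1ℤ ℚ./ b)
  γ = fromℚ (1ℤ ℚ./ c)

  aα≈1 : fromℕ a * α ≈ 1ℝ
  aα≈1 = n*1/n≈1 a

  bβ≈1 : fromℕ b * β ≈ 1ℝ
  bβ≈1 = n*1/n≈1 b

  cγ≈1 : fromℕ c * γ ≈ 1ℝ
  cγ≈1 = n*1/n≈1 c

  ℰ-unit : ∀ {r w} m n → 0ℝ ≤ r → r < 1ℝ → w ≈ r + fromℤ m → ℰ n w ≈ sign m * E n r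
  ℰ-unit {r} {w} m n 0≤r r<1 w≈r+m = begin
    ℰ n w                ≈⟨ cong w≈r+m ⟩
    ℰ n (r + fromℤ m)    ≈⟨ antiperiodic r m ⟩
    sign m * ℰ n r       ≈⟨ R.*-congˡ {sign m} (on-unit r 0≤r r<1) ⟩
    sign m * E n r       ∎
    where open IsEulerFunction (isEuler n)

  -- The times at which ⌊at + x⌋, ⌊bt + y⌋ and ⌊ct - z⌋ + 1 take the given value for the first time.
  tA tB tC : ℤ → ℝ
  tA m = (fromℤ m - x) * α
  tB n = (fromℤ n - y) * β
  tC k = (fromℤ k - 1ℝ + z) * γ

  -- The exponents of the two formal variables in u^{x-m} v^{y-n} w^{z+k}.
  X Y : ℤ → ℤ → ℝ
  X m k = (x - fromℤ m) * α + (z + fromℤ k) * γ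
  Y n k = (y - fromℤ n) * β + (z + fromℤ k) * γ

  φ : ℤ → ℤ → ℤ → ℝ
  φ m n k = fromℚ ½ * (sign (m ℤ.+ n ℤ.+ k) * Ψ α β γ (X m k) (Y n k) p q)

  wA₁ wA₂ wB₁ wB₂ wC₁ wC₂ : ℝ → ℝ
  wA₁ t = fromℤ (+ c) * ((t + x) ÷ a) + z
  wA₂ t = fromℤ (+ b) * ((t + x) ÷ a) + - y
  wB₁ t = fromℤ (+ c) * ((t + y) ÷ b) + z
  wB₂ t = fromℤ (ℤ.- (+ a)) * ((t + y) ÷ b) + x
  wC₁ t = fromℤ (+ a) * ((t + z) ÷ c) + x
  wC₂ t = fromℤ (+ b) * ((t + z) ÷ c) + y

  -- Coefficients of X^p Y^q / (p! q!) in the generating functions of the μ-th summands; the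
  -- variables are scaled by the powers of a, b and c in the theorem.
  gA gB gC : ℤ → ℝ
  gA μ = sign μ * (subst γ γ (λ n → ℰ n (wA₁ (fromℤ μ))) ⊠ subst 0ℝ (- β) (λ n → ℰ n (wA₂ (fromℤ μ)))) p q
  gB μ = sign μ * (subst γ γ (λ n → ℰ n (wB₁ (fromℤ μ))) ⊠ subst α 0ℝ (λ n → ℰ n (wB₂ (fromℤ μ)))) p q
  gC μ = sign μ * (subst α 0ℝ (λ n → ℰ n (wC₁ (fromℤ μ))) ⊠ subst 0ℝ β (λ n → ℰ n (wC₂ (fromℤ μ)))) p q

  -- Increments of the step function at its three kinds of events

  sign₃ : ∀ m n k → sign (m ℤ.+ n ℤ.+ k) ≈ sign m * sign n * sign k
  sign₃ m n k = begin
    sign (m ℤ.+ n ℤ.+ k)         ≈⟨ sign-homo (m ℤ.+ n) k ⟩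
    sign k * sign (m ℤ.+ n)      ≈⟨ R.*-congˡ {sign k} (sign-homo m n) ⟩
    sign k * (sign n * sign m)   ≈⟨ solve 3 (λ m n k → k :* (n :* m) := m :* n :* k) ≈-refl (sign m) (sign n) (sign k) ⟩
    sign m * sign n * sign k     ∎

  -- For an event of A or B at time T = (M - t)/d, the first argument z - cT differs by the integer
  -- `k` from `remainder` = k - (cT - z), which lies in [0, 1) when T is after `tC k` and not after
  -- `tC (k + 1)`.
  module BetweenC (d : ℕ) .{{_ : NonZero d}} (t : ℝ) (M k : ℤ) where

    private
      δ : ℝ
      δ = fromℚ (1ℤ ℚ./ d)

    remainder : ℝ
    remainder = fromℕ c * ((t - fromℤ M) * δ) + z + fromℤ k

    nonNegative : (fromℤ M - t) * δ ≤ tC (k ℤ.+ 1ℤ) → 0ℝ ≤ remainder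
    nonNegative T≤C r<0 = T≤C (<-scale (0<1/n c) (modulo ((fromℤ M - t) * δ) cγ≈1 (modulo γ (fromℤ-suc k)
      (solve 8 (λ t z c δ γ M k K →
        γ :* (con 0ℚ :- (c :* ((t :- M) :* δ) :+ z :+ k)) :=
        (M :- t) :* δ :- (K :- con 1ℚ :+ z) :* γ :+ (M :- t) :* δ :* (c :* γ :- con 1ℚ) :+ γ :* (K :- (k :+ con 1ℚ)))
        ≈-refl t z (fromℕ c) δ γ (fromℤ M) (fromℤ k) (fromℤ (k ℤ.+ 1ℤ))))) r<0)

    belowOne : tC k < (fromℤ M - t) * δ → remainder < 1ℝ
    belowOne = <-scale (0<n/1 c) (modulo (- (fromℤ k - 1ℝ + z)) cγ≈1
      (solve 7 (λ t z c δ γ M k →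
        c :* ((M :- t) :* δ :- (k :- con 1ℚ :+ z) :* γ) :=
        con 1ℚ :- (c :* ((t :- M) :* δ) :+ z :+ k) :+ :- (k :- con 1ℚ :+ z) :* (c :* γ :- con 1ℚ))
        ≈-refl t z (fromℕ c) δ γ (fromℤ M) (fromℤ k)))

    argument : fromℤ (+ c) * ((fromℤ (ℤ.- M) + t) ÷ d) + z ≈ remainder + fromℤ (ℤ.- k)
    argument = modulo (fromℕ c * δ) (fromℤ-neg M) (modulo (- 1ℝ) (fromℤ-neg k)
      (solve 8 (λ t z c δ M k μ ν →
        c :* ((μ :+ t) :* δ) :+ z :=
        c :* ((t :- M) :* δ) :+ z :+ k :+ ν :+ c :* δ :* (μ :- :- M) :+ :- (con 1ℚ) :* (ν :- :- k))
        ≈-refl t z (fromℕ c) δ (fromℤ M) (fromℤ k) (fromℤ (ℤ.- M)) (fromℤ (ℤ.- k))))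

    exponent : remainder * γ ≈ (t - fromℤ M) * δ + (z + fromℤ k) * γ
    exponent = modulo ((t - fromℤ M) * δ) cγ≈1
      (solve 7 (λ t z c δ γ M k →
        (c :* ((t :- M) :* δ) :+ z :+ k) :* γ :=
        (t :- M) :* δ :+ (z :+ k) :* γ :+ (t :- M) :* δ :* (c :* γ :- con 1ℚ)) ≈-refl t z (fromℕ c) δ γ (fromℤ M) (fromℤ k))

  -- At T = `tA M` the summand has index -M. Its second argument -(bT + y) decreases with T, so
  -- adding the coming value `N`, not `n`, brings it into [0, 1). The signs of `M` and `N` then both
  -- differ from those of the state, and the two changes cancel.
  stepA : ∀ {m M n N k K} → M ≡ m ℤ.+ 1ℤ → N ≡ n ℤ.+ 1ℤ → K ≡ k ℤ.+ 1ℤ →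
          tB n < tA M → tA M ≤ tB N → tC k < tA M → tA M ≤ tC K →
          φ M n k ≈ φ m n k + - gA (ℤ.- M)
  stepA {m} {M} {n} {N} {k} {K} ≡.refl ≡.refl ≡.refl B<A A≤B C<A A≤C = begin
    φ M n k
      ≈⟨ half-jump sign-new sign-event jump-sum ⟩
    φ m n k + - (sign (ℤ.- M) * (sign (ℤ.- k) * sign (ℤ.- N)) * (e (X M k) (Y n k) ⊠ (U 0ℝ β ⊠ U γ γ)) p q)
      ≈⟨ R.+-congˡ {φ m n k} (-‿cong (≈-trans (R.*-congˡ {sign (ℤ.- M)} (event₁ α β γ {f₁} {f₂} eq₁ eq₂ (X M k) (Y n k) Cᴬ.exponent hQ p q))
           (≈-sym (R.*-assoc (sign (ℤ.- M)) (sign (ℤ.- k) * sign (ℤ.- N)) _)))) ⟨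
    φ m n k + - gA (ℤ.- M) ∎
    where
    module Cᴬ = BetweenC a x M k
    M′ N′ k′ r₁ r₂ : ℝ
    M′ = fromℤ M
    N′ = fromℤ N
    k′ = fromℤ k
    r₁ = Cᴬ.remainder
    r₂ = fromℕ b * ((x - M′) * α) - y + N′
    f₁ f₂ : ℕ → ℝ
    f₁ i = ℰ i (wA₁ (fromℤ (ℤ.- M)))
    f₂ i = ℰ i (wA₂ (fromℤ (ℤ.- M)))

    0≤r₂ : 0ℝ ≤ r₂
    0≤r₂ r₂<0 = A≤B (<-scale (0<1/n b) (modulo ((M′ - x) * α) bβ≈1
      (solve 7 (λ x y b α β M N →
        β :* (con 0ℚ :- (b :* ((x :- M) :* α) :- y :+ N)) :=
        (M :- x) :* α :- (N :- y) :* β :+ (M :- x) :* α :* (b :* β :- con 1ℚ))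
        ≈-refl x y (fromℕ b) α β M′ N′)) r₂<0)

    r₂<1 : r₂ < 1ℝ
    r₂<1 = <-scale (0<n/1 b) (modulo (y - fromℤ n) bβ≈1 (modulo 1ℝ (fromℤ-suc n)
      (solve 8 (λ x y b α β M n N →
        b :* ((M :- x) :* α :- (n :- y) :* β) :=
        con 1ℚ :- (b :* ((x :- M) :* α) :- y :+ N) :+ (y :- n) :* (b :* β :- con 1ℚ) :+ con 1ℚ :* (N :- (n :+ con 1ℚ)))
        ≈-refl x y (fromℕ b) α β M′ (fromℤ n) N′))) B<A

    eq₁ : ∀ i → f₁ i ≈ sign (ℤ.- k) * E i r₁
    eq₁ i = ℰ-unit (ℤ.- k) i (Cᴬ.nonNegative A≤C) (Cᴬ.belowOne C<A) Cᴬ.argument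

    eq₂ : ∀ i → f₂ i ≈ sign (ℤ.- N) * E i r₂
    eq₂ i = ℰ-unit (ℤ.- N) i 0≤r₂ r₂<1 (modulo (fromℕ b * α) (fromℤ-neg M) (modulo (- 1ℝ) (fromℤ-neg N)
      (solve 8 (λ x y b α M N μ ν →
        b :* ((μ :+ x) :* α) :+ :- y :=
        b :* ((x :- M) :* α) :- y :+ N :+ ν :+ b :* α :* (μ :- :- M) :+ :- (con 1ℚ) :* (ν :- :- N))
        ≈-refl x y (fromℕ b) α M′ N′ (fromℤ (ℤ.- M)) (fromℤ (ℤ.- N)))))

    hQ : r₁ * γ + - (r₂ * β) + β ≈ Y n k
    hQ = modulo ((x - M′) * α) cγ≈1 (modulo (- ((x - M′) * α)) bβ≈1 (modulo (- β) (fromℤ-suc n)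
      (solve 12 (λ x y z b c α β γ M n N k →
        (c :* ((x :- M) :* α) :+ z :+ k) :* γ :+ :- ((b :* ((x :- M) :* α) :- y :+ N) :* β) :+ β :=
        (y :- n) :* β :+ (z :+ k) :* γ :+ (x :- M) :* α :* (c :* γ :- con 1ℚ)
        :+ :- ((x :- M) :* α) :* (b :* β :- con 1ℚ) :+ :- β :* (N :- (n :+ con 1ℚ)))
        ≈-refl x y z (fromℕ b) (fromℕ c) α β γ M′ (fromℤ n) N′ k′)))

    jump-sum : Ψ α β γ (X m k) (Y n k) p q + Ψ α β γ (X M k) (Y n k) p q ≈
               (e (X M k) (Y n k) ⊠ (U 0ℝ β ⊠ U γ γ)) p q + (e (X M k) (Y n k) ⊠ (U 0ℝ β ⊠ U γ γ)) p q
    jump-sum = ≈-trans (R.+-congʳ (Ψ-cong α β γ X-shift ≈-refl p q)) (Ψ-jump₁ α β γ (X M k) (Y n k) p q)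
      where
      X-shift : X m k ≈ X M k + α
      X-shift = modulo α (fromℤ-suc m) (solve 7 (λ x z α γ m M k →
        (x :- m) :* α :+ (z :+ k) :* γ := (x :- M) :* α :+ (z :+ k) :* γ :+ α :+ α :* (M :- (m :+ con 1ℚ)))
        ≈-refl x z α γ (fromℤ m) M′ k′)

    sign-new : sign (M ℤ.+ n ℤ.+ k) ≈ - 1ℝ * sign (m ℤ.+ n ℤ.+ k)
    sign-new = ≈-trans (sign₃ M n k) (≈-trans (R.*-congʳ {sign k} (R.*-congʳ {sign n} (sign-suc m)))
      (modulo 1ℝ (sign₃ m n k) (solve 4 (λ m n k s →
        :- con 1ℚ :* m :* n :* k := :- con 1ℚ :* s :+ con 1ℚ :* (s :- m :* n :* k))
        ≈-refl (sign m) (sign n) (sign k) (sign (m ℤ.+ n ℤ.+ k)))))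

    sign-event : sign (ℤ.- M) * (sign (ℤ.- k) * sign (ℤ.- N)) ≈ sign (m ℤ.+ n ℤ.+ k)
    sign-event = begin
      sign (ℤ.- M) * (sign (ℤ.- k) * sign (ℤ.- N))
        ≈⟨ *-cong (≈-trans (sign-neg M) (sign-suc m)) (*-cong (sign-neg k) (≈-trans (sign-neg N) (sign-suc n))) ⟩
      - 1ℝ * sign m * (sign k * (- 1ℝ * sign n))
        ≈⟨ solve 3 (λ m n k → :- con 1ℚ :* m :* (k :* (:- con 1ℚ :* n)) := m :* n :* k) ≈-refl (sign m) (sign n) (sign k) ⟩
      sign m * sign n * sign k
        ≈⟨ sign₃ m n k ⟨
      sign (m ℤ.+ n ℤ.+ k) ∎

  -- The negative coefficient -a and the index -N combine to the increasing argument aT + x, which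
  -- is reduced by the current `m`. Only `N` is ahead of the state, so one sign remains and the
  -- increment is `+ gB`, in contrast to A and C.
  stepB : ∀ {m M n N k K} → M ≡ m ℤ.+ 1ℤ → N ≡ n ℤ.+ 1ℤ → K ≡ k ℤ.+ 1ℤ →
          tA m ≤ tB N → tB N < tA M → tC k < tB N → tB N ≤ tC K →
          φ m N k ≈ φ m n k + gB (ℤ.- N)
  stepB {m} {M} {n} {N} {k} {K} ≡.refl ≡.refl ≡.refl A≤B B<A C<B B≤C = begin
    φ m N k
      ≈⟨ half-jump sign-new sign-event jump-sum ⟩
    φ m n k + - (- τ * (e (X m k) (Y N k) ⊠ (U α 0ℝ ⊠ U γ γ)) p q)
      ≈⟨ R.+-congˡ {φ m n k} (solve 3 (λ s t e → :- (:- (s :* t) :* e) := s :* (t :* e)) ≈-refl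
           (sign (ℤ.- N)) (sign (ℤ.- k) * sign m) ((e (X m k) (Y N k) ⊠ (U α 0ℝ ⊠ U γ γ)) p q)) ⟩
    φ m n k + sign (ℤ.- N) * (sign (ℤ.- k) * sign m * (e (X m k) (Y N k) ⊠ (U α 0ℝ ⊠ U γ γ)) p q)
      ≈⟨ R.+-congˡ {φ m n k} (R.*-congˡ {sign (ℤ.- N)} (event₂ α β γ {f₁} {f₂} eq₁ eq₂ (X m k) (Y N k) hP Cᴮ.exponent p q)) ⟨
    φ m n k + gB (ℤ.- N) ∎
    where
    module Cᴮ = BetweenC b y N k
    m′ M′ N′ k′ r₁ r₂ τ : ℝ
    m′ = fromℤ m
    M′ = fromℤ M
    N′ = fromℤ N
    k′ = fromℤ k
    r₁ = Cᴮ.remainder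
    r₂ = fromℕ a * ((N′ - y) * β) + x - m′
    τ  = sign (ℤ.- N) * (sign (ℤ.- k) * sign m)
    f₁ f₂ : ℕ → ℝ
    f₁ i = ℰ i (wB₁ (fromℤ (ℤ.- N)))
    f₂ i = ℰ i (wB₂ (fromℤ (ℤ.- N)))

    0≤r₂ : 0ℝ ≤ r₂
    0≤r₂ r₂<0 = A≤B (<-scale (0<1/n a) (modulo ((y - N′) * β) aα≈1
      (solve 7 (λ x y a α β m N →
        α :* (con 0ℚ :- (a :* ((N :- y) :* β) :+ x :- m)) :=
        (m :- x) :* α :- (N :- y) :* β :+ (y :- N) :* β :* (a :* α :- con 1ℚ))
        ≈-refl x y (fromℕ a) α β m′ N′)) r₂<0)

    r₂<1 : r₂ < 1ℝ
    r₂<1 = <-scale (0<n/1 a) (modulo (M′ - x) aα≈1 (modulo 1ℝ (fromℤ-suc m)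
      (solve 8 (λ x y a α β m M N →
        a :* ((M :- x) :* α :- (N :- y) :* β) :=
        con 1ℚ :- (a :* ((N :- y) :* β) :+ x :- m) :+ (M :- x) :* (a :* α :- con 1ℚ) :+ con 1ℚ :* (M :- (m :+ con 1ℚ)))
        ≈-refl x y (fromℕ a) α β m′ M′ N′))) B<A

    eq₁ : ∀ i → f₁ i ≈ sign (ℤ.- k) * E i r₁
    eq₁ i = ℰ-unit (ℤ.- k) i (Cᴮ.nonNegative B≤C) (Cᴮ.belowOne C<B) Cᴮ.argument

    eq₂ : ∀ i → f₂ i ≈ sign m * E i r₂
    eq₂ i = ℰ-unit m i 0≤r₂ r₂<1 (modulo (fromℤ (ℤ.- (+ a)) * β) (fromℤ-neg N) (modulo ((y - N′) * β) (fromℤ-neg (+ a))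
      (solve 8 (λ x y a a⁻ β m N μ →
        a⁻ :* ((μ :+ y) :* β) :+ x :=
        a :* ((N :- y) :* β) :+ x :- m :+ m :+ a⁻ :* β :* (μ :- :- N) :+ (y :- N) :* β :* (a⁻ :- :- a))
        ≈-refl x y (fromℕ a) (fromℤ (ℤ.- (+ a))) β m′ N′ (fromℤ (ℤ.- N)))))

    hP : r₁ * γ + r₂ * α ≈ X m k
    hP = modulo ((y - N′) * β) cγ≈1 (modulo ((N′ - y) * β) aα≈1
      (solve 11 (λ x y z a c α β γ m N k →
        (c :* ((y :- N) :* β) :+ z :+ k) :* γ :+ (a :* ((N :- y) :* β) :+ x :- m) :* α :=
        (x :- m) :* α :+ (z :+ k) :* γ :+ (y :- N) :* β :* (c :* γ :- con 1ℚ) :+ (N :- y) :* β :* (a :* α :- con 1ℚ))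
        ≈-refl x y z (fromℕ a) (fromℕ c) α β γ m′ N′ k′))

    jump-sum : Ψ α β γ (X m k) (Y n k) p q + Ψ α β γ (X m k) (Y N k) p q ≈
               (e (X m k) (Y N k) ⊠ (U α 0ℝ ⊠ U γ γ)) p q + (e (X m k) (Y N k) ⊠ (U α 0ℝ ⊠ U γ γ)) p q
    jump-sum = ≈-trans (R.+-congʳ (Ψ-cong α β γ ≈-refl Y-shift p q)) (Ψ-jump₂ α β γ (X m k) (Y N k) p q)
      where
      Y-shift : Y n k ≈ Y N k + β
      Y-shift = modulo β (fromℤ-suc n) (solve 7 (λ y z β γ n N k →
        (y :- n) :* β :+ (z :+ k) :* γ := (y :- N) :* β :+ (z :+ k) :* γ :+ β :+ β :* (N :- (n :+ con 1ℚ)))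
        ≈-refl y z β γ (fromℤ n) N′ k′)

    sign-new : sign (m ℤ.+ N ℤ.+ k) ≈ - 1ℝ * sign (m ℤ.+ n ℤ.+ k)
    sign-new = ≈-trans (sign₃ m N k) (≈-trans (R.*-congʳ {sign k} (R.*-congˡ {sign m} (sign-suc n)))
      (modulo 1ℝ (sign₃ m n k) (solve 4 (λ m n k s →
        m :* (:- con 1ℚ :* n) :* k := :- con 1ℚ :* s :+ con 1ℚ :* (s :- m :* n :* k))
        ≈-refl (sign m) (sign n) (sign k) (sign (m ℤ.+ n ℤ.+ k)))))

    sign-event : - τ ≈ sign (m ℤ.+ n ℤ.+ k)
    sign-event = begin
      - (sign (ℤ.- N) * (sign (ℤ.- k) * sign m))
        ≈⟨ -‿cong (*-cong (≈-trans (sign-neg N) (sign-suc n)) (R.*-congʳ {sign m} (sign-neg k))) ⟩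
      - (- 1ℝ * sign n * (sign k * sign m))
        ≈⟨ solve 3 (λ m n k → :- (:- con 1ℚ :* n :* (k :* m)) := m :* n :* k) ≈-refl (sign m) (sign n) (sign k) ⟩
      sign m * sign n * sign k
        ≈⟨ sign₃ m n k ⟨
      sign (m ℤ.+ n ℤ.+ k) ∎

  -- The event time is `tC K` = (k + z)/c, so the index of the summand is `k` itself, and the
  -- integer parts of aT + x and bT + y are the current `m` and `n`.
  stepC : ∀ {m M n N k K} → M ≡ m ℤ.+ 1ℤ → N ≡ n ℤ.+ 1ℤ → K ≡ k ℤ.+ 1ℤ →
          tA m ≤ tC K → tC K < tA M → tB n ≤ tC K → tC K < tB N →
          φ m n K ≈ φ m n k + - gC k
  stepC {m} {M} {n} {N} {k} {K} ≡.refl ≡.refl ≡.refl A≤C C<A B≤C C<B = begin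
    φ m n K
      ≈⟨ half-jump sign-new sign-event jump-sum ⟩
    φ m n k + - (sign k * (sign m * sign n) * (e (X m k) (Y n k) ⊠ (U α 0ℝ ⊠ U 0ℝ β)) p q)
      ≈⟨ R.+-congˡ {φ m n k} (-‿cong (≈-trans (R.*-congˡ {sign k} (event₃ α β γ {f₁} {f₂} eq₁ eq₂ (X m k) (Y n k) hP hQ p q))
           (≈-sym (R.*-assoc (sign k) (sign m * sign n) _)))) ⟨
    φ m n k + - gC k ∎
    where
    m′ M′ n′ N′ k′ K′ r₁ r₂ : ℝ
    m′ = fromℤ m
    M′ = fromℤ M
    n′ = fromℤ n
    N′ = fromℤ N
    k′ = fromℤ k
    K′ = fromℤ K
    r₁ = wC₁ k′ - m′
    r₂ = wC₂ k′ - n′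
    f₁ f₂ : ℕ → ℝ
    f₁ i = ℰ i (wC₁ k′)
    f₂ i = ℰ i (wC₂ k′)

    nonNegative : ∀ {d} .{{_ : NonZero d}} {t l} → let δ = fromℚ (1ℤ ℚ./ d) in
      (l - t) * δ ≤ tC K → 0ℝ ≤ fromℕ d * ((k′ + z) ÷ c) + t - l
    nonNegative {d} {t} {l} h r<0 = h (<-scale (0<1/n d) (modulo (- ((k′ + z) * γ)) (n*1/n≈1 d) (modulo γ (fromℤ-suc k)
      (solve 8 (λ z d δ γ t l k K →
        δ :* (con 0ℚ :- (d :* ((k :+ z) :* γ) :+ t :- l)) :=
        (l :- t) :* δ :- (K :- con 1ℚ :+ z) :* γ :+ :- ((k :+ z) :* γ) :* (d :* δ :- con 1ℚ) :+ γ :* (K :- (k :+ con 1ℚ)))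
        ≈-refl z (fromℕ d) (fromℚ (1ℤ ℚ./ d)) γ t l k′ K′))) r<0)

    belowOne : ∀ {d} .{{_ : NonZero d}} {t l L} → L ≈ l + 1ℝ → let δ = fromℚ (1ℤ ℚ./ d) in
      tC K < (L - t) * δ → fromℕ d * ((k′ + z) ÷ c) + t - l < 1ℝ
    belowOne {d} {t} {l} {L} L≈l+1 = <-scale (0<n/1 d) (modulo (L - t) (n*1/n≈1 d) (modulo (- (fromℕ d * γ)) (fromℤ-suc k) (modulo 1ℝ L≈l+1
      (solve 9 (λ z d δ γ t l L k K →
        d :* ((L :- t) :* δ :- (K :- con 1ℚ :+ z) :* γ) :=
        con 1ℚ :- (d :* ((k :+ z) :* γ) :+ t :- l) :+ (L :- t) :* (d :* δ :- con 1ℚ)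
        :+ :- (d :* γ) :* (K :- (k :+ con 1ℚ)) :+ con 1ℚ :* (L :- (l :+ con 1ℚ)))
        ≈-refl z (fromℕ d) (fromℚ (1ℤ ℚ./ d)) γ t l L k′ K′))))

    eq₁ : ∀ i → f₁ i ≈ sign m * E i r₁
    eq₁ i = ℰ-unit m i (nonNegative A≤C) (belowOne (fromℤ-suc m) C<A)
      (solve 2 (λ w m → w := w :- m :+ m) ≈-refl (wC₁ k′) m′)

    eq₂ : ∀ i → f₂ i ≈ sign n * E i r₂
    eq₂ i = ℰ-unit n i (nonNegative B≤C) (belowOne (fromℤ-suc n) C<B)
      (solve 2 (λ w m → w := w :- m :+ m) ≈-refl (wC₂ k′) n′)

    exponent : ∀ d .{{_ : NonZero d}} t l → let δ = fromℚ (1ℤ ℚ./ d) in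
      (fromℕ d * ((k′ + z) ÷ c) + t - l) * δ ≈ (t - l) * δ + (z + k′) * γ
    exponent d t l = modulo ((k′ + z) * γ) (n*1/n≈1 d)
      (solve 7 (λ z d δ γ t l k →
        (d :* ((k :+ z) :* γ) :+ t :- l) :* δ :=
        (t :- l) :* δ :+ (z :+ k) :* γ :+ (k :+ z) :* γ :* (d :* δ :- con 1ℚ))
        ≈-refl z (fromℕ d) (fromℚ (1ℤ ℚ./ d)) γ t l k′)

    hP : r₁ * α ≈ X m k
    hP = exponent a x m′

    hQ : r₂ * β ≈ Y n k
    hQ = exponent b y n′

    jump-sum : Ψ α β γ (X m k) (Y n k) p q + Ψ α β γ (X m K) (Y n K) p q ≈
               (e (X m k) (Y n k) ⊠ (U α 0ℝ ⊠ U 0ℝ β)) p q + (e (X m k) (Y n k) ⊠ (U α 0ℝ ⊠ U 0ℝ β)) p q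
    jump-sum = ≈-trans (R.+-congˡ {Ψ α β γ (X m k) (Y n k) p q} (Ψ-cong α β γ (shifted α x m′) (shifted β y n′) p q))
      (≈-trans (R.+-comm (Ψ α β γ (X m k) (Y n k) p q) _) (Ψ-jump₃ α β γ (X m k) (Y n k) p q))
      where
      shifted : ∀ δ t l → (t - l) * δ + (z + K′) * γ ≈ (t - l) * δ + (z + k′) * γ + γ
      shifted δ t l = modulo γ (fromℤ-suc k) (solve 7 (λ z δ γ t l k K →
        (t :- l) :* δ :+ (z :+ K) :* γ := (t :- l) :* δ :+ (z :+ k) :* γ :+ γ :+ γ :* (K :- (k :+ con 1ℚ)))
        ≈-refl z δ γ t l k′ K′)

    sign-new : sign (m ℤ.+ n ℤ.+ K) ≈ - 1ℝ * sign (m ℤ.+ n ℤ.+ k)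
    sign-new = ≈-trans (sign₃ m n K) (≈-trans (R.*-congˡ {sign m * sign n} (sign-suc k))
      (modulo 1ℝ (sign₃ m n k) (solve 4 (λ m n k s →
        m :* n :* (:- con 1ℚ :* k) := :- con 1ℚ :* s :+ con 1ℚ :* (s :- m :* n :* k))
        ≈-refl (sign m) (sign n) (sign k) (sign (m ℤ.+ n ℤ.+ k)))))

    sign-event : sign k * (sign m * sign n) ≈ sign (m ℤ.+ n ℤ.+ k)
    sign-event = ≈-trans (R.*-comm (sign k) (sign m * sign n)) (≈-sym (sign₃ m n k))

  -- Periodicity

  sign-abc : sign (+ a) * sign (+ b) * sign (+ c) ≈ 1ℝ
  sign-abc = ≈-trans (≈-sym (sign₃ (+ a) (+ b) (+ c)))
    (≈-trans (R.reflexive (≡.cong ((- 1ℝ) ^_) (_∣_.equality 2∣a+b+c))) (even (quotient 2∣a+b+c)))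
    where
    even : ∀ d → (- 1ℝ) ^ (d ℕ.* 2) ≈ 1ℝ
    even zero    = ≈-refl
    even (suc d) = ≈-trans (-1*-1*x≈x ((- 1ℝ) ^ (d ℕ.* 2))) (even d)

  ℰ-shift : ∀ {w w′} m n → w′ ≈ w + fromℤ m → ℰ n w′ ≈ sign m * ℰ n w
  ℰ-shift {w} m n w′≈w+m = ≈-trans (cong w′≈w+m) (antiperiodic w m)
    where open IsEulerFunction (isEuler n)

  argument-shift : ∀ d .{{_ : NonZero d}} i t s μ → fromℤ i * ((fromℤ (μ ℤ.+ + d) + t) ÷ d) + s ≈
                                                    fromℤ i * ((fromℤ μ + t) ÷ d) + s + fromℤ i
  argument-shift d i t s μ = modulo (fromℤ i * fromℚ (1ℤ ℚ./ d)) (fromℤ-+ μ (+ d)) (modulo (fromℤ i) (n*1/n≈1 d)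
    (solve 7 (λ d δ i t s μ μd →
      i :* ((μd :+ t) :* δ) :+ s :=
      i :* ((μ :+ t) :* δ) :+ s :+ i :+ i :* δ :* (μd :- (μ :+ d)) :+ i :* (d :* δ :- con 1ℚ))
      ≈-refl (fromℕ d) (fromℚ (1ℤ ℚ./ d)) (fromℤ i) t s (fromℤ μ) (fromℤ (μ ℤ.+ + d))))

  private
    -- Raising μ by the modulus d adds the integers `i₁` and `i₂` to the arguments of ℰ; the
    -- hypothesis says that the three resulting signs cancel.
    periodic : ∀ d .{{_ : NonZero d}} i₁ i₂ P₁ Q₁ P₂ Q₂ t s₁ s₂ → sign (+ d) * (sign i₁ * sign i₂) ≈ 1ℝ →
      let w₁ μ = fromℤ i₁ * ((fromℤ μ + t) ÷ d) + s₁
          w₂ μ = fromℤ i₂ * ((fromℤ μ + t) ÷ d) + s₂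
          g μ  = sign μ * (subst P₁ Q₁ (λ n → ℰ n (w₁ μ)) ⊠ subst P₂ Q₂ (λ n → ℰ n (w₂ μ))) p q
      in ∀ μ → g (μ ℤ.+ + d) ≈ g μ
    periodic d i₁ i₂ P₁ Q₁ P₂ Q₂ t s₁ s₂ sign≈1 μ = ≈-trans
      (*-cong (sign-homo μ (+ d)) (subst-⊠-subst-scale P₁ Q₁ P₂ Q₂
        (λ n → ℰ-shift i₁ n (argument-shift d i₁ t s₁ μ)) (λ n → ℰ-shift i₂ n (argument-shift d i₂ t s₂ μ)) p q))
      (modulo (sign μ * G) sign≈1
        (solve 5 (λ d i₁ i₂ s G → d :* s :* (i₁ :* i₂ :* G) := s :* G :+ s :* G :* (d :* (i₁ :* i₂) :- con 1ℚ))
          ≈-refl (sign (+ d)) (sign i₁) (sign i₂) (sign μ) G))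
      where
      G : ℝ
      G = (subst P₁ Q₁ (λ n → ℰ n (fromℤ i₁ * ((fromℤ μ + t) ÷ d) + s₁)) ⊠
           subst P₂ Q₂ (λ n → ℰ n (fromℤ i₂ * ((fromℤ μ + t) ÷ d) + s₂))) p q

  gA-periodic : ∀ μ → gA (μ ℤ.+ + a) ≈ gA μ
  gA-periodic = periodic a (+ c) (+ b) γ γ 0ℝ (- β) x z (- y) (≈-trans
    (solve 3 (λ a b c → a :* (c :* b) := a :* b :* c) ≈-refl (sign (+ a)) (sign (+ b)) (sign (+ c))) sign-abc)

  gB-periodic : ∀ μ → gB (μ ℤ.+ + b) ≈ gB μ
  gB-periodic = periodic b (+ c) (ℤ.- (+ a)) γ γ α 0ℝ y z x (≈-trans
    (R.*-congˡ {sign (+ b)} (R.*-congˡ {sign (+ c)} (sign-neg (+ a)))) (≈-trans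
    (solve 3 (λ a b c → b :* (c :* a) := a :* b :* c) ≈-refl (sign (+ a)) (sign (+ b)) (sign (+ c))) sign-abc))

  -- Over a period the exponentials change by u^(-a) v^(-b) w^c = 1: each exponent loses d · 1/d and
  -- gains c · 1/c.
  φ-periodic : ∀ m n → φ (m ℤ.+ + a) (n ℤ.+ + b) (+ c) ≈ φ m n (+ 0)
  φ-periodic m n = R.*-congˡ {fromℚ ½} (*-cong sign-periodic (Ψ-cong α β γ (coordinate a x m) (coordinate b y n) p q))
    where
    sign-periodic : sign (m ℤ.+ + a ℤ.+ (n ℤ.+ + b) ℤ.+ + c) ≈ sign (m ℤ.+ n ℤ.+ + 0)
    sign-periodic = begin
      sign (m ℤ.+ + a ℤ.+ (n ℤ.+ + b) ℤ.+ + c)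
        ≈⟨ sign₃ (m ℤ.+ + a) (n ℤ.+ + b) (+ c) ⟩
      sign (m ℤ.+ + a) * sign (n ℤ.+ + b) * sign (+ c)
        ≈⟨ R.*-congʳ {sign (+ c)} (*-cong (sign-homo m (+ a)) (sign-homo n (+ b))) ⟩
      sign (+ a) * sign m * (sign (+ b) * sign n) * sign (+ c)
        ≈⟨ modulo (sign m * sign n) sign-abc (solve 5 (λ a b c m n →
             a :* m :* (b :* n) :* c := m :* n :* con 1ℚ :+ m :* n :* (a :* b :* c :- con 1ℚ))
             ≈-refl (sign (+ a)) (sign (+ b)) (sign (+ c)) (sign m) (sign n)) ⟩
      sign m * sign n * 1ℝ
        ≈⟨ sign₃ m n (+ 0) ⟨
      sign (m ℤ.+ n ℤ.+ + 0) ∎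

    coordinate : ∀ d .{{_ : NonZero d}} t l → let δ = fromℚ (1ℤ ℚ./ d) in
      (t - fromℤ (l ℤ.+ + d)) * δ + (z + fromℤ (+ c)) * γ ≈ (t - fromℤ l) * δ + (z + fromℤ (+ 0)) * γ
    coordinate d t l = modulo (- fromℚ (1ℤ ℚ./ d)) (fromℤ-+ l (+ d)) (modulo (- 1ℝ) (n*1/n≈1 d) (modulo 1ℝ cγ≈1
      (solve 8 (λ z t l d δ c γ ld →
        (t :- ld) :* δ :+ (z :+ c) :* γ :=
        (t :- l) :* δ :+ (z :+ con 0ℚ) :* γ :+ :- δ :* (ld :- (l :+ d)) :+ :- (con 1ℚ) :* (d :* δ :- con 1ℚ)
        :+ con 1ℚ :* (c :* γ :- con 1ℚ))
        ≈-refl z t (fromℤ l) (fromℕ d) (fromℚ (1ℤ ℚ./ d)) (fromℕ c) γ (fromℤ (l ℤ.+ + d)))))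

  -- The order of events over one period

  time-suc : ∀ d .{{_ : NonZero d}} t m → let δ = fromℚ (1ℤ ℚ./ d) in
             (fromℤ m + t) * δ < (fromℤ (m ℤ.+ 1ℤ) + t) * δ
  time-suc d t m = <-scale (0<1/n d) (modulo (- fromℚ (1ℤ ℚ./ d)) (fromℤ-suc m)
    (solve 4 (λ δ t m m⁺ →
      δ :* (con 1ℚ :- con 0ℚ) := (m⁺ :+ t) :* δ :- (m :+ t) :* δ :+ :- δ :* (m⁺ :- (m :+ con 1ℚ)))
      ≈-refl (fromℚ (1ℤ ℚ./ d)) t (fromℤ m) (fromℤ (m ℤ.+ 1ℤ)))) 0<1
    where
    0<1 : 0ℝ < 1ℝ
    0<1 = mk< ½ (ℚₚ.positive⁻¹ ½) (0 , λ _ _ → toWitness {a? = 0ℚ ℚ.+ ½ ℚₚ.<? 1ℚ} _)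

  -- Here part floor = ⌊d t₀ + s⌋, where t₀ = z/c is the first jump of k; as i/d = k/c, this
  -- bounds the position of t₀ + k/c among the jumps of ⌊d t + s⌋.
  module Bracket (d : ℕ) .{{_ : NonZero d}} (s : ℝ) (floor : IntegerPart (fromℤ (+ d) * ((fromℤ (+ 0) + z) ÷ c) + s))
    (i k : ℕ) (i/d≈k/c : fromℕ i * fromℚ (1ℤ ℚ./ d) ≈ fromℕ k * γ) where

    private
      δ m₀ : ℝ
      δ  = fromℚ (1ℤ ℚ./ d)
      m₀ = fromℤ (part floor)

    ≤-next : (fromℤ (part floor ℤ.+ + i) - s) * δ ≤ tC (+ suc k)
    ≤-next C<A = lower floor (<-scale (0<n/1 d)
      (modulo (fromℕ d * δ) (fromℤ-+ (part floor) (+ i)) (modulo (m₀ - s) (n*1/n≈1 d)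
      (modulo (- (fromℕ d * γ)) (fromℤ-+ 1ℤ (+ k)) (modulo (fromℕ d) i/d≈k/c
      (solve 10 (λ d δ γ s z m mi i k k⁺ →
        d :* ((mi :- s) :* δ :- (k⁺ :- con 1ℚ :+ z) :* γ) :=
        m :- (d :* ((con 0ℚ :+ z) :* γ) :+ s) :+ d :* δ :* (mi :- (m :+ i)) :+ (m :- s) :* (d :* δ :- con 1ℚ)
        :+ :- (d :* γ) :* (k⁺ :- (con 1ℚ :+ k)) :+ d :* (i :* δ :- k :* γ))
        ≈-refl (fromℕ d) δ γ s z m₀ (fromℤ (part floor ℤ.+ + i)) (fromℕ i) (fromℕ k) (fromℤ (+ suc k))))))) C<A)

    next-< : tC (+ suc k) < (fromℤ (part floor ℤ.+ + suc i) - s) * δ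
    next-< = <-scale (0<1/n d)
      (modulo (- δ) (fromℤ-+ (part floor) (+ suc i)) (modulo (- δ) (fromℤ-+ 1ℤ (+ i))
      (modulo (- (z * γ)) (n*1/n≈1 d) (modulo δ (fromℤ-suc (part floor))
      (modulo γ (fromℤ-+ 1ℤ (+ k)) (modulo (- 1ℝ) i/d≈k/c
      (solve 12 (λ d δ γ s z m m⁺ mi i i⁺ k k⁺ →
        δ :* (m⁺ :- (d :* ((con 0ℚ :+ z) :* γ) :+ s)) :=
        (mi :- s) :* δ :- (k⁺ :- con 1ℚ :+ z) :* γ :+ :- δ :* (mi :- (m :+ i⁺)) :+ :- δ :* (i⁺ :- (con 1ℚ :+ i))
        :+ :- (z :* γ) :* (d :* δ :- con 1ℚ) :+ δ :* (m⁺ :- (m :+ con 1ℚ))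
        :+ γ :* (k⁺ :- (con 1ℚ :+ k)) :+ :- (con 1ℚ) :* (i :* δ :- k :* γ))
        ≈-refl (fromℕ d) δ γ s z m₀ (fromℤ (part floor ℤ.+ 1ℤ)) (fromℤ (part floor ℤ.+ + suc i)) (fromℕ i) (fromℕ (suc i))
          (fromℕ k) (fromℤ (+ suc k))))))))) (upper floor)

  reciprocity : ∑[ μ < c ] gC (+ toℕ μ) ≈ ∑[ μ < b ] gB (+ toℕ μ) + - ∑[ μ < a ] gA (+ toℕ μ)
  -- The period starts just before the C-event at time z/c, with simultaneous events of A and B
  -- already counted; hence the initial m and n are the integer parts of az/c + x and bz/c + y.
  reciprocity = with-integerPart (wC₁ (fromℤ (+ 0))) λ f₁ → with-integerPart (wC₂ (fromℤ (+ 0))) λ f₂ → from-start f₁ f₂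
    where
    from-start : IntegerPart (wC₁ (fromℤ (+ 0))) → IntegerPart (wC₂ (fromℤ (+ 0))) →
                 ∑[ μ < c ] gC (+ toℕ μ) ≈ ∑[ μ < b ] gB (+ toℕ μ) + - ∑[ μ < a ] gA (+ toℕ μ)
    from-start f₁ f₂ = modulo 1ℝ closed (solve 4 (λ φ A B C →
        C := B :+ :- A :+ con 1ℚ :* (φ :- (φ :+ (:- A :+ B :+ :- C)))) ≈-refl
        (φ (m₀ ℤ.+ + 0) (n₀ ℤ.+ + 0) (+ 0)) (∑[ μ < a ] gA (+ toℕ μ)) (∑[ μ < b ] gB (+ toℕ μ)) (∑[ μ < c ] gC (+ toℕ μ)))
      where
      m₀ n₀ : ℤ
      m₀ = part f₁
      n₀ = part f₂

      A B C : ℕ → ℝ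
      A i = tA (m₀ ℤ.+ + i)
      B j = tB (n₀ ℤ.+ + j)
      C l = tC (+ l)

      +suc : ∀ m i → m ℤ.+ + suc i ≡ m ℤ.+ + i ℤ.+ 1ℤ
      +suc m i = ≡.trans (≡.cong (λ j → m ℤ.+ + j) (ℕₚ.+-comm 1 i)) (≡.sym (ℤₚ.+-assoc m (+ i) 1ℤ))

      C-suc : ∀ l → C l < C (suc l)
      C-suc l = <-transport (solve 4 (λ z γ k k⁺ →
          (k⁺ :+ (:- con 1ℚ :+ z)) :* γ :- (k :+ (:- con 1ℚ :+ z)) :* γ := (k⁺ :- con 1ℚ :+ z) :* γ :- (k :- con 1ℚ :+ z) :* γ)
          ≈-refl z γ (fromℤ (+ l)) (fromℤ (+ suc l)))
        (≡.subst (λ k → (fromℤ (+ l) + (- 1ℝ + z)) * γ < (fromℤ k + (- 1ℝ + z)) * γ) (≡.sym (+suc (+ 0) l))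
          (time-suc c (- 1ℝ + z) (+ l)))

      A-suc : ∀ i → A i < A (suc i)
      A-suc i = ≡.subst (λ m → A i < tA m) (≡.sym (+suc m₀ i)) (time-suc a (- x) (m₀ ℤ.+ + i))

      B-suc : ∀ j → B j < B (suc j)
      B-suc j = ≡.subst (λ n → B j < tB n) (≡.sym (+suc n₀ j)) (time-suc b (- y) (n₀ ℤ.+ + j))

      open Merge A B C A-suc B-suc C-suc

      initial : Valid 0 0 0
      initial = valid-before-C FA.≤-next FA.next-< FB.≤-next FB.next-<
        where
        agree : ∀ δ → 0ℝ * δ ≈ 0ℝ * γ
        agree δ = ≈-trans (R.zeroˡ δ) (≈-sym (R.zeroˡ γ))
        module FA = Bracket a x f₁ 0 0 (agree α)
        module FB = Bracket b y f₂ 0 0 (agree β)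

      final : Valid a b c
      final = valid-before-C FA.≤-next FA.next-< FB.≤-next FB.next-<
        where
        module FA = Bracket a x f₁ a c (≈-trans aα≈1 (≈-sym cγ≈1))
        module FB = Bracket b y f₂ b c (≈-trans bβ≈1 (≈-sym cγ≈1))

      JA JB JC : ℕ → ℝ
      JA i = - gA (ℤ.- (m₀ ℤ.+ + suc i))
      JB j = gB (ℤ.- (n₀ ℤ.+ + suc j))
      JC l = - gC (+ l)

      sumA : accumulate JA a ≈ - ∑[ μ < a ] gA (+ toℕ μ)
      sumA = ≈-trans (accumulate-neg (λ i → gA (ℤ.- (m₀ ℤ.+ + suc i))) a)
        (-‿cong (≈-trans (sum-descending gA m₀ a) (sum-cyclic gA a gA-periodic (ℤ.- (m₀ ℤ.+ + a)))))

      sumB : accumulate JB b ≈ ∑[ μ < b ] gB (+ toℕ μ)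
      sumB = ≈-trans (sum-descending gB n₀ b) (sum-cyclic gB b gB-periodic (ℤ.- (n₀ ℤ.+ + b)))

      -- As `k` starts at 0, these indices already are 0, ..., c - 1; the other two sums start at
      -- unknown integer parts and need periodicity.
      sumC : accumulate JC c ≈ - ∑[ μ < c ] gC (+ toℕ μ)
      sumC = ≈-trans (accumulate-neg (λ l → gC (+ l)) c) (-‿cong (accumulate≈sum (λ l → gC (+ l)) c))

      closed : φ (m₀ ℤ.+ + 0) (n₀ ℤ.+ + 0) (+ 0) ≈ φ (m₀ ℤ.+ + 0) (n₀ ℤ.+ + 0) (+ 0) +
               (- ∑[ μ < a ] gA (+ toℕ μ) + ∑[ μ < b ] gB (+ toℕ μ) + - ∑[ μ < c ] gC (+ toℕ μ))
      closed = begin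
        φ (m₀ ℤ.+ + 0) (n₀ ℤ.+ + 0) (+ 0)
          ≡⟨ ≡.cong₂ (λ m n → φ m n (+ 0)) (ℤₚ.+-identityʳ m₀) (ℤₚ.+-identityʳ n₀) ⟩
        φ m₀ n₀ (+ 0)
          ≈⟨ φ-periodic m₀ n₀ ⟨
        φ (m₀ ℤ.+ + a) (n₀ ℤ.+ + b) (+ c)
          ≈⟨ sum-of-jumps (λ i j l → φ (m₀ ℤ.+ + i) (n₀ ℤ.+ + j) (+ l)) JA JB JC
               (λ i j l → stepA {m₀ ℤ.+ + i} {n = n₀ ℤ.+ + j} {k = + l} (+suc m₀ i) (+suc n₀ j) (+suc (+ 0) l))
               (λ i j l → stepB {m₀ ℤ.+ + i} {n = n₀ ℤ.+ + j} {k = + l} (+suc m₀ i) (+suc n₀ j) (+suc (+ 0) l))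
               (λ i j l → stepC {m₀ ℤ.+ + i} {n = n₀ ℤ.+ + j} {k = + l} (+suc m₀ i) (+suc n₀ j) (+suc (+ 0) l))
               initial a b c final ⟩
        φ (m₀ ℤ.+ + 0) (n₀ ℤ.+ + 0) (+ 0) + (accumulate JA a + accumulate JB b + accumulate JC c)
          ≈⟨ R.+-congˡ {φ (m₀ ℤ.+ + 0) (n₀ ℤ.+ + 0) (+ 0)} (+-cong (+-cong sumA sumB) sumC) ⟩
        φ (m₀ ℤ.+ + 0) (n₀ ℤ.+ + 0) (+ 0) +
        (- ∑[ μ < a ] gA (+ toℕ μ) + ∑[ μ < b ] gB (+ toℕ μ) + - ∑[ μ < c ] gC (+ toℕ μ)) ∎

-- Coefficients of the generating functions

^ᶻ-neg : ∀ a .{{_ : NonZero a}} n → a ^ᶻ (ℤ.- (+ n)) ≈ fromℚ (1ℤ ℚ./ a) ^ n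
^ᶻ-neg a zero    = ≈-refl
^ᶻ-neg a (suc n) = ^-congˡ (suc n) (R.*-identityˡ (fromℚ (1ℤ ℚ./ a)))

^ᶻ-1∸suc : ∀ a .{{_ : NonZero a}} n → a ^ᶻ (1ℤ ℤ.- + suc n) ≈ fromℚ (1ℤ ℚ./ a) ^ n
^ᶻ-1∸suc a n = ≈-trans (R.reflexive (≡.cong (a ^ᶻ_) (exponent (+ n)))) (^ᶻ-neg a n)
  where
  open ℤSolver using () renaming (solve to solveℤ; _:=_ to _:≡_; _:+_ to _⊹_; _:-_ to _∸_; :-_ to neg_; con to int)
  exponent : ∀ i → 1ℤ ℤ.- (1ℤ ℤ.+ i) ≡ ℤ.- i
  exponent = solveℤ 1 (λ i → int 1ℤ ∸ (int 1ℤ ⊹ i) :≡ neg i) ≡.refl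

^ᶻ-weight : ∀ c .{{_ : NonZero c}} {i p} q → i ℕ.≤ p →
            c ^ᶻ (1ℤ ℤ.+ + suc i ℤ.- + suc p ℤ.- + suc q) ≈ fromℚ (1ℤ ℚ./ c) ^ (p ℕ.∸ i ℕ.+ q)
^ᶻ-weight c {i} {p} q i≤p = ≈-trans (R.reflexive (≡.cong (c ^ᶻ_) (≡.trans
  (≡.cong (λ n → 1ℤ ℤ.+ + suc i ℤ.- + suc n ℤ.- + suc q) (≡.sym (ℕₚ.m+[n∸m]≡n i≤p)))
  (exponent (+ i) (+ (p ℕ.∸ i)) (+ q))))) (^ᶻ-neg c (p ℕ.∸ i ℕ.+ q))
  where
  open ℤSolver using () renaming (solve to solveℤ; _:=_ to _:≡_; _:+_ to _⊹_; _:-_ to _∸_; :-_ to neg_; con to int)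
  exponent : ∀ i d q → 1ℤ ℤ.+ (1ℤ ℤ.+ i) ℤ.- (1ℤ ℤ.+ (i ℤ.+ d)) ℤ.- (1ℤ ℤ.+ q) ≡ ℤ.- (d ℤ.+ q)
  exponent = solveℤ 3 (λ i d q →
    int 1ℤ ⊹ (int 1ℤ ⊹ i) ∸ (int 1ℤ ⊹ (i ⊹ d)) ∸ (int 1ℤ ⊹ q) :≡ neg (d ⊹ q)) ≡.refl

∑-exchange : ∀ {k n} (s : Fin n → ℝ) (κ : Fin k → ℝ) (f g : Fin k → Fin n → ℝ) →
  ∑[ μ < n ] (s μ * ∑[ i < k ] (κ i * (f i μ * g i μ))) ≈ ∑[ i < k ] (κ i * ∑[ μ < n ] (s μ * f i μ * g i μ))
∑-exchange {k} {n} s κ f g = begin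
  ∑[ μ < n ] (s μ * ∑[ i < k ] (κ i * (f i μ * g i μ)))
    ≈⟨ sum-cong-≋ {n} (λ μ → *-distribˡ-sum {k} (s μ) (λ i → κ i * (f i μ * g i μ))) ⟩
  ∑[ μ < n ] ∑[ i < k ] (s μ * (κ i * (f i μ * g i μ)))
    ≈⟨ ∑-comm {n} {k} (λ μ i → s μ * (κ i * (f i μ * g i μ))) ⟩
  ∑[ i < k ] ∑[ μ < n ] (s μ * (κ i * (f i μ * g i μ)))
    ≈⟨ sum-cong-≋ {k} (λ i → sum-cong-≋ {n} (λ μ →
         solve 4 (λ s κ f g → s :* (κ :* (f :* g)) := κ :* (s :* f :* g)) ≈-refl (s μ) (κ i) (f i μ) (g i μ))) ⟩
  ∑[ i < k ] ∑[ μ < n ] (κ i * (s μ * f i μ * g i μ))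
    ≈⟨ sum-cong-≋ {k} (λ i → *-distribˡ-sum {n} (κ i) (λ μ → s μ * f i μ * g i μ)) ⟨
  ∑[ i < k ] (κ i * ∑[ μ < n ] (s μ * f i μ * g i μ)) ∎

-- Only the X-degree is distributed: i = j - 1 goes to the factor in αX, and the rest joins the full
-- Y-degree q in the factor in γ(X + Y).
row-coefficient : ∀ α γ (f g : ℕ → ℝ) p q → (subst γ γ f ⊠ subst α 0ℝ g) p q ≈
  ∑[ i < suc p ] (fromℕ (p C toℕ i) * α ^ toℕ i * γ ^ (p ℕ.∸ toℕ i ℕ.+ q) * (f (p ℕ.∸ toℕ i ℕ.+ q) * g (toℕ i)))
row-coefficient α γ f g p q = begin
  (subst γ γ f ⊠ subst α 0ℝ g) p q
    ≈⟨ ⊠-comm (subst γ γ f) (subst α 0ℝ g) p q ⟩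
  (subst α 0ℝ g ⊠ subst γ γ f) p q
    ≈⟨ ⊠-rowˡ p q (subst α 0ℝ g) (subst γ γ f) (∂₂-subst-0 α g) ⟩
  ((λ i → subst α 0ℝ g i 0) ⊙ (λ i → subst γ γ f i q)) p
    ≈⟨ ⊙-binomial p (λ i → subst α 0ℝ g i 0) (λ i → subst γ γ f i q) ⟩
  _
    ≈⟨ sum-cong-≋ {suc p} (λ i → term (toℕ i)) ⟩
  ∑[ i < suc p ] (fromℕ (p C toℕ i) * α ^ toℕ i * γ ^ (p ℕ.∸ toℕ i ℕ.+ q) * (f (p ℕ.∸ toℕ i ℕ.+ q) * g (toℕ i))) ∎
  where
  term : ∀ i → (p C i) ×ᴿ (α ^ i * 1ℝ * g (i ℕ.+ 0) * (γ ^ (p ℕ.∸ i) * γ ^ q * f (p ℕ.∸ i ℕ.+ q))) ≈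
               fromℕ (p C i) * α ^ i * γ ^ (p ℕ.∸ i ℕ.+ q) * (f (p ℕ.∸ i ℕ.+ q) * g i)
  term i = begin
    (p C i) ×ᴿ (α ^ i * 1ℝ * g (i ℕ.+ 0) * (γ ^ (p ℕ.∸ i) * γ ^ q * F))
      ≈⟨ fromℕ*≈× (p C i) _ ⟨
    fromℕ (p C i) * (α ^ i * 1ℝ * g (i ℕ.+ 0) * (γ ^ (p ℕ.∸ i) * γ ^ q * F))
      ≈⟨ R.*-congˡ {fromℕ (p C i)} (*-cong (R.*-congˡ {α ^ i * 1ℝ} (R.reflexive (≡.cong g (ℕₚ.+-identityʳ i))))
           (R.*-congʳ {F} (≈-sym (^-homo-* γ (p ℕ.∸ i) q)))) ⟩
    fromℕ (p C i) * (α ^ i * 1ℝ * g i * (γ ^ (p ℕ.∸ i ℕ.+ q) * F))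
      ≈⟨ solve 5 (λ C A g G F → C :* (A :* con 1ℚ :* g :* (G :* F)) := C :* A :* G :* (F :* g)) ≈-refl
           (fromℕ (p C i)) (α ^ i) (g i) (γ ^ (p ℕ.∸ i ℕ.+ q)) F ⟩
    fromℕ (p C i) * α ^ i * γ ^ (p ℕ.∸ i ℕ.+ q) * (F * g i) ∎
    where
    F : ℝ
    F = f (p ℕ.∸ i ℕ.+ q)

-- The variable -Y contributes (-1)^h with h one less than in the theorem; the minus sign before the
-- sum of the `gA` supplies the missing factor.
column-coefficient : ∀ β γ (f g : ℕ → ℝ) p q → (subst γ γ f ⊠ subst 0ℝ (- β) g) p q ≈
  ∑[ h < suc q ] (fromℕ (q C toℕ h) * (- 1ℝ) ^ toℕ h * β ^ toℕ h * γ ^ (q ℕ.∸ toℕ h ℕ.+ p) * (f (q ℕ.∸ toℕ h ℕ.+ p) * g (toℕ h)))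
column-coefficient β γ f g p q = begin
  (subst γ γ f ⊠ subst 0ℝ (- β) g) p q
    ≈⟨ ⊠-comm (subst γ γ f) (subst 0ℝ (- β) g) p q ⟩
  (subst 0ℝ (- β) g ⊠ subst γ γ f) p q
    ≈⟨ ⊠-columnˡ p q (subst 0ℝ (- β) g) (subst γ γ f) (∂₁-subst-0 (- β) g) ⟩
  (subst 0ℝ (- β) g 0 ⊙ subst γ γ f p) q
    ≈⟨ ⊙-binomial q (subst 0ℝ (- β) g 0) (subst γ γ f p) ⟩
  _
    ≈⟨ sum-cong-≋ {suc q} (λ h → term (toℕ h)) ⟩
  ∑[ h < suc q ] (fromℕ (q C toℕ h) * (- 1ℝ) ^ toℕ h * β ^ toℕ h * γ ^ (q ℕ.∸ toℕ h ℕ.+ p) * (f (q ℕ.∸ toℕ h ℕ.+ p) * g (toℕ h))) ∎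
  where
  power : ∀ h → (- β) ^ h ≈ (- 1ℝ) ^ h * β ^ h
  power h = ≈-trans (^-congˡ h (solve 1 (λ β → :- β := :- con 1ℚ :* β) ≈-refl β)) (^-distrib-* (- 1ℝ) β h)

  term : ∀ h → (q C h) ×ᴿ (1ℝ * (- β) ^ h * g h * (γ ^ p * γ ^ (q ℕ.∸ h) * f (p ℕ.+ (q ℕ.∸ h)))) ≈
               fromℕ (q C h) * (- 1ℝ) ^ h * β ^ h * γ ^ (q ℕ.∸ h ℕ.+ p) * (f (q ℕ.∸ h ℕ.+ p) * g h)
  term h = begin
    (q C h) ×ᴿ (1ℝ * (- β) ^ h * g h * (γ ^ p * γ ^ (q ℕ.∸ h) * f (p ℕ.+ (q ℕ.∸ h))))
      ≈⟨ fromℕ*≈× (q C h) _ ⟨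
    fromℕ (q C h) * (1ℝ * (- β) ^ h * g h * (γ ^ p * γ ^ (q ℕ.∸ h) * f (p ℕ.+ (q ℕ.∸ h))))
      ≈⟨ R.*-congˡ {fromℕ (q C h)} (*-cong (R.*-congʳ {g h} (R.*-congˡ {1ℝ} (power h)))
           (*-cong (≈-trans (R.*-comm (γ ^ p) (γ ^ (q ℕ.∸ h))) (≈-sym (^-homo-* γ (q ℕ.∸ h) p)))
                   (R.reflexive (≡.cong f (ℕₚ.+-comm p (q ℕ.∸ h)))))) ⟩
    fromℕ (q C h) * (1ℝ * ((- 1ℝ) ^ h * β ^ h) * g h * (γ ^ (q ℕ.∸ h ℕ.+ p) * F))
      ≈⟨ solve 6 (λ C S B g G F → C :* (con 1ℚ :* (S :* B) :* g :* (G :* F)) := C :* S :* B :* G :* (F :* g)) ≈-refl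
           (fromℕ (q C h)) ((- 1ℝ) ^ h) (β ^ h) (g h) (γ ^ (q ℕ.∸ h ℕ.+ p)) F ⟩
    fromℕ (q C h) * (- 1ℝ) ^ h * β ^ h * γ ^ (q ℕ.∸ h ℕ.+ p) * (F * g h) ∎
    where
    F : ℝ
    F = f (q ℕ.∸ h ℕ.+ p)

weight-index : ∀ {i p} q → i ℕ.≤ p → (suc p ℕ.+ suc q ℕ.∸ suc i) ℕ.∸ 1 ≡ p ℕ.∸ i ℕ.+ q
weight-index {i} {p} q i≤p = ≡.cong ℕ.pred
  (≡.trans (ℕₚ.+-∸-comm (suc q) i≤p) (ℕₚ.+-suc (p ℕ.∸ i) q))

theorem2 : (ℰ : ℕ → ℝ → ℝ) → (∀ n → IsEulerFunction n (ℰ n)) →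
    (a b c : ℕ) .{{_ : NonZero a}} .{{_ : NonZero b}} .{{_ : NonZero c}} →
    Coprime a b → Coprime a c → Coprime b c →
    2 ∣ (a ℕ.+ b ℕ.+ c) →
    (p q : ℕ) → 1 ℕ.≤ p → 1 ℕ.≤ q →
    (x y z : ℝ) →
    a ^ᶻ (1ℤ ℤ.- + p) * b ^ᶻ (1ℤ ℤ.- + q) * S ℰ p q (+ a) (+ b) c x y z
    ≈
    ∑[1≤ j ≤ p ]
    ( fromℕ ((p ℕ.∸ 1) C (j ℕ.∸ 1))
    * a ^ᶻ (1ℤ ℤ.- + j)
    * c ^ᶻ (1ℤ ℤ.+ + j ℤ.- + p ℤ.- + q)
    * S ℰ (p ℕ.+ q ℕ.∸ j) j (+ c) (ℤ.- (+ a)) b z x y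
    )
    +
    ∑[1≤ h ≤ q ]
    ( fromℕ ((q ℕ.∸ 1) C (h ℕ.∸ 1))
    * (- 1ℝ) ^ h
    * b ^ᶻ (1ℤ ℤ.- + h)
    * c ^ᶻ (1ℤ ℤ.+ + h ℤ.- + p ℤ.- + q)
    * S ℰ (p ℕ.+ q ℕ.∸ h) h (+ c) (+ b) a z (- y) x
    )
theorem2 ℰ isEuler a b c _ _ _ 2∣a+b+c (suc p) (suc q) _ _ x y z = begin
  a ^ᶻ (1ℤ ℤ.- + suc p) * b ^ᶻ (1ℤ ℤ.- + suc q) * S ℰ (suc p) (suc q) (+ a) (+ b) c x y z
    ≈⟨ left ⟩
  ∑[ μ < c ] gC (+ toℕ μ)
    ≈⟨ reciprocity ⟩
  ∑[ μ < b ] gB (+ toℕ μ) + - ∑[ μ < a ] gA (+ toℕ μ)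
    ≈⟨ +-cong right₁ right₂ ⟩
  _ ∎
  where
  open Reciprocity ℰ isEuler a b c 2∣a+b+c x y z p q

  left : a ^ᶻ (1ℤ ℤ.- + suc p) * b ^ᶻ (1ℤ ℤ.- + suc q) * S ℰ (suc p) (suc q) (+ a) (+ b) c x y z ≈
         ∑[ μ < c ] gC (+ toℕ μ)
  left = begin
    a ^ᶻ (1ℤ ℤ.- + suc p) * b ^ᶻ (1ℤ ℤ.- + suc q) * S ℰ (suc p) (suc q) (+ a) (+ b) c x y z
      ≈⟨ R.*-congʳ {S ℰ (suc p) (suc q) (+ a) (+ b) c x y z} (*-cong (^ᶻ-1∸suc a p) (^ᶻ-1∸suc b q)) ⟩
    α ^ p * β ^ q * S ℰ (suc p) (suc q) (+ a) (+ b) c x y z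
      ≈⟨ *-distribˡ-sum {c} (α ^ p * β ^ q)
           (λ μ → sign (+ toℕ μ) * ℰ p (wC₁ (fromℕ (toℕ μ))) * ℰ q (wC₂ (fromℕ (toℕ μ)))) ⟩
    ∑[ μ < c ] (α ^ p * β ^ q * (sign (+ toℕ μ) * ℰ p (wC₁ (fromℕ (toℕ μ))) * ℰ q (wC₂ (fromℕ (toℕ μ)))))
      ≈⟨ sum-cong-≋ {c} (λ μ → ≈-sym (term (+ toℕ μ))) ⟩
    ∑[ μ < c ] gC (+ toℕ μ) ∎
    where
    term : ∀ μ → gC μ ≈ α ^ p * β ^ q * (sign μ * ℰ p (wC₁ (fromℤ μ)) * ℰ q (wC₂ (fromℤ μ)))
    term μ = begin
      sign μ * (subst α 0ℝ f ⊠ subst 0ℝ β g) p q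
        ≈⟨ R.*-congˡ {sign μ} (⊠-row-column p q (subst α 0ℝ f) (subst 0ℝ β g) (∂₂-subst-0 α f) (∂₁-subst-0 β g)) ⟩
      sign μ * (α ^ p * 1ℝ * f (p ℕ.+ 0) * (1ℝ * β ^ q * g q))
        ≈⟨ R.*-congˡ {sign μ} (R.*-congʳ {1ℝ * β ^ q * g q} (R.*-congˡ {α ^ p * 1ℝ} (R.reflexive (≡.cong f (ℕₚ.+-identityʳ p))))) ⟩
      sign μ * (α ^ p * 1ℝ * f p * (1ℝ * β ^ q * g q))
        ≈⟨ solve 5 (λ s A B f g → s :* (A :* con 1ℚ :* f :* (con 1ℚ :* B :* g)) := A :* B :* (s :* f :* g)) ≈-refl
             (sign μ) (α ^ p) (β ^ q) (f p) (g q) ⟩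
      α ^ p * β ^ q * (sign μ * f p * g q) ∎
      where
      f g : ℕ → ℝ
      f n = ℰ n (wC₁ (fromℤ μ))
      g n = ℰ n (wC₂ (fromℤ μ))

  fB₁ fB₂ : ℕ → Fin b → ℝ
  fB₁ n μ = ℰ n (wB₁ (fromℕ (toℕ μ)))
  fB₂ n μ = ℰ n (wB₂ (fromℕ (toℕ μ)))

  fA₁ fA₂ : ℕ → Fin a → ℝ
  fA₁ n μ = ℰ n (wA₁ (fromℕ (toℕ μ)))
  fA₂ n μ = ℰ n (wA₂ (fromℕ (toℕ μ)))

  κ₁ : ℕ → ℝ
  κ₁ i = fromℕ (p C i) * α ^ i * γ ^ (p ℕ.∸ i ℕ.+ q)

  κ₂ : ℕ → ℝ
  κ₂ h = fromℕ (q C h) * (- 1ℝ) ^ h * β ^ h * γ ^ (q ℕ.∸ h ℕ.+ p)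

  right₁ : ∑[ μ < b ] gB (+ toℕ μ) ≈ ∑[ i < suc p ]
    ( fromℕ (p C toℕ i) * a ^ᶻ (1ℤ ℤ.- + suc (toℕ i)) * c ^ᶻ (1ℤ ℤ.+ + suc (toℕ i) ℤ.- + suc p ℤ.- + suc q)
    * S ℰ (suc p ℕ.+ suc q ℕ.∸ suc (toℕ i)) (suc (toℕ i)) (+ c) (ℤ.- (+ a)) b z x y )
  right₁ = begin
    ∑[ μ < b ] gB (+ toℕ μ)
      ≈⟨ sum-cong-≋ {b} (λ μ → R.*-congˡ {sign (+ toℕ μ)} (row-coefficient α γ (λ n → fB₁ n μ) (λ n → fB₂ n μ) p q)) ⟩
    ∑[ μ < b ] (sign (+ toℕ μ) * ∑[ i < suc p ] (κ₁ (toℕ i) * (fB₁ (p ℕ.∸ toℕ i ℕ.+ q) μ * fB₂ (toℕ i) μ)))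
      ≈⟨ ∑-exchange {suc p} {b} (λ μ → sign (+ toℕ μ)) (λ i → κ₁ (toℕ i)) (λ i → fB₁ (p ℕ.∸ toℕ i ℕ.+ q)) (λ i → fB₂ (toℕ i)) ⟩
    ∑[ i < suc p ] (κ₁ (toℕ i) * ∑[ μ < b ] (sign (+ toℕ μ) * fB₁ (p ℕ.∸ toℕ i ℕ.+ q) μ * fB₂ (toℕ i) μ))
      ≈⟨ sum-cong-≋ {suc p} (λ i → term (toℕ i) (Finₚ.toℕ≤pred[n] i)) ⟩
    _ ∎
    where
    term : ∀ i → i ℕ.≤ p → κ₁ i * ∑[ μ < b ] (sign (+ toℕ μ) * fB₁ (p ℕ.∸ i ℕ.+ q) μ * fB₂ i μ) ≈
      fromℕ (p C i) * a ^ᶻ (1ℤ ℤ.- + suc i) * c ^ᶻ (1ℤ ℤ.+ + suc i ℤ.- + suc p ℤ.- + suc q)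
      * S ℰ (suc p ℕ.+ suc q ℕ.∸ suc i) (suc i) (+ c) (ℤ.- (+ a)) b z x y
    term i i≤p = *-cong
      (*-cong (R.*-congˡ {fromℕ (p C i)} (≈-sym (^ᶻ-1∸suc a i))) (≈-sym (^ᶻ-weight c q i≤p)))
      (R.reflexive (≡.cong (λ n → ∑[ μ < b ] (sign (+ toℕ μ) * fB₁ n μ * fB₂ i μ)) (≡.sym (weight-index q i≤p))))

  right₂ : - ∑[ μ < a ] gA (+ toℕ μ) ≈ ∑[ h < suc q ]
    ( fromℕ (q C toℕ h) * (- 1ℝ) ^ suc (toℕ h) * b ^ᶻ (1ℤ ℤ.- + suc (toℕ h))
    * c ^ᶻ (1ℤ ℤ.+ + suc (toℕ h) ℤ.- + suc p ℤ.- + suc q)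
    * S ℰ (suc p ℕ.+ suc q ℕ.∸ suc (toℕ h)) (suc (toℕ h)) (+ c) (+ b) a z (- y) x )
  right₂ = begin
    - ∑[ μ < a ] gA (+ toℕ μ)
      ≈⟨ -‿cong (sum-cong-≋ {a} (λ μ → R.*-congˡ {sign (+ toℕ μ)} (column-coefficient β γ (λ n → fA₁ n μ) (λ n → fA₂ n μ) p q))) ⟩
    - ∑[ μ < a ] (sign (+ toℕ μ) * ∑[ h < suc q ] (κ₂ (toℕ h) * (fA₁ (q ℕ.∸ toℕ h ℕ.+ p) μ * fA₂ (toℕ h) μ)))
      ≈⟨ -‿cong (∑-exchange {suc q} {a} (λ μ → sign (+ toℕ μ)) (λ h → κ₂ (toℕ h)) (λ h → fA₁ (q ℕ.∸ toℕ h ℕ.+ p)) (λ h → fA₂ (toℕ h))) ⟩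
    - ∑[ h < suc q ] (κ₂ (toℕ h) * T (toℕ h))
      ≈⟨ solve 1 (λ s → :- s := :- con 1ℚ :* s) ≈-refl (∑[ h < suc q ] (κ₂ (toℕ h) * T (toℕ h))) ⟩
    - 1ℝ * ∑[ h < suc q ] (κ₂ (toℕ h) * T (toℕ h))
      ≈⟨ *-distribˡ-sum {suc q} (- 1ℝ) (λ h → κ₂ (toℕ h) * T (toℕ h)) ⟩
    ∑[ h < suc q ] (- 1ℝ * (κ₂ (toℕ h) * T (toℕ h)))
      ≈⟨ sum-cong-≋ {suc q} (λ h → term (toℕ h) (Finₚ.toℕ≤pred[n] h)) ⟩
    _ ∎
    where
    T : ℕ → ℝ
    T h = ∑[ μ < a ] (sign (+ toℕ μ) * fA₁ (q ℕ.∸ h ℕ.+ p) μ * fA₂ h μ)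

    term : ∀ h → h ℕ.≤ q → - 1ℝ * (κ₂ h * T h) ≈
      fromℕ (q C h) * (- 1ℝ) ^ suc h * b ^ᶻ (1ℤ ℤ.- + suc h) * c ^ᶻ (1ℤ ℤ.+ + suc h ℤ.- + suc p ℤ.- + suc q)
      * S ℰ (suc p ℕ.+ suc q ℕ.∸ suc h) (suc h) (+ c) (+ b) a z (- y) x
    term h h≤q = ≈-trans
      (solve 5 (λ C S B G T → :- con 1ℚ :* (C :* S :* B :* G :* T) := C :* (:- con 1ℚ :* S) :* B :* G :* T) ≈-refl
        (fromℕ (q C h)) ((- 1ℝ) ^ h) (β ^ h) (γ ^ (q ℕ.∸ h ℕ.+ p)) (T h))
      -- The index lemmas name the distributed degree first, so `p` and `q` have to be exchanged
      -- before they apply.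
      (*-cong
        (*-cong (R.*-congˡ {fromℕ (q C h) * (- 1ℝ) ^ suc h} (≈-sym (^ᶻ-1∸suc b h)))
          (≈-sym (≈-trans (R.reflexive (≡.cong (c ^ᶻ_) (swap (+ suc p) (+ suc q)))) (^ᶻ-weight c p h≤q))))
        (R.reflexive (≡.cong (λ n → ∑[ μ < a ] (sign (+ toℕ μ) * fA₁ n μ * fA₂ h μ))
          (≡.sym (≡.trans (≡.cong (λ n → (n ℕ.∸ suc h) ℕ.∸ 1) (ℕₚ.+-comm (suc p) (suc q))) (weight-index p h≤q))))))
      where
      swap : ∀ i j → 1ℤ ℤ.+ + suc h ℤ.- i ℤ.- j ≡ 1ℤ ℤ.+ + suc h ℤ.- j ℤ.- i
      swap i j = ℤS.solve 3 (λ k i j → k ℤS.:- i ℤS.:- j ℤS.:= k ℤS.:- j ℤS.:- i) ≡.refl (1ℤ ℤ.+ + suc h) i j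
        where module ℤS = ℤSolver
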